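{- Let $k\geq a\geq 1$ be integers with $k\not\equiv a \pmod 2$. Then \[ \sum_{n_1, n_2, \ldots, n_{k-1}\geq 0} \frac{q^{N_1^2+N_2^2+\cdots+N_{k-1}^2+2N_a+2N_{a+2}+\cdots+2N_{k-1}}\,(-q;q^2)_{n_{k-1}}} {(q^2;q^2)_{n_1}(q^2;q^2)_{n_2}\cdots(q^2;q^2)_{n_{k-2}}(q^4;q^4)_{n_{k-1}}} =\frac{(-q;q^2)_{\infty}\,(q^a,q^{2k+2-a},q^{2k+2};q^{2k+2})_{\infty}}{(q^2;q^2)_{\infty}}, \] where $N_i=n_i+n_{i+1}+\cdots+n_{k-1}$ for $1\le i\le k-1$ (so $n_i=N_i-N_{i+1}$ with $N_k=0$).
   Context: Standard $q$-series notation: $(a;q)_\infty=\prod_{j\ge0}(1-aq^j)$, $(a;q)_n=(a;q)_\infty/(aq^n;q)_\infty$, and $(a_1,\ldots,a_m;q)_\infty=(a_1;q)_\infty\cdots(a_m;q)_\infty$. The identity is one of formal power series in $q$ (equivalently, of analytic functions for $|q|<1$). Since $k-1\equiv a \pmod 2$, the linear terms in the exponent are $2N_j$ for $j=a,a+2,\ldots,k-1$. -}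

module Defs where

open import Data.Nat as ℕ using (ℕ; zero; suc; _+_; _*_; _∸_; _≡ᵇ_; _<_; ⌊_/2⌋)
open import Data.Integer as ℤ using (ℤ; +_; -[1+_])
open import Data.Bool using (if_then_else_)
open import Data.List as List using (List; []; _∷_)
open import Data.Vec as Vec using (Vec)
open import Data.Nat.ListAction using (sum)
open import Data.Vec.Relation.Unary.All using (All)
open import Data.Product using (∃-syntax; _×_)
open import Relation.Binary.PropositionalEquality using (_≡_)
open import Relation.Nullary using (¬_)

-- Formal power series in q over ℤ, as coefficient sequences.

PS : Set
PS = ℕ → ℤ

Σ< : ℕ → (ℕ → ℤ) → ℤ
Σ< zero    f = + 0
Σ< (suc n) f = Σ< n f ℤ.+ f n

sumℕ : ℕ → (ℕ → ℕ) → ℕ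
sumℕ zero    f = 0
sumℕ (suc n) f = sumℕ n f + f n

one : PS
one zero    = + 1
one (suc _) = + 0

mono : ℕ → PS
mono e m = if e ≡ᵇ m then + 1 else + 0

infixl 6 _⊕_
infixl 7 _⊛_
infixr 8 _·_

_⊕_ : PS → PS → PS
(f ⊕ g) m = f m ℤ.+ g m

_·_ : ℤ → PS → PS
(c · f) m = c ℤ.* f m

_⊛_ : PS → PS → PS
(f ⊛ g) m = Σ< (suc m) (λ i → f i ℤ.* g (m ∸ i))

prodPS : ℕ → (ℕ → PS) → PS
prodPS zero    F = one
prodPS (suc n) F = prodPS n F ⊛ F n

-- Multiplicative inverse of a series f with constant term f 0 = 1,
-- via the standard recurrence b 0 = 1, b m = - Σ_{i=1}^{m} f i * b (m - i).
-- invList f n = [b n , b (n-1) , … , b 0].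
private
  dot : PS → ℕ → List ℤ → ℤ
  dot f j []       = + 0
  dot f j (b ∷ bs) = f j ℤ.* b ℤ.+ dot f (suc j) bs

  hd : List ℤ → ℤ
  hd []      = + 0
  hd (x ∷ _) = x

invList : PS → ℕ → List ℤ
invList f zero    = + 1 ∷ []
invList f (suc n) = (ℤ.- dot f 1 (invList f n)) ∷ invList f n

inv : PS → PS
inv f m = hd (invList f m)

-- q-Pochhammer symbols, with base a = ε q^c (ε ∈ ℤ) and nome q^d.

factor : ℤ → ℕ → PS
factor ε e = one ⊕ (ℤ.- ε) · mono e

poch : ℤ → ℕ → ℕ → ℕ → PS
poch ε c d zero    = one
poch ε c d (suc n) = poch ε c d n ⊛ factor ε (c + d * n)

-- (ε q^c ; q^d)_∞ for d ≥ 1: the coefficient of q^m of the infinite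
-- product equals that of the finite product of the first m+1 factors
-- (every later factor is 1 + O(q^{m+1})); this is the definition here.
pochInf : ℤ → ℕ → ℕ → PS
pochInf ε c d m = poch ε c d (suc m) m

boxSum : (K B : ℕ) → (Vec ℕ K → ℤ) → ℤ
boxSum zero    B F = F Vec.[]
boxSum (suc K) B F = Σ< B (λ x → boxSum K B (λ v → F (x Vec.∷ v)))

-- The family F is (formally, coefficientwise) summable with sum S:
-- for every m only finitely many members have a nonzero q^m coefficient
-- (all lie in some box [0,B)^K) and the q^m coefficients add up to S m.
HasSum : (K : ℕ) → (Vec ℕ K → PS) → PS → Set
HasSum K F S = ∀ m → ∃[ B ]
  ((∀ v → ¬ All (_< B) v → F v m ≡ + 0) × boxSum K B (λ v → F v m) ≡ S m)

private
  hdℕ : List ℕ → ℕ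
  hdℕ []      = 0
  hdℕ (x ∷ _) = x

-- n_i (1-based) of v = (n_1,…,n_K); 0 out of range
nAt : ∀ {K} → Vec ℕ K → ℕ → ℕ
nAt v i = hdℕ (List.drop (i ∸ 1) (Vec.toList v))

-- N_i = n_i + n_{i+1} + … + n_K (1-based; N_{K+1} = 0)
Nt : ∀ {K} → Vec ℕ K → ℕ → ℕ
Nt v i = sum (List.drop (i ∸ 1) (Vec.toList v))

-- exponent N_1²+…+N_{k-1}² + 2N_a + 2N_{a+2} + … + 2N_{k-1}
-- (the linear part has (k+1-a)/2 terms N_{a+2t}, t = 0,…,(k-1-a)/2)
expo : (k a : ℕ) → Vec ℕ (k ∸ 1) → ℕ
expo k a v =
  sumℕ (k ∸ 1) (λ j → Nt v (suc j) * Nt v (suc j))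
  + 2 * sumℕ ⌊ (k + 1 ∸ a) /2⌋ (λ t → Nt v (a + 2 * t))

denom : (k : ℕ) → Vec ℕ (k ∸ 1) → PS
denom k v = prodPS (k ∸ 2) (λ j → poch (+ 1) 2 2 (nAt v (suc j)))
            ⊛ poch (+ 1) 4 4 (nAt v (k ∸ 1))

lhsTerm : (k a : ℕ) → Vec ℕ (k ∸ 1) → PS
lhsTerm k a v =
  mono (expo k a v) ⊛ poch -[1+ 0 ] 1 2 (nAt v (k ∸ 1)) ⊛ inv (denom k v)

rhs : (k a : ℕ) → PS
rhs k a =
  pochInf -[1+ 0 ] 1 2
  ⊛ pochInf (+ 1) a (2 * k + 2)
  ⊛ pochInf (+ 1) (2 * k + 2 ∸ a) (2 * k + 2)
  ⊛ pochInf (+ 1) (2 * k + 2) (2 * k + 2)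
  ⊛ inv (pochInf (+ 1) 2 2)

{-# OPTIONS --safe #-}

-- Write Q = q² and let I n = 1/(Q;Q)ₙ.  A limiting case of the q-Chu–Vandermonde sum gives, for ε ∈ {0, 1} and
-- ρ σ = Q^(1+ε), a Bailey lemma that turns Σ_j α_j / ((Q;Q)_{s-j} (Q;Q)_{s+j+ε}) into a sum of the same kind after
-- multiplication by σ^s Q^(s(s-1)/2) (-ρ;Q)_s / (Q;Q)_{n-s} and summation over s.  With {ρ, σ} = {q, q³} and ε = 1,
-- or ρ = σ = q and ε = 0, this performs the summation over one Nᵢ, with or without the linear term 2Nᵢ.
-- The innermost factor 1/(Q²;Q²)ₙ comes from the Bailey pair with α_j = (-1)ʲ Q^(j²) (1 - Q^(2j+1)), ε = 1, and two
-- consecutive levels, one of them with the linear term, multiply α_j by q^(2j²+2j).  Below N_a there are no linear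
-- terms; there (1 - Q^(2j+1)) / ((Q;Q)_{n-j} (Q;Q)_{n+j+1}) is rewritten as a difference of two kernels with ε = 0.
-- As n → ∞ the left-hand side becomes (-q;q²)_∞ / (q²;q²)_∞ Σ_{j ∈ ℤ} (-1)ʲ q^((k+1)j² + (k+1-a)j), which is evaluated
-- by the Jacobi triple product.  Its finite form, proved by recurrences in n, also yields the unit Bailey pair from
-- which the innermost pair is derived.
module Submission where

open import Defs
open import Algebra using (CommutativeRing)
open import Algebra.Solver.Ring.AlmostCommutativeRing using (fromCommutativeRing; _-Raw-AlmostCommutative⟶_)
open import Data.Empty using (⊥-elim)
open import Data.Integer as ℤ using (ℤ; +_; -[1+_])
open import Data.List using (List; []; _∷_)
open import Data.Maybe using (Maybe; just; nothing)
open import Data.Nat as ℕ using (ℕ; zero; suc; z≤n; s≤s; _≤_; _<_; _∸_; _%_; _/_; ⌊_/2⌋)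
open import Data.Nat.DivMod using (m≡m%n+[m/n]*n; [m+kn]%n≡m%n; m%n<n)
open import Data.Product using (_,_; ∃-syntax)
open import Data.Sum using (inj₁; inj₂)
open import Data.Vec using (Vec; []; _∷_)
open import Data.Vec.Relation.Unary.All using (All; []; _∷_)
open import Level using (0ℓ; _⊔_)
open import Relation.Binary.PropositionalEquality as ≡ using (_≡_)
open import Relation.Nullary using (¬_; yes; no)
import Algebra.Properties.AbelianGroup
import Algebra.Properties.CommutativeSemiring.Exp
import Algebra.Properties.Ring
import Algebra.Properties.Semiring.Exp
import Algebra.Properties.Semiring.Mult.TCOptimised
import Algebra.Solver.Ring
import Data.Integer.Properties as ℤₚ
import Data.Nat.Properties as ℕₚ
import Data.Nat.Solver
import Relation.Binary.Reasoning.Setoid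

open Data.Nat.Solver.+-*-Solver using ()
  renaming (solve to solveℕ; _:=_ to _:≡_; _:+_ to _⊹_; _:*_ to _⊠_; con to cst)

-- The factor (-q;q²)_{n_{k-1}} starts the chain: a step consumes (-ρ;Q)_s and must hand on a
-- product that no longer depends on j. With ε = 1, a level carrying 2Nᵢ takes (-q;q²)_s and leaves
-- (-q;q²)_{n+1}, while a level without it, where σ = q forces ρ = q³, takes (-q;q²)_{s+1} and
-- leaves (-q;q²)_n. So at ε = 1 the linear terms alternate, which is the pattern N_{k-1}, N_{k-3},
-- ..., N_a. Adjacent levels without a linear term need ρ = σ = q, hence ε = 0. The kernel is
-- therefore changed after N_{a-1}, where the factor 1 - Q^(2j+1) has come back. Division and limits
-- are avoided. Reciprocals are sequences with their defining equations in an arbitrary commutative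
-- ring in which q is nilpotent, so n → ∞ becomes n = 2M with q^M = 0: in a sum over j + t = 2M
-- either j ≥ M and the term vanishes, or t ≥ M and the finite products have become constant.

-- Ring solver with integer coefficients

module IntegerSolver {c ℓ} (R : CommutativeRing c ℓ) where
  open CommutativeRing R
  open Algebra.Properties.Semiring.Mult.TCOptimised semiring
    using (_×_; ×-homo-+; ×1-homo-*; 1+×)
  open Algebra.Properties.Ring ring
    using (-‿distribˡ-*; -‿distribʳ-*; -0#≈0#; -‿involutive)
  open Algebra.Properties.AbelianGroup +-abelianGroup using (⁻¹-∙-comm)
  open Relation.Binary.Reasoning.Setoid setoid

  private
    fromℕ : ℕ → Carrier
    fromℕ n = n × 1#

    fromℤ : ℤ → Carrier
    fromℤ (+ n)    = fromℕ n
    fromℤ -[1+ n ] = - fromℕ (suc n)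

    cancel : ∀ x a b → (x + a) + - (x + b) ≈ a + - b
    cancel x a b = begin
      (x + a) + - (x + b)     ≈⟨ +-cong (+-comm x a) (sym (⁻¹-∙-comm x b)) ⟩
      (a + x) + (- x + - b)   ≈⟨ +-assoc a x _ ⟩
      a + (x + (- x + - b))   ≈⟨ +-congˡ (sym (+-assoc x (- x) (- b))) ⟩
      a + ((x + - x) + - b)   ≈⟨ +-congˡ (+-congʳ (-‿inverseʳ x)) ⟩
      a + (0# + - b)          ≈⟨ +-congˡ (+-identityˡ (- b)) ⟩
      a + - b                 ∎

    fromℤ-⊖ : ∀ m n → fromℤ (m ℤ.⊖ n) ≈ fromℕ m + - fromℕ n
    fromℤ-⊖ zero    zero    = sym (-‿inverseʳ 0#)
    fromℤ-⊖ zero    (suc n) = sym (+-identityˡ _)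
    fromℤ-⊖ (suc m) zero    = sym (trans (+-congˡ -0#≈0#) (+-identityʳ _))
    fromℤ-⊖ (suc m) (suc n) = begin
      fromℤ (suc m ℤ.⊖ suc n)            ≈⟨ reflexive (≡.cong fromℤ (ℤₚ.[1+m]⊖[1+n]≡m⊖n m n)) ⟩
      fromℤ (m ℤ.⊖ n)                    ≈⟨ fromℤ-⊖ m n ⟩
      fromℕ m + - fromℕ n                ≈⟨ sym (cancel 1# _ _) ⟩
      (1# + fromℕ m) + - (1# + fromℕ n)  ≈⟨ sym (+-cong (1+× m 1#) (-‿cong (1+× n 1#))) ⟩
      fromℕ (suc m) + - fromℕ (suc n)    ∎

    fromℤ-+ : ∀ i j → fromℤ (i ℤ.+ j) ≈ fromℤ i + fromℤ j
    fromℤ-+ (+ m)    (+ n)    = ×-homo-+ 1# m n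
    fromℤ-+ (+ m)    -[1+ n ] = fromℤ-⊖ m (suc n)
    fromℤ-+ -[1+ m ] (+ n)    = trans (fromℤ-⊖ n (suc m)) (+-comm _ _)
    fromℤ-+ -[1+ m ] -[1+ n ] = begin
      - fromℕ (suc (suc (m ℕ.+ n)))       ≈⟨ -‿cong (reflexive (≡.cong fromℕ (≡.sym (ℕₚ.+-suc (suc m) n)))) ⟩
      - fromℕ (suc m ℕ.+ suc n)           ≈⟨ -‿cong (×-homo-+ 1# (suc m) (suc n)) ⟩
      - (fromℕ (suc m) + fromℕ (suc n))   ≈⟨ sym (⁻¹-∙-comm _ _) ⟩
      - fromℕ (suc m) + - fromℕ (suc n)   ∎

    fromℤ-neg : ∀ i → fromℤ (ℤ.- i) ≈ - fromℤ i
    fromℤ-neg (+ zero)  = sym -0#≈0#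
    fromℤ-neg (+ suc n) = refl
    fromℤ-neg -[1+ n ]  = sym (-‿involutive _)

    fromℤ-*⁺ : ∀ m j → fromℤ (+ m ℤ.* j) ≈ fromℕ m * fromℤ j
    fromℤ-*⁺ m (+ n)    = trans (reflexive (≡.cong fromℤ (≡.sym (ℤₚ.pos-* m n)))) (×1-homo-* m n)
    fromℤ-*⁺ m -[1+ n ] = begin
      fromℤ (+ m ℤ.* (ℤ.- + suc n))   ≈⟨ reflexive (≡.cong fromℤ (≡.sym (ℤₚ.neg-distribʳ-* (+ m) (+ suc n)))) ⟩
      fromℤ (ℤ.- (+ m ℤ.* + suc n))   ≈⟨ fromℤ-neg (+ m ℤ.* + suc n) ⟩
      - fromℤ (+ m ℤ.* + suc n)       ≈⟨ -‿cong (fromℤ-*⁺ m (+ suc n)) ⟩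
      - (fromℕ m * fromℕ (suc n))     ≈⟨ -‿distribʳ-* _ _ ⟩
      fromℕ m * - fromℕ (suc n)       ∎

    fromℤ-* : ∀ i j → fromℤ (i ℤ.* j) ≈ fromℤ i * fromℤ j
    fromℤ-* (+ m)    j = fromℤ-*⁺ m j
    fromℤ-* -[1+ m ] j = begin
      fromℤ ((ℤ.- + suc m) ℤ.* j)     ≈⟨ reflexive (≡.cong fromℤ (≡.sym (ℤₚ.neg-distribˡ-* (+ suc m) j))) ⟩
      fromℤ (ℤ.- (+ suc m ℤ.* j))     ≈⟨ fromℤ-neg (+ suc m ℤ.* j) ⟩
      - fromℤ (+ suc m ℤ.* j)         ≈⟨ -‿cong (fromℤ-*⁺ (suc m) j) ⟩
      - (fromℕ (suc m) * fromℤ j)     ≈⟨ -‿distribˡ-* _ _ ⟩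
      - fromℕ (suc m) * fromℤ j       ∎

    -- Integer coefficients have decidable equality whatever `R` is, so constants such as 1 - 1
    -- cancel in normal forms.
    homomorphism : ℤ.+-*-rawRing -Raw-AlmostCommutative⟶ fromCommutativeRing R
    homomorphism = record
      { ⟦_⟧ = fromℤ ; +-homo = fromℤ-+ ; *-homo = fromℤ-* ; -‿homo = fromℤ-neg
      ; 0-homo = refl ; 1-homo = refl }

    _≟′_ : ∀ i j → Maybe (fromℤ i ≈ fromℤ j)
    i ≟′ j with i ℤ.≟ j
    ... | yes i≡j = just (reflexive (≡.cong fromℤ i≡j))
    ... | no  _   = nothing

  open Algebra.Solver.Ring ℤ.+-*-rawRing (fromCommutativeRing R) homomorphism _≟′_ public
    using (solve; _:=_; _:+_; _:*_; _:-_; :-_; con)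

-- Sums over the pairs with i + j = n

module Antidiagonal {c ℓ} (R : CommutativeRing c ℓ) where
  open CommutativeRing R renaming (zero to *-zero)
  open Relation.Binary.Reasoning.Setoid setoid
  open IntegerSolver R

  -- Both indices are handed to `f`, so that n - j never appears as a truncated subtraction.
  anti : ℕ → (ℕ → ℕ → Carrier) → Carrier
  anti zero    f = f 0 0
  anti (suc n) f = f 0 (suc n) + anti n (λ i j → f (suc i) j)

  anti-cong : ∀ n {f g} → (∀ i j → i ℕ.+ j ≡ n → f i j ≈ g i j) → anti n f ≈ anti n g
  anti-cong zero    f≈g = f≈g 0 0 ≡.refl
  anti-cong (suc n) f≈g =
    +-cong (f≈g 0 (suc n) ≡.refl) (anti-cong n (λ i j i+j≡n → f≈g (suc i) j (≡.cong suc i+j≡n)))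

  anti-last : ∀ n f → anti (suc n) f ≈ anti n (λ i j → f i (suc j)) + f (suc n) 0
  anti-last zero    f = refl
  anti-last (suc n) f = trans (+-congˡ (anti-last n (λ i j → f (suc i) j))) (sym (+-assoc _ _ _))

  anti-+ : ∀ n f g → anti n (λ i j → f i j + g i j) ≈ anti n f + anti n g
  anti-+ zero    f g = refl
  anti-+ (suc n) f g = trans (+-congˡ (anti-+ n _ _))
    (solve 4 (λ a b x y → (a :+ b) :+ (x :+ y) := (a :+ x) :+ (b :+ y)) refl _ _ _ _)

  anti-*ˡ : ∀ n x f → x * anti n f ≈ anti n (λ i j → x * f i j)
  anti-*ˡ zero    x f = refl
  anti-*ˡ (suc n) x f = trans (distribˡ x _ _) (+-congˡ (anti-*ˡ n x _))

  anti-comm : ∀ n f → anti n f ≈ anti n (λ i j → f j i)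
  anti-comm zero    f = refl
  anti-comm (suc n) f = begin
    f 0 (suc n) + anti n (λ i j → f (suc i) j)  ≈⟨ +-congˡ (anti-comm n _) ⟩
    f 0 (suc n) + anti n (λ i j → f (suc j) i)  ≈⟨ +-comm _ _ ⟩
    anti n (λ i j → f (suc j) i) + f 0 (suc n)  ≈⟨ sym (anti-last n (λ i j → f j i)) ⟩
    anti (suc n) (λ i j → f j i)                ∎

  -- Both sides range over the triples with i + j + u = n.
  anti-assoc : ∀ n (f : ℕ → ℕ → ℕ → Carrier) →
    anti n (λ s u → anti s (λ i j → f i j u)) ≈ anti n (λ i r → anti r (λ j u → f i j u))
  anti-assoc zero    f = refl
  anti-assoc (suc n) f = begin
    f 0 0 (suc n) + anti n (λ s u → f 0 (suc s) u + anti s (λ i j → f (suc i) j u))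
      ≈⟨ +-congˡ (anti-+ n _ _) ⟩
    f 0 0 (suc n) + (anti n (λ s u → f 0 (suc s) u) + anti n (λ s u → anti s (λ i j → f (suc i) j u)))
      ≈⟨ sym (+-assoc _ _ _) ⟩
    anti (suc n) (f 0) + anti n (λ s u → anti s (λ i j → f (suc i) j u))
      ≈⟨ +-congˡ (anti-assoc n (λ i → f (suc i))) ⟩
    anti (suc n) (f 0) + anti n (λ i r → anti r (f (suc i))) ∎

  -- The antidiagonal of n - 1, empty for n = 0: what remains once the first or last term is
  -- removed, uniformly in n.
  anti⁻ : ℕ → (ℕ → ℕ → Carrier) → Carrier
  anti⁻ zero    f = 0#
  anti⁻ (suc n) f = anti n f

  anti⁻-cong : ∀ n {f g} → (∀ i j → suc (i ℕ.+ j) ≡ n → f i j ≈ g i j) → anti⁻ n f ≈ anti⁻ n g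
  anti⁻-cong zero    f≈g = refl
  anti⁻-cong (suc n) f≈g = anti-cong n (λ i j eq → f≈g i j (≡.cong suc eq))

  anti⁻-+ : ∀ n f g → anti⁻ n (λ i j → f i j + g i j) ≈ anti⁻ n f + anti⁻ n g
  anti⁻-+ zero    f g = sym (+-identityˡ 0#)
  anti⁻-+ (suc n) f g = anti-+ n f g

  anti⁻-*ˡ : ∀ n x f → x * anti⁻ n f ≈ anti⁻ n (λ i j → x * f i j)
  anti⁻-*ˡ zero    x f = zeroʳ x
  anti⁻-*ˡ (suc n) x f = anti-*ˡ n x f

  anti-headˡ : ∀ n f → anti n f ≈ f 0 n + anti⁻ n (λ i j → f (suc i) j)
  anti-headˡ zero    f = sym (+-identityʳ _)
  anti-headˡ (suc n) f = refl

  anti-headʳ : ∀ n f → anti n f ≈ anti⁻ n (λ i j → f i (suc j)) + f n 0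
  anti-headʳ zero    f = sym (+-identityˡ _)
  anti-headʳ (suc n) f = anti-last n f

-- q-shifted factorials

module Rising {c ℓ} (R : CommutativeRing c ℓ) (Q : CommutativeRing.Carrier R) where
  open CommutativeRing R renaming (zero to *-zero)
  open Relation.Binary.Reasoning.Setoid setoid
  open Algebra.Properties.Semiring.Exp semiring public
  open IntegerSolver R

  -- rise x n = (-x ; Q)ₙ and gauss x n = xⁿ Q^(n(n-1)/2).
  rise : Carrier → ℕ → Carrier
  rise x zero    = 1#
  rise x (suc n) = rise x n * (1# + x * Q ^ n)

  gauss : Carrier → ℕ → Carrier
  gauss x zero    = 1#
  gauss x (suc n) = gauss x n * (x * Q ^ n)

  rise-cong : ∀ {x y} n → x ≈ y → rise x n ≈ rise y n
  rise-cong zero    x≈y = refl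
  rise-cong (suc n) x≈y = *-cong (rise-cong n x≈y) (+-congˡ (*-congʳ x≈y))

  rise-+ : ∀ x m n → rise x (m ℕ.+ n) ≈ rise x m * rise (x * Q ^ m) n
  rise-+ x m zero    = trans (reflexive (≡.cong (rise x) (ℕₚ.+-identityʳ m))) (sym (*-identityʳ _))
  rise-+ x m (suc n) = begin
    rise x (m ℕ.+ suc n)                           ≈⟨ reflexive (≡.cong (rise x) (ℕₚ.+-suc m n)) ⟩
    rise x (m ℕ.+ n) * (1# + x * Q ^ (m ℕ.+ n))    ≈⟨ *-cong (rise-+ x m n) (+-congˡ (*-congˡ (^-homo-* Q m n))) ⟩
    rise x m * rise (x * Q ^ m) n * (1# + x * (Q ^ m * Q ^ n))
      ≈⟨ solve 5 (λ a b x p q → a :* b :* (con (+ 1) :+ x :* (p :* q)) := a :* (b :* (con (+ 1) :+ x :* p :* q))) refl _ _ _ _ _ ⟩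
    rise x m * rise (x * Q ^ m) (suc n)            ∎

  rise-suc : ∀ x n → rise x (suc n) ≈ (1# + x) * rise (x * Q) n
  rise-suc x n = begin
    rise x (1 ℕ.+ n)                                     ≈⟨ rise-+ x 1 n ⟩
    1# * (1# + x * 1#) * rise (x * (Q * 1#)) n
      ≈⟨ *-cong (solve 1 (λ x → con (+ 1) :* (con (+ 1) :+ x :* con (+ 1)) := con (+ 1) :+ x) refl x)
                (rise-cong n (*-congˡ (*-identityʳ Q))) ⟩
    (1# + x) * rise (x * Q) n                            ∎

  gauss-cong : ∀ {x y} n → x ≈ y → gauss x n ≈ gauss y n
  gauss-cong zero    x≈y = refl
  gauss-cong (suc n) x≈y = *-cong (gauss-cong n x≈y) (*-congʳ x≈y)

  gauss-+ : ∀ x m n → gauss x (m ℕ.+ n) ≈ gauss x m * gauss (x * Q ^ m) n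
  gauss-+ x m zero    = trans (reflexive (≡.cong (gauss x) (ℕₚ.+-identityʳ m))) (sym (*-identityʳ _))
  gauss-+ x m (suc n) = begin
    gauss x (m ℕ.+ suc n)                     ≈⟨ reflexive (≡.cong (gauss x) (ℕₚ.+-suc m n)) ⟩
    gauss x (m ℕ.+ n) * (x * Q ^ (m ℕ.+ n))   ≈⟨ *-cong (gauss-+ x m n) (*-congˡ (^-homo-* Q m n)) ⟩
    gauss x m * gauss (x * Q ^ m) n * (x * (Q ^ m * Q ^ n))
      ≈⟨ solve 5 (λ a b x p q → a :* b :* (x :* (p :* q)) := a :* (b :* (x :* p :* q))) refl _ _ _ _ _ ⟩
    gauss x m * gauss (x * Q ^ m) (suc n)     ∎

  -- `rise (- Q) n` is (Q;Q)ₙ, so `I n` stands for 1/(Q;Q)ₙ in a ring without division.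
  Reciprocal : (ℕ → Carrier) → Set ℓ
  Reciprocal I = ∀ n → rise (- Q) n * I n ≈ 1#

  Nilpotent : ℕ → Set ℓ
  Nilpotent M = ∀ {n} → M ≤ n → Q ^ n ≈ 0#

  1^ : ∀ n → 1# ^ n ≈ 1#
  1^ zero    = refl
  1^ (suc n) = trans (*-identityˡ _) (1^ n)

-- The q-Chu-Vandermonde sum and the Bailey lemma

module BaileyStep {c ℓ} (R : CommutativeRing c ℓ) (Q : CommutativeRing.Carrier R)
  (I : ℕ → CommutativeRing.Carrier R) (I-inverse : Rising.Reciprocal R Q I) where
  open CommutativeRing R renaming (zero to *-zero)
  open Rising R Q
  open Relation.Binary.Reasoning.Setoid setoid
  open IntegerSolver R
  open Antidiagonal R

  I-zero : I 0 ≈ 1#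
  I-zero = trans (sym (*-identityˡ _)) (I-inverse 0)

  I-suc : ∀ n → (1# - Q ^ suc n) * I (suc n) ≈ I n
  I-suc n = begin
    (1# - Q * Q ^ n) * I (suc n)              ≈⟨ sym (*-identityʳ _) ⟩
    (1# - Q * Q ^ n) * I (suc n) * 1#         ≈⟨ *-congˡ (sym (I-inverse n)) ⟩
    (1# - Q * Q ^ n) * I (suc n) * (rise (- Q) n * I n)
      ≈⟨ solve 5 (λ q p i r j → (con (+ 1) :- q :* p) :* i :* (r :* j) := (r :* (con (+ 1) :+ :- q :* p) :* i) :* j) refl _ _ _ _ _ ⟩
    rise (- Q) (suc n) * I (suc n) * I n      ≈⟨ *-congʳ (I-inverse (suc n)) ⟩
    1# * I n                                  ≈⟨ *-identityˡ _ ⟩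
    I n                                       ∎

  -- 1 - Q^(n+1) is a factor of the unit (Q;Q)_{n+1}, hence a unit. Inductions on n may therefore
  -- multiply by it first.
  1-Q^suc-cancel : ∀ n {x y} → (1# - Q ^ suc n) * x ≈ (1# - Q ^ suc n) * y → x ≈ y
  1-Q^suc-cancel n {x} {y} eq = trans (sym (unit x)) (trans (*-congˡ eq) (unit y))
    where
    unit : ∀ x → rise (- Q) n * I (suc n) * ((1# - Q ^ suc n) * x) ≈ x
    unit x = begin
      rise (- Q) n * I (suc n) * ((1# - Q * Q ^ n) * x)
        ≈⟨ solve 5 (λ q p i r x → r :* i :* ((con (+ 1) :- q :* p) :* x) := (r :* (con (+ 1) :+ :- q :* p) :* i) :* x) refl _ _ _ _ _ ⟩
      rise (- Q) (suc n) * I (suc n) * x  ≈⟨ *-congʳ (I-inverse (suc n)) ⟩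
      1# * x                              ≈⟨ *-identityˡ x ⟩
      x                                   ∎

  -- For t + u = n + 1 one has 1 - Q^(n+1) = Q^t (1 - Q^u) + (1 - Q^t), and the two brackets are
  -- absorbed by `I u` and `I t`: the q-Pascal rule summed against a weight φ.
  pascal : ∀ n (φ : ℕ → ℕ → Carrier) →
    (1# - Q ^ suc n) * anti (suc n) (λ t u → I t * I u * φ t u)
    ≈ anti n (λ t u → I t * I u * (Q ^ t * φ t (suc u) + φ (suc t) u))
  pascal n φ = begin
    (1# - Q ^ suc n) * anti (suc n) (λ t u → I t * I u * φ t u)
      ≈⟨ anti-*ˡ (suc n) _ (λ t u → I t * I u * φ t u) ⟩
    anti (suc n) (λ t u → (1# - Q ^ suc n) * (I t * I u * φ t u))
      ≈⟨ anti-cong (suc n) split ⟩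
    anti (suc n) (λ t u → X t u + Y t u)
      ≈⟨ anti-+ (suc n) X Y ⟩
    anti (suc n) X + anti (suc n) Y
      ≈⟨ +-cong (anti-last n X) (+-congʳ (solve 3 (λ i j f → (con (+ 1) :- con (+ 1)) :* i :* j :* f := con (+ 0)) refl _ _ _)) ⟩
    (anti n (λ t u → X t (suc u)) + X (suc n) 0) + (0# + anti n (λ t u → Y (suc t) u))
      ≈⟨ +-cong (trans (+-congˡ (solve 4 (λ p i j f → p :* i :* ((con (+ 1) :- con (+ 1)) :* j) :* f := con (+ 0)) refl _ _ _ _)) (+-identityʳ _))
                (+-identityˡ _) ⟩
    anti n (λ t u → X t (suc u)) + anti n (λ t u → Y (suc t) u)
      ≈⟨ sym (anti-+ n _ _) ⟩
    anti n (λ t u → X t (suc u) + Y (suc t) u)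
      ≈⟨ anti-cong n (λ t u _ → trans (+-cong (*-congʳ (*-congˡ (I-suc u))) (*-congʳ (*-congʳ (I-suc t))))
           (solve 5 (λ p i j f g → p :* i :* j :* f :+ i :* j :* g := i :* j :* (p :* f :+ g)) refl _ _ _ _ _)) ⟩
    anti n (λ t u → I t * I u * (Q ^ t * φ t (suc u) + φ (suc t) u)) ∎
    where
    X Y : ℕ → ℕ → Carrier
    X t u = Q ^ t * I t * ((1# - Q ^ u) * I u) * φ t u
    Y t u = (1# - Q ^ t) * I t * I u * φ t u
    split : ∀ t u → t ℕ.+ u ≡ suc n → (1# - Q ^ suc n) * (I t * I u * φ t u) ≈ X t u + Y t u
    split t u eq = begin
      (1# - Q ^ suc n) * (I t * I u * φ t u)
        ≈⟨ *-congʳ (+-congˡ (-‿cong (trans (reflexive (≡.cong (Q ^_) (≡.sym eq))) (^-homo-* Q t u)))) ⟩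
      (1# - Q ^ t * Q ^ u) * (I t * I u * φ t u)
        ≈⟨ solve 5 (λ p q i j f → (con (+ 1) :- p :* q) :* (i :* j :* f)
             := p :* i :* ((con (+ 1) :- q) :* j) :* f :+ (con (+ 1) :- p) :* i :* j :* f) refl _ _ _ _ _ ⟩
      X t u + Y t u ∎

  -- Induction on n with b fixed, d replaced by d Q and c by c + 1, which preserves the hypothesis.
  -- That hypothesis makes the two terms of `pascal` combine: (1 - b d Q^t) + d (1 + b Q^t) = 1 + d.
  q-Vandermonde : ∀ n b d c → b * d ≈ Q ^ suc c →
    anti n (λ t u → I t * I u * (gauss d t * rise b t * I (c ℕ.+ t)))
    ≈ rise d n * I n * I (c ℕ.+ n)
  q-Vandermonde zero    b d c bd = begin
    I 0 * I 0 * (1# * 1# * I (c ℕ.+ 0))   ≈⟨ *-congʳ (*-congʳ I-zero) ⟩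
    1# * I 0 * (1# * 1# * I (c ℕ.+ 0))
      ≈⟨ solve 2 (λ i j → con (+ 1) :* i :* (con (+ 1) :* con (+ 1) :* j) := con (+ 1) :* i :* j) refl _ _ ⟩
    1# * I 0 * I (c ℕ.+ 0)                ∎
  q-Vandermonde (suc n) b d c bd = 1-Q^suc-cancel n (begin
    (1# - Q ^ suc n) * anti (suc n) (λ t u → I t * I u * (gauss d t * rise b t * I (c ℕ.+ t)))
      ≈⟨ pascal n (λ t u → gauss d t * rise b t * I (c ℕ.+ t)) ⟩
    anti n (λ t u → I t * I u * (Q ^ t * (gauss d t * rise b t * I (c ℕ.+ t))
      + gauss d (suc t) * rise b (suc t) * I (c ℕ.+ suc t)))
      ≈⟨ anti-cong n (λ t u _ → *-congˡ (term t)) ⟩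
    anti n (λ t u → I t * I u * ((1# + d) * (gauss (d * Q) t * rise b t * I (suc c ℕ.+ t))))
      ≈⟨ anti-cong n (λ t u _ → solve 4 (λ i j x y → i :* j :* (x :* y) := x :* (i :* j :* y)) refl _ _ _ _) ⟩
    anti n (λ t u → (1# + d) * (I t * I u * (gauss (d * Q) t * rise b t * I (suc c ℕ.+ t))))
      ≈⟨ sym (anti-*ˡ n _ _) ⟩
    (1# + d) * anti n (λ t u → I t * I u * (gauss (d * Q) t * rise b t * I (suc c ℕ.+ t)))
      ≈⟨ *-congˡ (q-Vandermonde n b (d * Q) (suc c) bdQ) ⟩
    (1# + d) * (rise (d * Q) n * I n * I (suc c ℕ.+ n))
      ≈⟨ solve 4 (λ x y i j → x :* (y :* i :* j) := (x :* y) :* i :* j) refl _ _ _ _ ⟩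
    ((1# + d) * rise (d * Q) n) * I n * I (suc c ℕ.+ n)
      ≈⟨ *-cong (*-cong (sym (rise-suc d n)) (sym (I-suc n))) (reflexive (≡.cong I (≡.sym (ℕₚ.+-suc c n)))) ⟩
    rise d (suc n) * ((1# - Q ^ suc n) * I (suc n)) * I (c ℕ.+ suc n)
      ≈⟨ solve 4 (λ x y i j → x :* (y :* i) :* j := y :* (x :* i :* j)) refl _ _ _ _ ⟩
    (1# - Q ^ suc n) * (rise d (suc n) * I (suc n) * I (c ℕ.+ suc n)) ∎)
    where
    bdQ : b * (d * Q) ≈ Q ^ suc (suc c)
    bdQ = trans (sym (*-assoc b d Q)) (trans (*-comm _ Q) (*-congˡ bd))
    gauss-Q : ∀ t → gauss (d * Q) t ≈ Q ^ t * gauss d t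
    gauss-Q zero    = sym (*-identityˡ _)
    gauss-Q (suc t) = trans (*-congʳ (gauss-Q t))
      (solve 4 (λ p g d q → p :* g :* (d :* q :* p) := q :* p :* (g :* (d :* p))) refl _ _ _ _)
    term : ∀ t → Q ^ t * (gauss d t * rise b t * I (c ℕ.+ t)) + gauss d (suc t) * rise b (suc t) * I (c ℕ.+ suc t)
      ≈ (1# + d) * (gauss (d * Q) t * rise b t * I (suc c ℕ.+ t))
    term t = begin
      Q ^ t * (gauss d t * rise b t * I (c ℕ.+ t)) + gauss d (suc t) * rise b (suc t) * I (c ℕ.+ suc t)
        ≈⟨ +-cong (*-congˡ (*-congˡ (trans (sym (I-suc (c ℕ.+ t))) (*-congʳ (+-congˡ (-‿cong (^-homo-* Q (suc c) t)))))))
                  (*-congˡ (reflexive (≡.cong I (ℕₚ.+-suc c t)))) ⟩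
      Q ^ t * (gauss d t * rise b t * ((1# - Q ^ suc c * Q ^ t) * I (suc c ℕ.+ t)))
        + gauss d (suc t) * rise b (suc t) * I (suc c ℕ.+ t)
        ≈⟨ +-congʳ (*-congˡ (*-congˡ (*-congʳ (+-congˡ (-‿cong (*-congʳ (sym bd))))))) ⟩
      Q ^ t * (gauss d t * rise b t * ((1# - b * d * Q ^ t) * I (suc c ℕ.+ t)))
        + gauss d t * (d * Q ^ t) * (rise b t * (1# + b * Q ^ t)) * I (suc c ℕ.+ t)
        ≈⟨ solve 6 (λ p g r b d i → p :* (g :* r :* ((con (+ 1) :- b :* d :* p) :* i))
              :+ g :* (d :* p) :* (r :* (con (+ 1) :+ b :* p)) :* i
              := (con (+ 1) :+ d) :* ((p :* g) :* r :* i)) refl _ _ _ _ _ _ ⟩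
      (1# + d) * (Q ^ t * gauss d t * rise b t * I (suc c ℕ.+ t))
        ≈⟨ *-congˡ (*-congʳ (*-congʳ (sym (gauss-Q t)))) ⟩
      (1# + d) * (gauss (d * Q) t * rise b t * I (suc c ℕ.+ t)) ∎

  -- With j + t = n, the kernel is 1/((Q;Q)_{n-j} (Q;Q)_{n+j+ε}): a Bailey pair relative to a = Q^ε,
  -- up to the factor (1 - Q)^ε.
  bailey : ℕ → (ℕ → Carrier) → ℕ → Carrier
  bailey ε α n = anti n (λ j t → α j * (I t * I (ε ℕ.+ (j ℕ.+ j) ℕ.+ t)))

  -- Exchanging the sums over s and j leaves an inner sum over t, which is `q-Vandermonde` with b =
  -- ρ Q^j, d = σ Q^j, c = ε + 2j; the condition on ρ σ is its hypothesis.
  bailey-step : ∀ ε ρ σ α n → ρ * σ ≈ Q ^ suc ε →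
    anti n (λ s u → I u * (gauss σ s * rise ρ s * bailey ε α s))
    ≈ anti n (λ j t → α j * gauss σ j * (rise ρ j * rise (σ * Q ^ j) t) * (I t * I (ε ℕ.+ (j ℕ.+ j) ℕ.+ t)))
  bailey-step ε ρ σ α n ρσ = begin
    anti n (λ s u → I u * (gauss σ s * rise ρ s * bailey ε α s))
      ≈⟨ anti-cong n (λ s u _ → trans (sym (*-assoc _ _ _)) (anti-*ˡ s _ _)) ⟩
    anti n (λ s u → anti s (λ j t → I u * (gauss σ s * rise ρ s) * (α j * (I t * I (ε ℕ.+ (j ℕ.+ j) ℕ.+ t)))))
      ≈⟨ anti-cong n (λ s u _ → anti-cong s (λ j t j+t≡s → *-congʳ (*-congˡ (split j t s j+t≡s)))) ⟩
    anti n (λ s u → anti s (λ j t → I u * ((gauss σ j * gauss (σ * Q ^ j) t) * (rise ρ j * rise (ρ * Q ^ j) t))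
                                       * (α j * (I t * I (ε ℕ.+ (j ℕ.+ j) ℕ.+ t)))))
      ≈⟨ anti-assoc n _ ⟩
    anti n (λ j r → anti r (λ t u → I u * ((gauss σ j * gauss (σ * Q ^ j) t) * (rise ρ j * rise (ρ * Q ^ j) t))
                                       * (α j * (I t * I (ε ℕ.+ (j ℕ.+ j) ℕ.+ t)))))
      ≈⟨ anti-cong n (λ j r _ → inner j r) ⟩
    anti n (λ j t → α j * gauss σ j * (rise ρ j * rise (σ * Q ^ j) t) * (I t * I (ε ℕ.+ (j ℕ.+ j) ℕ.+ t))) ∎
    where
    split : ∀ j t s → j ℕ.+ t ≡ s → gauss σ s * rise ρ s
      ≈ (gauss σ j * gauss (σ * Q ^ j) t) * (rise ρ j * rise (ρ * Q ^ j) t)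
    split j t _ ≡.refl = *-cong (gauss-+ σ j t) (rise-+ ρ j t)
    bd : ∀ j → (ρ * Q ^ j) * (σ * Q ^ j) ≈ Q ^ suc (ε ℕ.+ (j ℕ.+ j))
    bd j = begin
      (ρ * Q ^ j) * (σ * Q ^ j)      ≈⟨ solve 3 (λ a b p → (a :* p) :* (b :* p) := (a :* b) :* (p :* p)) refl _ _ _ ⟩
      ρ * σ * (Q ^ j * Q ^ j)        ≈⟨ *-cong ρσ (sym (^-homo-* Q j j)) ⟩
      Q ^ suc ε * Q ^ (j ℕ.+ j)      ≈⟨ sym (^-homo-* Q (suc ε) (j ℕ.+ j)) ⟩
      Q ^ suc (ε ℕ.+ (j ℕ.+ j))      ∎
    inner : ∀ j r → anti r (λ t u → I u * ((gauss σ j * gauss (σ * Q ^ j) t) * (rise ρ j * rise (ρ * Q ^ j) t))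
                                       * (α j * (I t * I (ε ℕ.+ (j ℕ.+ j) ℕ.+ t))))
      ≈ α j * gauss σ j * (rise ρ j * rise (σ * Q ^ j) r) * (I r * I (ε ℕ.+ (j ℕ.+ j) ℕ.+ r))
    inner j r = begin
      _ ≈⟨ anti-cong r (λ t u _ → solve 8 (λ u a b c d x t y → u :* ((a :* b) :* (c :* d)) :* (x :* (t :* y))
                              := (x :* a :* c) :* (t :* u :* (b :* d :* y))) refl _ _ _ _ _ _ _ _) ⟩
      anti r (λ t u → α j * gauss σ j * rise ρ j * (I t * I u * (gauss (σ * Q ^ j) t * rise (ρ * Q ^ j) t * I (ε ℕ.+ (j ℕ.+ j) ℕ.+ t))))
        ≈⟨ sym (anti-*ˡ r _ _) ⟩
      α j * gauss σ j * rise ρ j * anti r (λ t u → I t * I u * (gauss (σ * Q ^ j) t * rise (ρ * Q ^ j) t * I (ε ℕ.+ (j ℕ.+ j) ℕ.+ t)))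
        ≈⟨ *-congˡ (q-Vandermonde r (ρ * Q ^ j) (σ * Q ^ j) (ε ℕ.+ (j ℕ.+ j)) (bd j)) ⟩
      α j * gauss σ j * rise ρ j * (rise (σ * Q ^ j) r * I r * I (ε ℕ.+ (j ℕ.+ j) ℕ.+ r))
        ≈⟨ solve 6 (λ x a c d i y → x :* a :* c :* (d :* i :* y) := x :* a :* (c :* d) :* (i :* y)) refl _ _ _ _ _ _ ⟩
      α j * gauss σ j * (rise ρ j * rise (σ * Q ^ j) r) * (I r * I (ε ℕ.+ (j ℕ.+ j) ℕ.+ r)) ∎

  bailey-cong : ∀ ε {α β} n → (∀ j → α j ≈ β j) → bailey ε α n ≈ bailey ε β n
  bailey-cong ε n α≈β = anti-cong n (λ j t _ → *-congʳ (α≈β j))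

  bailey-+ : ∀ ε α β n → bailey ε (λ j → α j + β j) n ≈ bailey ε α n + bailey ε β n
  bailey-+ ε α β n = trans (anti-cong n (λ j t _ → distribʳ _ _ _)) (anti-+ n _ _)

-- The finite Jacobi triple product

module TripleProduct {c ℓ} (R : CommutativeRing c ℓ) (P : CommutativeRing.Carrier R)
  (h : ℕ → CommutativeRing.Carrier R) (h-inverse : Rising.Reciprocal R P h) where
  open CommutativeRing R renaming (zero to *-zero)
  open Rising R P
  open Relation.Binary.Reasoning.Setoid setoid
  open IntegerSolver R
  open Antidiagonal R
  open BaileyStep R P h h-inverse

  -- The kernel of bailey 0 is even in j, so the terms y j of a bilateral sum at - 1 - j are
  -- added to the terms x (suc j).
  fold : (x y : ℕ → Carrier) → ℕ → Carrier
  fold x y zero    = x 0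
  fold x y (suc j) = x (suc j) + y j

  -- With `U` below, the kernels 1/((P;P)_{n-j} (P;P)_{n+j+ε}) for ε = 0, 1, 2 in the order `U`,
  -- `V`, `W`, where t = n - j.
  V W : ℕ → ℕ → Carrier
  V j t = h t * h (suc (j ℕ.+ j) ℕ.+ t)
  W j t = h t * h (suc (suc (j ℕ.+ j)) ℕ.+ t)

  U : ℕ → ℕ → Carrier
  U j t = h t * h (j ℕ.+ j ℕ.+ t)

  U-suc : ∀ j t → U (suc j) t ≈ W j t
  U-suc j t = *-congˡ (reflexive (≡.cong (λ i → h (suc i ℕ.+ t)) (ℕₚ.+-suc j j)))

  bailey-fold : ∀ x y n → bailey 0 (fold x y) n ≈ bailey 0 x n + anti⁻ n (λ j t → y j * W j t)
  bailey-fold x y n = begin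
    bailey 0 (fold x y) n
      ≈⟨ anti-headˡ n _ ⟩
    x 0 * U 0 n + anti⁻ n (λ j t → (x (suc j) + y j) * U (suc j) t)
      ≈⟨ +-congˡ (anti⁻-cong n (λ j t _ → trans (distribʳ _ _ _) (+-congˡ (*-congˡ (U-suc j t))))) ⟩
    x 0 * U 0 n + anti⁻ n (λ j t → x (suc j) * U (suc j) t + y j * W j t)
      ≈⟨ +-congˡ (anti⁻-+ n _ _) ⟩
    x 0 * U 0 n + (anti⁻ n (λ j t → x (suc j) * U (suc j) t) + anti⁻ n (λ j t → y j * W j t))
      ≈⟨ sym (+-assoc _ _ _) ⟩
    x 0 * U 0 n + anti⁻ n (λ j t → x (suc j) * U (suc j) t) + anti⁻ n (λ j t → y j * W j t)
      ≈⟨ +-congʳ (sym (anti-headˡ n (λ j t → x j * U j t))) ⟩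
    bailey 0 x n + anti⁻ n (λ j t → y j * W j t) ∎

  -- The factor 1 - P^t kills the term t = 0 and lowers the index of `h` by one; t is then shifted.
  anti-lower : ∀ n (φ : ℕ → ℕ → Carrier) → anti n (λ j t → φ j t * ((1# - P ^ t) * h t)) ≈ anti⁻ n (λ j t → φ j (suc t) * h t)
  anti-lower n φ = begin
    anti n (λ j t → φ j t * ((1# - P ^ t) * h t))
      ≈⟨ anti-headʳ n _ ⟩
    anti⁻ n (λ j t → φ j (suc t) * ((1# - P ^ suc t) * h (suc t))) + φ n 0 * ((1# - 1#) * h 0)
      ≈⟨ +-cong (anti⁻-cong n (λ j t _ → *-congˡ (I-suc t)))
                (solve 2 (λ x i → x :* ((con (+ 1) :- con (+ 1)) :* i) := con (+ 0)) refl _ _) ⟩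
    anti⁻ n (λ j t → φ j (suc t) * h t) + 0#
      ≈⟨ +-identityʳ _ ⟩
    anti⁻ n (λ j t → φ j (suc t) * h t) ∎

  private
    1-P^+ : ∀ m t k → t ℕ.+ k ≡ m → 1# - P ^ m ≈ 1# - P ^ t * P ^ k
    1-P^+ _ t k ≡.refl = +-congˡ (-‿cong (^-homo-* P t k))

    doubled : ∀ e j t {n} → j ℕ.+ t ≡ n → t ℕ.+ (e ℕ.+ (j ℕ.+ j) ℕ.+ t) ≡ e ℕ.+ (n ℕ.+ n)
    doubled e j t ≡.refl = solveℕ 3 (λ e j t → t ⊹ (e ⊹ (j ⊹ j) ⊹ t)
      :≡ e ⊹ ((j ⊹ t) ⊹ (j ⊹ t))) ≡.refl e j t

  -- With p = P^t and q = P^(2j+1+t), the prefactor is 1 - p q = (1 - q) + q (1 - p); the first part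
  -- lowers the second factor of the kernel, the second part the first. `bailey₁-splitʳ` uses p (1 -
  -- q) + (1 - p) instead, which moves the power of P to the other part.
  bailey₁-splitˡ : ∀ x n → (1# - P ^ suc (n ℕ.+ n)) * bailey 1 x n
    ≈ bailey 0 x n + anti⁻ n (λ j t → x j * P ^ suc (suc (j ℕ.+ j) ℕ.+ t) * W j t)
  bailey₁-splitˡ x n = begin
    (1# - P ^ suc (n ℕ.+ n)) * bailey 1 x n
      ≈⟨ anti-*ˡ n _ _ ⟩
    anti n (λ j t → (1# - P ^ suc (n ℕ.+ n)) * (x j * V j t))
      ≈⟨ anti-cong n (λ j t eq → term j t (doubled 1 j t eq)) ⟩
    anti n (λ j t → x j * U j t + x j * P ^ suc (j ℕ.+ j ℕ.+ t) * h (suc (j ℕ.+ j ℕ.+ t)) * ((1# - P ^ t) * h t))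
      ≈⟨ anti-+ n _ _ ⟩
    bailey 0 x n + anti n (λ j t → x j * P ^ suc (j ℕ.+ j ℕ.+ t) * h (suc (j ℕ.+ j ℕ.+ t)) * ((1# - P ^ t) * h t))
      ≈⟨ +-congˡ (anti-lower n (λ j t → x j * P ^ suc (j ℕ.+ j ℕ.+ t) * h (suc (j ℕ.+ j ℕ.+ t)))) ⟩
    bailey 0 x n + anti⁻ n (λ j t → x j * P ^ suc (j ℕ.+ j ℕ.+ suc t) * h (suc (j ℕ.+ j ℕ.+ suc t)) * h t)
      ≈⟨ +-congˡ (anti⁻-cong n (λ j t _ → trans (reflexive (≡.cong (λ i → x j * P ^ suc i * h (suc i) * h t) (ℕₚ.+-suc (j ℕ.+ j) t)))
           (trans (*-assoc _ _ _) (*-congˡ (*-comm _ _))))) ⟩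
    bailey 0 x n + anti⁻ n (λ j t → x j * P ^ suc (suc (j ℕ.+ j) ℕ.+ t) * W j t) ∎
    where
    term : ∀ j t → t ℕ.+ suc (j ℕ.+ j ℕ.+ t) ≡ suc (n ℕ.+ n) → (1# - P ^ suc (n ℕ.+ n)) * (x j * V j t)
      ≈ x j * U j t + x j * P ^ suc (j ℕ.+ j ℕ.+ t) * h (suc (j ℕ.+ j ℕ.+ t)) * ((1# - P ^ t) * h t)
    term j t eq = begin
      (1# - P ^ suc (n ℕ.+ n)) * (x j * V j t)
        ≈⟨ *-congʳ (1-P^+ _ t _ eq) ⟩
      (1# - P ^ t * P ^ suc (j ℕ.+ j ℕ.+ t)) * (x j * (h t * h (suc (j ℕ.+ j ℕ.+ t))))
        ≈⟨ solve 5 (λ p q x i k → (con (+ 1) :- p :* q) :* (x :* (i :* k))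
             := x :* (i :* ((con (+ 1) :- q) :* k)) :+ x :* q :* k :* ((con (+ 1) :- p) :* i)) refl _ _ _ _ _ ⟩
      x j * (h t * ((1# - P ^ suc (j ℕ.+ j ℕ.+ t)) * h (suc (j ℕ.+ j ℕ.+ t))))
        + x j * P ^ suc (j ℕ.+ j ℕ.+ t) * h (suc (j ℕ.+ j ℕ.+ t)) * ((1# - P ^ t) * h t)
        ≈⟨ +-congʳ (*-congˡ (*-congˡ (I-suc (j ℕ.+ j ℕ.+ t)))) ⟩
      x j * U j t + x j * P ^ suc (j ℕ.+ j ℕ.+ t) * h (suc (j ℕ.+ j ℕ.+ t)) * ((1# - P ^ t) * h t) ∎

  bailey₁-splitʳ : ∀ x n → (1# - P ^ suc (n ℕ.+ n)) * bailey 1 x n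
    ≈ anti n (λ j t → x j * P ^ t * U j t) + anti⁻ n (λ j t → x j * W j t)
  bailey₁-splitʳ x n = begin
    (1# - P ^ suc (n ℕ.+ n)) * bailey 1 x n
      ≈⟨ anti-*ˡ n _ _ ⟩
    anti n (λ j t → (1# - P ^ suc (n ℕ.+ n)) * (x j * V j t))
      ≈⟨ anti-cong n (λ j t eq → term j t (doubled 1 j t eq)) ⟩
    anti n (λ j t → x j * P ^ t * U j t + x j * h (suc (j ℕ.+ j ℕ.+ t)) * ((1# - P ^ t) * h t))
      ≈⟨ anti-+ n _ _ ⟩
    anti n (λ j t → x j * P ^ t * U j t) + anti n (λ j t → x j * h (suc (j ℕ.+ j ℕ.+ t)) * ((1# - P ^ t) * h t))
      ≈⟨ +-congˡ (anti-lower n (λ j t → x j * h (suc (j ℕ.+ j ℕ.+ t)))) ⟩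
    anti n (λ j t → x j * P ^ t * U j t) + anti⁻ n (λ j t → x j * h (suc (j ℕ.+ j ℕ.+ suc t)) * h t)
      ≈⟨ +-congˡ (anti⁻-cong n (λ j t _ → trans (reflexive (≡.cong (λ i → x j * h (suc i) * h t) (ℕₚ.+-suc (j ℕ.+ j) t)))
           (trans (*-assoc _ _ _) (*-congˡ (*-comm _ _))))) ⟩
    anti n (λ j t → x j * P ^ t * U j t) + anti⁻ n (λ j t → x j * W j t) ∎
    where
    term : ∀ j t → t ℕ.+ suc (j ℕ.+ j ℕ.+ t) ≡ suc (n ℕ.+ n) → (1# - P ^ suc (n ℕ.+ n)) * (x j * V j t)
      ≈ x j * P ^ t * U j t + x j * h (suc (j ℕ.+ j ℕ.+ t)) * ((1# - P ^ t) * h t)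
    term j t eq = begin
      (1# - P ^ suc (n ℕ.+ n)) * (x j * V j t)
        ≈⟨ *-congʳ (1-P^+ _ t _ eq) ⟩
      (1# - P ^ t * P ^ suc (j ℕ.+ j ℕ.+ t)) * (x j * (h t * h (suc (j ℕ.+ j ℕ.+ t))))
        ≈⟨ solve 5 (λ p q x i k → (con (+ 1) :- p :* q) :* (x :* (i :* k))
             := x :* p :* (i :* ((con (+ 1) :- q) :* k)) :+ x :* k :* ((con (+ 1) :- p) :* i)) refl _ _ _ _ _ ⟩
      x j * P ^ t * (h t * ((1# - P ^ suc (j ℕ.+ j ℕ.+ t)) * h (suc (j ℕ.+ j ℕ.+ t))))
        + x j * h (suc (j ℕ.+ j ℕ.+ t)) * ((1# - P ^ t) * h t)
        ≈⟨ +-congʳ (*-congˡ (*-congˡ (I-suc (j ℕ.+ j ℕ.+ t)))) ⟩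
      x j * P ^ t * U j t + x j * h (suc (j ℕ.+ j ℕ.+ t)) * ((1# - P ^ t) * h t) ∎

  -- Now q = P^(2j+t) and the splitting is (1 - p) + p (1 - q). Lowering the second factor turns the
  -- kernel at j into `V` at j - 1, so the term j = 0 stands apart.
  bailey₀-split : ∀ x n → (1# - P ^ suc (suc (n ℕ.+ n))) * bailey 0 x (suc n)
    ≈ bailey 1 x n + (x 0 * P ^ suc n * V 0 n + anti n (λ j t → x (suc j) * P ^ t * V j t))
  bailey₀-split x n = begin
    (1# - P ^ suc (suc (n ℕ.+ n))) * bailey 0 x (suc n)
      ≈⟨ anti-*ˡ (suc n) _ (λ j t → x j * U j t) ⟩
    anti (suc n) (λ j t → (1# - P ^ suc (suc (n ℕ.+ n))) * (x j * U j t))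
      ≈⟨ anti-cong (suc n) (λ j t eq → term j t (≡.trans (doubled 0 j t eq) (≡.cong suc (ℕₚ.+-suc n n)))) ⟩
    anti (suc n) (λ j t → X j t + Y j t)
      ≈⟨ anti-+ (suc n) X Y ⟩
    anti (suc n) X + anti (suc n) Y
      ≈⟨ +-cong (anti-lower (suc n) (λ j t → x j * h (j ℕ.+ j ℕ.+ t))) refl ⟩
    anti n (λ j t → x j * h (j ℕ.+ j ℕ.+ suc t) * h t) + (Y 0 (suc n) + anti n (λ j t → Y (suc j) t))
      ≈⟨ +-cong (anti-cong n (λ j t _ → trans (reflexive (≡.cong (λ i → x j * h i * h t) (ℕₚ.+-suc (j ℕ.+ j) t)))
                   (trans (*-assoc _ _ _) (*-congˡ (*-comm _ _)))))
                (+-cong (*-congˡ (trans (*-congˡ (I-suc n)) (*-comm _ _)))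
                        (anti-cong n (λ j t _ → *-congˡ (*-congˡ (trans
                           (reflexive (≡.cong (λ i → (1# - P ^ suc (i ℕ.+ t)) * h (suc (i ℕ.+ t))) (ℕₚ.+-suc j j)))
                           (I-suc (suc (j ℕ.+ j ℕ.+ t)))))))) ⟩
    bailey 1 x n + (x 0 * P ^ suc n * V 0 n + anti n (λ j t → x (suc j) * P ^ t * V j t)) ∎
    where
    X Y : ℕ → ℕ → Carrier
    X j t = x j * h (j ℕ.+ j ℕ.+ t) * ((1# - P ^ t) * h t)
    Y j t = x j * P ^ t * (h t * ((1# - P ^ (j ℕ.+ j ℕ.+ t)) * h (j ℕ.+ j ℕ.+ t)))
    term : ∀ j t → t ℕ.+ (j ℕ.+ j ℕ.+ t) ≡ suc (suc (n ℕ.+ n)) →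
      (1# - P ^ suc (suc (n ℕ.+ n))) * (x j * U j t) ≈ X j t + Y j t
    term j t eq = begin
      (1# - P ^ suc (suc (n ℕ.+ n))) * (x j * U j t)
        ≈⟨ *-congʳ (1-P^+ _ t _ eq) ⟩
      (1# - P ^ t * P ^ (j ℕ.+ j ℕ.+ t)) * (x j * (h t * h (j ℕ.+ j ℕ.+ t)))
        ≈⟨ solve 5 (λ p q x i k → (con (+ 1) :- p :* q) :* (x :* (i :* k))
             := x :* k :* ((con (+ 1) :- p) :* i) :+ x :* p :* (i :* ((con (+ 1) :- q) :* k))) refl _ _ _ _ _ ⟩
      X j t + Y j t ∎

  W-split : ∀ y n → (1# - P ^ suc (suc (n ℕ.+ n))) * anti n (λ j t → y j * W j t)
    ≈ bailey 1 y n + anti⁻ n (λ j t → y j * P ^ suc (suc (suc (j ℕ.+ j ℕ.+ t))) * V (suc j) t)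
  W-split y n = begin
    (1# - P ^ suc (suc (n ℕ.+ n))) * anti n (λ j t → y j * W j t)
      ≈⟨ anti-*ˡ n _ _ ⟩
    anti n (λ j t → (1# - P ^ suc (suc (n ℕ.+ n))) * (y j * W j t))
      ≈⟨ anti-cong n (λ j t eq → term j t (doubled 2 j t eq)) ⟩
    anti n (λ j t → y j * V j t + y j * P ^ suc (suc (j ℕ.+ j ℕ.+ t)) * h (suc (suc (j ℕ.+ j ℕ.+ t))) * ((1# - P ^ t) * h t))
      ≈⟨ anti-+ n _ _ ⟩
    bailey 1 y n + anti n (λ j t → y j * P ^ suc (suc (j ℕ.+ j ℕ.+ t)) * h (suc (suc (j ℕ.+ j ℕ.+ t))) * ((1# - P ^ t) * h t))
      ≈⟨ +-congˡ (anti-lower n (λ j t → y j * P ^ suc (suc (j ℕ.+ j ℕ.+ t)) * h (suc (suc (j ℕ.+ j ℕ.+ t))))) ⟩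
    bailey 1 y n + anti⁻ n (λ j t → y j * P ^ suc (suc (j ℕ.+ j ℕ.+ suc t)) * h (suc (suc (j ℕ.+ j ℕ.+ suc t))) * h t)
      ≈⟨ +-congˡ (anti⁻-cong n (λ j t _ → trans
           (reflexive (≡.cong (λ i → y j * P ^ suc (suc i) * h (suc (suc i)) * h t) (ℕₚ.+-suc (j ℕ.+ j) t)))
           (trans (*-assoc _ _ _) (*-congˡ (trans (*-comm _ _)
             (reflexive (≡.cong (λ i → h t * h (suc (suc i ℕ.+ t))) (≡.sym (ℕₚ.+-suc j j))))))))) ⟩
    bailey 1 y n + anti⁻ n (λ j t → y j * P ^ suc (suc (suc (j ℕ.+ j ℕ.+ t))) * V (suc j) t) ∎
    where
    term : ∀ j t → t ℕ.+ suc (suc (j ℕ.+ j ℕ.+ t)) ≡ suc (suc (n ℕ.+ n)) → (1# - P ^ suc (suc (n ℕ.+ n))) * (y j * W j t)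
      ≈ y j * V j t + y j * P ^ suc (suc (j ℕ.+ j ℕ.+ t)) * h (suc (suc (j ℕ.+ j ℕ.+ t))) * ((1# - P ^ t) * h t)
    term j t eq = begin
      (1# - P ^ suc (suc (n ℕ.+ n))) * (y j * W j t)
        ≈⟨ *-congʳ (1-P^+ _ t _ eq) ⟩
      (1# - P ^ t * P ^ suc (suc (j ℕ.+ j ℕ.+ t))) * (y j * (h t * h (suc (suc (j ℕ.+ j ℕ.+ t)))))
        ≈⟨ solve 5 (λ p q x i k → (con (+ 1) :- p :* q) :* (x :* (i :* k))
             := x :* (i :* ((con (+ 1) :- q) :* k)) :+ x :* q :* k :* ((con (+ 1) :- p) :* i)) refl _ _ _ _ _ ⟩
      y j * (h t * ((1# - P ^ suc (suc (j ℕ.+ j ℕ.+ t))) * h (suc (suc (j ℕ.+ j ℕ.+ t)))))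
        + y j * P ^ suc (suc (j ℕ.+ j ℕ.+ t)) * h (suc (suc (j ℕ.+ j ℕ.+ t))) * ((1# - P ^ t) * h t)
        ≈⟨ +-congʳ (*-congˡ (*-congˡ (I-suc (suc (j ℕ.+ j ℕ.+ t))))) ⟩
      y j * V j t + y j * P ^ suc (suc (j ℕ.+ j ℕ.+ t)) * h (suc (suc (j ℕ.+ j ℕ.+ t))) * ((1# - P ^ t) * h t) ∎

  -- With p = P^t and q = P^(2j+1), 1 - q = (1 - q p) - q (1 - p). The last part acquires the kernel
  -- `W j`, which is that of index j + 1 for ε = 0; this is the place where `fold` puts it.
  bailey₁⇒bailey₀ : ∀ c n → bailey 1 (λ j → c j * (1# - P ^ suc (j ℕ.+ j))) n
    ≈ bailey 0 (fold c (λ j → - (c j * P ^ suc (j ℕ.+ j)))) n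
  bailey₁⇒bailey₀ c n = begin
    bailey 1 (λ j → c j * (1# - P ^ suc (j ℕ.+ j))) n
      ≈⟨ anti-cong n (λ j t _ → term j t) ⟩
    anti n (λ j t → c j * U j t + - (c j * P ^ suc (j ℕ.+ j)) * h (suc (j ℕ.+ j ℕ.+ t)) * ((1# - P ^ t) * h t))
      ≈⟨ anti-+ n _ _ ⟩
    bailey 0 c n + anti n (λ j t → - (c j * P ^ suc (j ℕ.+ j)) * h (suc (j ℕ.+ j ℕ.+ t)) * ((1# - P ^ t) * h t))
      ≈⟨ +-congˡ (anti-lower n (λ j t → - (c j * P ^ suc (j ℕ.+ j)) * h (suc (j ℕ.+ j ℕ.+ t)))) ⟩
    bailey 0 c n + anti⁻ n (λ j t → - (c j * P ^ suc (j ℕ.+ j)) * h (suc (j ℕ.+ j ℕ.+ suc t)) * h t)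
      ≈⟨ +-congˡ (anti⁻-cong n (λ j t _ → trans
           (*-congʳ (*-congˡ (reflexive (≡.cong (λ i → h (suc i)) (ℕₚ.+-suc (j ℕ.+ j) t)))))
           (trans (*-assoc _ _ _) (*-congˡ (*-comm _ _))))) ⟩
    bailey 0 c n + anti⁻ n (λ j t → - (c j * P ^ suc (j ℕ.+ j)) * W j t)
      ≈⟨ sym (bailey-fold _ _ n) ⟩
    bailey 0 (fold c (λ j → - (c j * P ^ suc (j ℕ.+ j)))) n ∎
    where
    term : ∀ j t → c j * (1# - P ^ suc (j ℕ.+ j)) * V j t
      ≈ c j * U j t + - (c j * P ^ suc (j ℕ.+ j)) * h (suc (j ℕ.+ j ℕ.+ t)) * ((1# - P ^ t) * h t)
    term j t = begin
      c j * (1# - P ^ suc (j ℕ.+ j)) * (h t * h (suc (j ℕ.+ j ℕ.+ t)))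
        ≈⟨ solve 5 (λ c q p i k → c :* (con (+ 1) :- q) :* (i :* k)
              := c :* (i :* ((con (+ 1) :- q :* p) :* k)) :+ :- (c :* q) :* k :* ((con (+ 1) :- p) :* i)) refl _ _ (P ^ t) _ _ ⟩
      c j * (h t * ((1# - P ^ suc (j ℕ.+ j) * P ^ t) * h (suc (j ℕ.+ j ℕ.+ t))))
        + - (c j * P ^ suc (j ℕ.+ j)) * h (suc (j ℕ.+ j ℕ.+ t)) * ((1# - P ^ t) * h t)
        ≈⟨ +-congʳ (*-congˡ (*-congˡ (trans (*-congʳ (+-congˡ (-‿cong (sym (^-homo-* P (suc (j ℕ.+ j)) t))))) (I-suc (j ℕ.+ j ℕ.+ t))))) ⟩
      c j * U j t + - (c j * P ^ suc (j ℕ.+ j)) * h (suc (j ℕ.+ j ℕ.+ t)) * ((1# - P ^ t) * h t) ∎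

  module Theta (z w : Carrier) (zw≈P : z * w ≈ P) where
    open Algebra.Properties.CommutativeSemiring.Exp commutativeSemiring using (^-distrib-*)

    -- The terms of the theta series Σ_{j ∈ ℤ} (-1)ʲ w^(j(j+1)/2) z^(j(j-1)/2):
    -- θ j is the one at j and θ⁻ j the one at - 1 - j.
    θ θ⁻ : ℕ → Carrier
    θ zero    = 1#
    θ (suc j) = - (θ j * (w ^ suc j * z ^ j))
    θ⁻ j = - (θ j * z ^ suc (j ℕ.+ j))

    private
      P^ : ∀ j → P ^ j ≈ z ^ j * w ^ j
      P^ j = trans (^-congˡ j (sym zw≈P)) (^-distrib-* z w j)

      P^suc-+ : ∀ j t → P ^ suc (j ℕ.+ t) ≈ z * w * (z ^ j * w ^ j * P ^ t)
      P^suc-+ j t = *-cong (sym zw≈P) (trans (^-homo-* P j t) (*-congʳ (P^ j)))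

      P^[2+2j+t] : ∀ j t → P ^ suc (suc (j ℕ.+ j ℕ.+ t)) ≈ z * w * (z * w) * (z ^ j * w ^ j * (z ^ j * w ^ j) * P ^ t)
      P^[2+2j+t] j t = trans (sym (*-assoc _ _ _)) (*-cong (*-cong (sym zw≈P) (sym zw≈P))
        (trans (^-homo-* P (j ℕ.+ j) t) (*-congʳ (trans (^-homo-* P j j) (*-cong (P^ j) (P^ j))))))

      θ⁻-expand : ∀ j → θ⁻ j ≈ - (θ j * (z * (z ^ j * z ^ j)))
      θ⁻-expand j = -‿cong (*-congˡ (*-congˡ (^-homo-* z j j)))

      θ⁻-suc : ∀ j → θ⁻ (suc j) ≈ θ j * (w * w ^ j * z ^ j) * (z * (z * z ^ j * (z * z ^ j)))
      θ⁻-suc j = trans (θ⁻-expand (suc j))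
        (solve 4 (λ t w v z → :- (:- (t :* (w :* v)) :* z) := t :* (w :* v) :* z) refl (θ j) (w ^ suc j) (z ^ j) _)

    -- Truncated theta series over ℤ with the kernels ε = 0 and ε = 1. For ε = 1 the indices j and -
    -- 1 - j share a kernel, so `D` adds their terms without a shift.
    E D : ℕ → Carrier
    E n = bailey 0 (fold θ θ⁻) n
    D n = bailey 1 (λ j → θ j + θ⁻ j) n

    -- The nonnegative and negative indices are split in the two opposite ways, so that the parts
    -- free of P add up to `E n`. Each part carrying a power of P is - z P^n times the free part at
    -- the next larger index of ℤ, so together they give - z P^n times `E n`.
    D-step : ∀ n → (1# - P ^ suc (n ℕ.+ n)) * D n ≈ (1# - z * P ^ n) * E n
    D-step n = begin
      (1# - P ^ suc (n ℕ.+ n)) * D n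
        ≈⟨ *-congˡ (bailey-+ 1 θ θ⁻ n) ⟩
      (1# - P ^ suc (n ℕ.+ n)) * (bailey 1 θ n + bailey 1 θ⁻ n)
        ≈⟨ distribˡ _ _ _ ⟩
      (1# - P ^ suc (n ℕ.+ n)) * bailey 1 θ n + (1# - P ^ suc (n ℕ.+ n)) * bailey 1 θ⁻ n
        ≈⟨ +-cong (bailey₁-splitˡ θ n) (bailey₁-splitʳ θ⁻ n) ⟩
      (bailey 0 θ n + anti⁻ n A₁) + (anti n A₂ + anti⁻ n A₃)
        ≈⟨ solve 4 (λ b x y s → (b :+ x) :+ (y :+ s) := (b :+ s) :+ (x :+ y)) refl _ _ _ _ ⟩
      (bailey 0 θ n + anti⁻ n A₃) + (anti⁻ n A₁ + anti n A₂)
        ≈⟨ +-congˡ key ⟩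
      (bailey 0 θ n + anti⁻ n A₃) + - (z * P ^ n) * (bailey 0 θ n + anti⁻ n A₃)
        ≈⟨ solve 2 (λ x y → x :+ :- y :* x := (con (+ 1) :- y) :* x) refl _ _ ⟩
      (1# - z * P ^ n) * (bailey 0 θ n + anti⁻ n A₃)
        ≈⟨ *-congˡ (sym (bailey-fold θ θ⁻ n)) ⟩
      (1# - z * P ^ n) * E n ∎
      where
      A₁ A₂ A₃ : ℕ → ℕ → Carrier
      A₁ j t = θ j * P ^ suc (suc (j ℕ.+ j) ℕ.+ t) * W j t
      A₂ j t = θ⁻ j * P ^ t * U j t
      A₃ j t = θ⁻ j * W j t
      term : ∀ j t → suc (j ℕ.+ t) ≡ n →
        A₁ j t + A₂ (suc j) t ≈ - (z * P ^ n) * (θ (suc j) * U (suc j) t + A₃ j t)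
      term j t ≡.refl = begin
        θ j * P ^ suc (suc (j ℕ.+ j) ℕ.+ t) * W j t + θ⁻ (suc j) * P ^ t * U (suc j) t
          ≈⟨ +-cong (*-congʳ (*-congˡ (P^[2+2j+t] j t))) (*-cong (*-congʳ (θ⁻-suc j)) (U-suc j t)) ⟩
        θ j * (z * w * (z * w) * (z ^ j * w ^ j * (z ^ j * w ^ j) * P ^ t)) * W j t
          + θ j * (w * w ^ j * z ^ j) * (z * (z * z ^ j * (z * z ^ j))) * P ^ t * W j t
          ≈⟨ solve 7 (λ a z w u v p x →
                a :* (z :* w :* (z :* w) :* (u :* v :* (u :* v) :* p)) :* x
                  :+ a :* (w :* v :* u) :* (z :* (z :* u :* (z :* u))) :* p :* x
                := :- (z :* (z :* w :* (u :* v :* p))) :* (:- (a :* (w :* v :* u)) :* x :+ :- (a :* (z :* (u :* u))) :* x))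
                refl _ _ _ _ _ _ _ ⟩
        - (z * (z * w * (z ^ j * w ^ j * P ^ t))) * (θ (suc j) * W j t + - (θ j * (z * (z ^ j * z ^ j))) * W j t)
          ≈⟨ sym (*-cong (-‿cong (*-congˡ (P^suc-+ j t))) (+-cong (*-congˡ (U-suc j t)) (*-congʳ (θ⁻-expand j)))) ⟩
        - (z * P ^ n) * (θ (suc j) * U (suc j) t + θ⁻ j * W j t) ∎
      key : anti⁻ n A₁ + anti n A₂ ≈ - (z * P ^ n) * (bailey 0 θ n + anti⁻ n A₃)
      key = begin
        anti⁻ n A₁ + anti n A₂
          ≈⟨ +-congˡ (anti-headˡ n A₂) ⟩
        anti⁻ n A₁ + (A₂ 0 n + anti⁻ n (λ j t → A₂ (suc j) t))
          ≈⟨ solve 3 (λ x y s → x :+ (y :+ s) := y :+ (x :+ s)) refl _ _ _ ⟩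
        A₂ 0 n + (anti⁻ n A₁ + anti⁻ n (λ j t → A₂ (suc j) t))
          ≈⟨ +-congˡ (sym (anti⁻-+ n A₁ _)) ⟩
        A₂ 0 n + anti⁻ n (λ j t → A₁ j t + A₂ (suc j) t)
          ≈⟨ +-cong (solve 3 (λ z p u → :- (con (+ 1) :* (z :* con (+ 1))) :* p :* u := :- (z :* p) :* (con (+ 1) :* u)) refl _ _ _)
                    (anti⁻-cong n term) ⟩
        - (z * P ^ n) * (θ 0 * U 0 n) + anti⁻ n (λ j t → - (z * P ^ n) * (θ (suc j) * U (suc j) t + A₃ j t))
          ≈⟨ +-congˡ (sym (anti⁻-*ˡ n _ _)) ⟩
        - (z * P ^ n) * (θ 0 * U 0 n) + - (z * P ^ n) * anti⁻ n (λ j t → θ (suc j) * U (suc j) t + A₃ j t)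
          ≈⟨ +-congˡ (*-congˡ (anti⁻-+ n _ _)) ⟩
        - (z * P ^ n) * (θ 0 * U 0 n) + - (z * P ^ n) * (anti⁻ n (λ j t → θ (suc j) * U (suc j) t) + anti⁻ n A₃)
          ≈⟨ solve 4 (λ k x y s → k :* x :+ k :* (y :+ s) := k :* ((x :+ y) :+ s)) refl _ _ _ _ ⟩
        - (z * P ^ n) * ((θ 0 * U 0 n + anti⁻ n (λ j t → θ (suc j) * U (suc j) t)) + anti⁻ n A₃)
          ≈⟨ *-congˡ (+-congʳ (sym (anti-headˡ n (λ j t → θ j * U j t)))) ⟩
        - (z * P ^ n) * (bailey 0 θ n + anti⁻ n A₃) ∎

    -- The mirror image of `D-step`: parts carrying a power of P are - w P^n times the free part at
    -- the next smaller index, and θ 0 passes to θ⁻ 0.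
    E-step : ∀ n → (1# - P ^ suc (suc (n ℕ.+ n))) * E (suc n) ≈ (1# - w * P ^ n) * D n
    E-step n = begin
      (1# - P ^ suc (suc (n ℕ.+ n))) * E (suc n)
        ≈⟨ *-congˡ (bailey-fold θ θ⁻ (suc n)) ⟩
      (1# - P ^ suc (suc (n ℕ.+ n))) * (bailey 0 θ (suc n) + anti n (λ j t → θ⁻ j * W j t))
        ≈⟨ distribˡ _ _ _ ⟩
      (1# - P ^ suc (suc (n ℕ.+ n))) * bailey 0 θ (suc n) + (1# - P ^ suc (suc (n ℕ.+ n))) * anti n (λ j t → θ⁻ j * W j t)
        ≈⟨ +-cong (bailey₀-split θ n) (W-split θ⁻ n) ⟩
      (bailey 1 θ n + (1# * P ^ suc n * V 0 n + anti n (λ j t → θ (suc j) * P ^ t * V j t))) + (bailey 1 θ⁻ n + anti⁻ n B)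
        ≈⟨ solve 5 (λ a b c d e → (a :+ (b :+ c)) :+ (d :+ e) := (a :+ d) :+ (c :+ (b :+ e))) refl _ _ _ _ _ ⟩
      (bailey 1 θ n + bailey 1 θ⁻ n) + (anti n (λ j t → θ (suc j) * P ^ t * V j t) + (1# * P ^ suc n * V 0 n + anti⁻ n B))
        ≈⟨ +-congˡ (+-cong plus minus) ⟩
      (bailey 1 θ n + bailey 1 θ⁻ n) + (- (w * P ^ n) * bailey 1 θ n + - (w * P ^ n) * bailey 1 θ⁻ n)
        ≈⟨ solve 3 (λ k x y → (x :+ y) :+ (:- k :* x :+ :- k :* y) := (con (+ 1) :- k) :* (x :+ y)) refl _ _ _ ⟩
      (1# - w * P ^ n) * (bailey 1 θ n + bailey 1 θ⁻ n)
        ≈⟨ *-congˡ (sym (bailey-+ 1 θ θ⁻ n)) ⟩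
      (1# - w * P ^ n) * D n ∎
      where
      B : ℕ → ℕ → Carrier
      B j t = θ⁻ j * P ^ suc (suc (suc (j ℕ.+ j ℕ.+ t))) * V (suc j) t
      plus-term : ∀ j t → j ℕ.+ t ≡ n → θ (suc j) * P ^ t * V j t ≈ - (w * P ^ n) * (θ j * V j t)
      plus-term j t ≡.refl = begin
        - (θ j * (w * w ^ j * z ^ j)) * P ^ t * V j t
          ≈⟨ solve 6 (λ a w v u p x → :- (a :* (w :* v :* u)) :* p :* x := :- (w :* (u :* v :* p)) :* (a :* x)) refl _ _ _ _ _ _ ⟩
        - (w * (z ^ j * w ^ j * P ^ t)) * (θ j * V j t)
          ≈⟨ *-congʳ (-‿cong (*-congˡ (trans (*-congʳ (sym (P^ j))) (sym (^-homo-* P j t))))) ⟩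
        - (w * P ^ n) * (θ j * V j t) ∎
      plus : anti n (λ j t → θ (suc j) * P ^ t * V j t) ≈ - (w * P ^ n) * bailey 1 θ n
      plus = trans (anti-cong n plus-term) (sym (anti-*ˡ n _ _))
      minus-term : ∀ j t → suc (j ℕ.+ t) ≡ n → B j t ≈ - (w * P ^ n) * (θ⁻ (suc j) * V (suc j) t)
      minus-term j t ≡.refl = begin
        θ⁻ j * P ^ suc (suc (suc (j ℕ.+ j ℕ.+ t))) * V (suc j) t
          ≈⟨ *-congʳ (*-cong (θ⁻-expand j) (*-cong (sym zw≈P) (P^[2+2j+t] j t))) ⟩
        - (θ j * (z * (z ^ j * z ^ j))) * (z * w * (z * w * (z * w) * (z ^ j * w ^ j * (z ^ j * w ^ j) * P ^ t))) * V (suc j) t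
          ≈⟨ solve 7 (λ a z w u v p x →
                :- (a :* (z :* (u :* u))) :* (z :* w :* (z :* w :* (z :* w) :* (u :* v :* (u :* v) :* p))) :* x
                := :- (w :* (z :* w :* (u :* v :* p))) :* (a :* (w :* v :* u) :* (z :* (z :* u :* (z :* u))) :* x))
                refl _ _ _ _ _ _ _ ⟩
        - (w * (z * w * (z ^ j * w ^ j * P ^ t))) * (θ j * (w * w ^ j * z ^ j) * (z * (z * z ^ j * (z * z ^ j))) * V (suc j) t)
          ≈⟨ sym (*-cong (-‿cong (*-congˡ (P^suc-+ j t))) (*-congʳ (θ⁻-suc j))) ⟩
        - (w * P ^ n) * (θ⁻ (suc j) * V (suc j) t) ∎
      minus : 1# * P ^ suc n * V 0 n + anti⁻ n B ≈ - (w * P ^ n) * bailey 1 θ⁻ n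
      minus = begin
        1# * (P * P ^ n) * V 0 n + anti⁻ n B
          ≈⟨ +-cong (*-congʳ (*-congˡ (*-congʳ (sym zw≈P)))) (anti⁻-cong n minus-term) ⟩
        1# * (z * w * P ^ n) * V 0 n + anti⁻ n (λ j t → - (w * P ^ n) * (θ⁻ (suc j) * V (suc j) t))
          ≈⟨ +-cong (solve 4 (λ z w p x → con (+ 1) :* (z :* w :* p) :* x := :- (w :* p) :* (:- (con (+ 1) :* (z :* con (+ 1))) :* x)) refl _ _ _ _)
                    (sym (anti⁻-*ˡ n _ _)) ⟩
        - (w * P ^ n) * (θ⁻ 0 * V 0 n) + - (w * P ^ n) * anti⁻ n (λ j t → θ⁻ (suc j) * V (suc j) t)
          ≈⟨ sym (distribˡ _ _ _) ⟩
        - (w * P ^ n) * (θ⁻ 0 * V 0 n + anti⁻ n (λ j t → θ⁻ (suc j) * V (suc j) t))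
          ≈⟨ *-congˡ (sym (anti-headˡ n (λ j t → θ⁻ j * V j t))) ⟩
        - (w * P ^ n) * bailey 1 θ⁻ n ∎

    -- Mutual induction along E 0, D 0, E 1, D 1, ...: passing to `D` adds the factor 1 - z P^n,
    -- passing to the next `E` the factor 1 - w P^n.
    E-product : ∀ n → rise (- P) (n ℕ.+ n) * E n ≈ rise (- z) n * rise (- w) n
    D-product : ∀ n → rise (- P) (suc (n ℕ.+ n)) * D n ≈ rise (- z) (suc n) * rise (- w) n
    E-product zero = begin
      1# * (1# * (h 0 * h 0)) ≈⟨ *-congˡ (*-congˡ (*-cong I-zero I-zero)) ⟩
      1# * (1# * (1# * 1#))   ≈⟨ solve 0 (con (+ 1) :* (con (+ 1) :* (con (+ 1) :* con (+ 1))) := con (+ 1) :* con (+ 1)) refl ⟩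
      1# * 1#                 ∎
    E-product (suc n) = begin
      rise (- P) (suc (n ℕ.+ suc n)) * E (suc n)
        ≈⟨ *-congʳ (reflexive (≡.cong (λ i → rise (- P) (suc i)) (ℕₚ.+-suc n n))) ⟩
      rise (- P) (suc (n ℕ.+ n)) * (1# + - P * (P * P ^ (n ℕ.+ n))) * E (suc n)
        ≈⟨ solve 4 (λ r p s e → r :* (con (+ 1) :+ :- p :* s) :* e := r :* ((con (+ 1) :- p :* s) :* e)) refl _ _ _ _ ⟩
      rise (- P) (suc (n ℕ.+ n)) * ((1# - P ^ suc (suc (n ℕ.+ n))) * E (suc n))
        ≈⟨ *-congˡ (E-step n) ⟩
      rise (- P) (suc (n ℕ.+ n)) * ((1# - w * P ^ n) * D n)
        ≈⟨ solve 3 (λ r k d → r :* (k :* d) := k :* (r :* d)) refl _ _ _ ⟩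
      (1# - w * P ^ n) * (rise (- P) (suc (n ℕ.+ n)) * D n)
        ≈⟨ *-congˡ (D-product n) ⟩
      (1# - w * P ^ n) * (rise (- z) (suc n) * rise (- w) n)
        ≈⟨ solve 4 (λ w p r s → (con (+ 1) :- w :* p) :* (r :* s) := r :* (s :* (con (+ 1) :+ :- w :* p))) refl _ _ _ _ ⟩
      rise (- z) (suc n) * rise (- w) (suc n) ∎
    D-product n = begin
      rise (- P) (n ℕ.+ n) * (1# + - P * P ^ (n ℕ.+ n)) * D n
        ≈⟨ solve 4 (λ r p s e → r :* (con (+ 1) :+ :- p :* s) :* e := r :* ((con (+ 1) :- p :* s) :* e)) refl _ _ _ _ ⟩
      rise (- P) (n ℕ.+ n) * ((1# - P ^ suc (n ℕ.+ n)) * D n)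
        ≈⟨ *-congˡ (D-step n) ⟩
      rise (- P) (n ℕ.+ n) * ((1# - z * P ^ n) * E n)
        ≈⟨ solve 3 (λ r k d → r :* (k :* d) := k :* (r :* d)) refl _ _ _ ⟩
      (1# - z * P ^ n) * (rise (- P) (n ℕ.+ n) * E n)
        ≈⟨ *-congˡ (E-product n) ⟩
      (1# - z * P ^ n) * (rise (- z) n * rise (- w) n)
        ≈⟨ solve 4 (λ w p r s → (con (+ 1) :- w :* p) :* (r :* s) := (r :* (con (+ 1) :+ :- w :* p)) :* s) refl _ _ _ _ ⟩
      rise (- z) (suc n) * rise (- w) n ∎

-- The Bailey chain of the multisum

-- Chain K a m is the shape of the exponent for k = K + 2, built from N_{k-1} (base) down to N₁:
-- the linear term 2Nᵢ is present at base and turn, absent at plain, and occurs m + 1 times.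
data Chain : ℕ → ℕ → ℕ → Set where
  base  : Chain 0 1 0
  turn  : ∀ {K m} → Chain K 2 m → Chain (suc K) 1 (suc m)
  plain : ∀ {K a m} → Chain K (suc a) m → Chain (suc K) (suc (suc a)) m

-- I n = 1/(q²;q²)ₙ and J n = 1/(q⁴;q⁴)ₙ.
record QData {c ℓ} (R : CommutativeRing c ℓ) : Set (c ⊔ ℓ) where
  open CommutativeRing R
  field
    q : Carrier
  Q : Carrier
  Q = q * q
  open Rising R Q
  field
    I         : ℕ → Carrier
    I-inverse : Reciprocal I
    J         : ℕ → Carrier
    J-inverse : ∀ n → rise (- Q) n * rise Q n * J n ≈ 1#

module BaileyChain {c ℓ} (R : CommutativeRing c ℓ) (S : QData R) where
  open CommutativeRing R renaming (zero to *-zero)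
  open QData S
  open Rising R Q
  open Relation.Binary.Reasoning.Setoid setoid
  open IntegerSolver R
  open Antidiagonal R
  open BaileyStep R Q I I-inverse
  open TripleProduct R Q I I-inverse using (fold; bailey₁⇒bailey₀)

  -- (-1)ʲ Q^(j²), since j² grows by 2j + 1.
  coeff : ℕ → Carrier
  coeff zero    = 1#
  coeff (suc j) = - (coeff j * Q ^ suc (j ℕ.+ j))

  rise-join : ∀ x j t n → j ℕ.+ t ≡ n → rise x j * rise (x * Q ^ j) t ≈ rise x n
  rise-join x j t _ ≡.refl = sym (rise-+ x j t)

  private
    module Unit where
      -- z = Q and w = 1 put (1;Q)ₙ into `D-product`, which vanishes for n ≥ 1: `D` is 1 at 0 and 0
      -- elsewhere.
      open TripleProduct.Theta R Q I I-inverse Q 1# (*-identityʳ Q) public using (θ; θ⁻; D; D-product)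

      cancel : ∀ n {x y} → rise (- Q) n * x ≈ rise (- Q) n * y → x ≈ y
      cancel n {x} {y} eq = trans (sym (unit x)) (trans (*-congˡ eq) (unit y))
        where
        unit : ∀ x → I n * (rise (- Q) n * x) ≈ x
        unit x = trans (sym (*-assoc _ _ _)) (trans (*-congʳ (trans (*-comm _ _) (I-inverse n))) (*-identityˡ x))

      D-zero : D 0 ≈ 1#
      D-zero = cancel 1 (D-product 0)

      D-suc : ∀ n → D (suc n) ≈ 0#
      D-suc n = cancel (suc (suc n ℕ.+ suc n)) (begin
        rise (- Q) (suc (suc n ℕ.+ suc n)) * D (suc n)      ≈⟨ D-product (suc n) ⟩
        rise (- Q) (suc (suc n)) * rise (- 1#) (suc n)      ≈⟨ *-congˡ (rise-suc (- 1#) n) ⟩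
        rise (- Q) (suc (suc n)) * ((1# - 1#) * rise (- 1# * Q) n)
          ≈⟨ solve 3 (λ a b d → a :* ((con (+ 1) :- con (+ 1)) :* b) := d :* con (+ 0)) refl _ _ _ ⟩
        rise (- Q) (suc (suc n ℕ.+ suc n)) * 0#             ∎)

      -- For this z and w, θ j is (-1)ʲ Q^(j(j-1)/2), while `gauss Q j` is Q^(j(j+1)/2).
      θ-gauss : ∀ j → θ j * gauss Q j ≈ coeff j
      θ-gauss zero    = *-identityˡ 1#
      θ-gauss (suc j) = begin
        - (θ j * (1# * 1# ^ j * Q ^ j)) * (gauss Q j * (Q * Q ^ j))
          ≈⟨ *-congʳ (-‿cong (*-congˡ (*-congʳ (*-congˡ (1^ j))))) ⟩
        - (θ j * (1# * 1# * Q ^ j)) * (gauss Q j * (Q * Q ^ j))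
          ≈⟨ solve 4 (λ t p g q → :- (t :* (con (+ 1) :* con (+ 1) :* p)) :* (g :* (q :* p)) := :- (t :* g :* (q :* (p :* p)))) refl _ _ _ _ ⟩
        - (θ j * gauss Q j * (Q * (Q ^ j * Q ^ j)))
          ≈⟨ -‿cong (*-cong (θ-gauss j) (*-congˡ (sym (^-homo-* Q j j)))) ⟩
        coeff (suc j) ∎

  -- Applying the Bailey step with ρ = σ = Q to the unit Bailey pair (θ + θ⁻, δ) leaves only s = 0.
  J-bailey : ∀ n → J n ≈ bailey 1 (λ j → coeff j * (1# - Q ^ suc (j ℕ.+ j))) n
  J-bailey n = begin
    J n                                              ≈⟨ sym (*-identityˡ _) ⟩
    1# * J n                                         ≈⟨ *-congʳ (sym (I-inverse n)) ⟩
    rise (- Q) n * I n * J n                         ≈⟨ *-congʳ (*-congˡ I-bailey) ⟩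
    rise (- Q) n * (rise Q n * B) * J n
      ≈⟨ solve 4 (λ a b x j → a :* (b :* x) :* j := a :* b :* j :* x) refl _ _ _ _ ⟩
    rise (- Q) n * rise Q n * J n * B                ≈⟨ *-congʳ (J-inverse n) ⟩
    1# * B                                           ≈⟨ *-identityˡ _ ⟩
    B                                                ∎
    where
    open Unit
    B = bailey 1 (λ j → coeff j * (1# - Q ^ suc (j ℕ.+ j))) n
    -- The choice ρ = σ = Q brings out (-Q;Q)ₙ, the factor that the denominator of `J n` has besides
    -- (Q;Q)ₙ.
    I-bailey : I n ≈ rise Q n * B
    I-bailey = begin
      I n
        ≈⟨ solve 1 (λ i → i := i :* (con (+ 1) :* con (+ 1) :* con (+ 1)) :+ con (+ 0)) refl _ ⟩
      I n * (1# * 1# * 1#) + 0#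
        ≈⟨ +-cong (*-congˡ (*-congˡ (sym D-zero))) (sym (zeroˡ _)) ⟩
      I n * (1# * 1# * D 0) + 0# * anti⁻ n (λ _ _ → 0#)
        ≈⟨ +-congˡ (trans (anti⁻-*ˡ n 0# (λ _ _ → 0#)) (anti⁻-cong n (λ s u _ → trans (zeroˡ 0#)
             (sym (trans (*-congˡ (*-congˡ (D-suc s))) (solve 2 (λ a b → a :* (b :* con (+ 0)) := con (+ 0)) refl _ _)))))) ⟩
      I n * (1# * 1# * D 0) + anti⁻ n (λ s u → I u * (gauss Q (suc s) * rise Q (suc s) * D (suc s)))
        ≈⟨ sym (anti-headˡ n (λ s u → I u * (gauss Q s * rise Q s * D s))) ⟩
      anti n (λ s u → I u * (gauss Q s * rise Q s * D s))
        ≈⟨ bailey-step 1 Q Q _ n (*-congˡ (sym (*-identityʳ Q))) ⟩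
      anti n (λ j t → (θ j + θ⁻ j) * gauss Q j * (rise Q j * rise (Q * Q ^ j) t) * (I t * I (1 ℕ.+ (j ℕ.+ j) ℕ.+ t)))
        ≈⟨ anti-cong n (λ j t eq → trans (*-congʳ (*-cong (coeff-θ j) (rise-join Q j t n eq)))
             (solve 3 (λ a b c → a :* b :* c := b :* (a :* c)) refl _ _ _)) ⟩
      anti n (λ j t → rise Q n * (coeff j * (1# - Q ^ suc (j ℕ.+ j)) * (I t * I (1 ℕ.+ (j ℕ.+ j) ℕ.+ t))))
        ≈⟨ sym (anti-*ˡ n _ _) ⟩
      rise Q n * B ∎
      where
      coeff-θ : ∀ j → (θ j + θ⁻ j) * gauss Q j ≈ coeff j * (1# - Q ^ suc (j ℕ.+ j))
      coeff-θ j = trans (solve 3 (λ t p g → (t :+ :- (t :* p)) :* g := (t :* g) :* (con (+ 1) :- p)) refl _ _ _)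
                        (*-congʳ (θ-gauss j))

  private
    1-Q^ : ∀ j → 1# - Q ^ suc (j ℕ.+ j) ≈ (1# - q * Q ^ j) * (1# + q * Q ^ j)
    1-Q^ j = trans (+-congˡ (-‿cong (*-congˡ (^-homo-* Q j j))))
      (solve 2 (λ q p → con (+ 1) :- q :* q :* (p :* p) := (con (+ 1) :- q :* p) :* (con (+ 1) :+ q :* p)) refl q (Q ^ j))

  -- Here ρ = q, σ = q³. In 1 - Q^(2j+1) = (1 - q^(2j+1)) (1 + q^(2j+1)) the second factor fills the
  -- gap between (-q;q²)_j and (-q^(2j+3);q²)_t, so that their product (-q;q²)_{n+1} is free of j;
  -- the first factor stays with α.
  turn-step : ∀ (x : ℕ → Carrier) n →
    anti n (λ s u → I u * (gauss (q * Q) s * (rise q s * bailey 1 (λ j → x j * (1# - Q ^ suc (j ℕ.+ j))) s)))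
    ≈ rise q (suc n) * bailey 1 (λ j → x j * gauss (q * Q) j * (1# - q * Q ^ j)) n
  turn-step x n = begin
    _ ≈⟨ anti-cong n (λ s u _ → *-congˡ (sym (*-assoc _ _ _))) ⟩
    anti n (λ s u → I u * (gauss (q * Q) s * rise q s * bailey 1 (λ j → x j * (1# - Q ^ suc (j ℕ.+ j))) s))
      ≈⟨ bailey-step 1 q (q * Q) _ n (solve 1 (λ q → q :* (q :* (q :* q)) := q :* q :* (q :* q :* con (+ 1))) refl q) ⟩
    anti n (λ j t → x j * (1# - Q ^ suc (j ℕ.+ j)) * gauss (q * Q) j * (rise q j * rise (q * Q * Q ^ j) t) * (I t * I (1 ℕ.+ (j ℕ.+ j) ℕ.+ t)))
      ≈⟨ anti-cong n (λ j t eq → term j t (≡.cong suc eq)) ⟩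
    anti n (λ j t → rise q (suc n) * (x j * gauss (q * Q) j * (1# - q * Q ^ j) * (I t * I (1 ℕ.+ (j ℕ.+ j) ℕ.+ t))))
      ≈⟨ sym (anti-*ˡ n _ _) ⟩
    rise q (suc n) * bailey 1 (λ j → x j * gauss (q * Q) j * (1# - q * Q ^ j)) n ∎
    where
    term : ∀ j t {y} → suc j ℕ.+ t ≡ suc n →
      x j * (1# - Q ^ suc (j ℕ.+ j)) * gauss (q * Q) j * (rise q j * rise (q * Q * Q ^ j) t) * y
      ≈ rise q (suc n) * (x j * gauss (q * Q) j * (1# - q * Q ^ j) * y)
    term j t {y} eq = begin
      x j * (1# - Q ^ suc (j ℕ.+ j)) * gauss (q * Q) j * (rise q j * rise (q * Q * Q ^ j) t) * y
        ≈⟨ *-congʳ (*-cong (*-congʳ (*-congˡ (1-Q^ j))) (*-congˡ (rise-cong t (*-assoc q Q (Q ^ j))))) ⟩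
      x j * ((1# - q * Q ^ j) * (1# + q * Q ^ j)) * gauss (q * Q) j * (rise q j * rise (q * Q ^ suc j) t) * y
        ≈⟨ solve 7 (λ x a b g r s y → x :* (a :* b) :* g :* (r :* s) :* y := (r :* b) :* s :* (x :* g :* a :* y)) refl _ _ _ _ _ _ _ ⟩
      rise q (suc j) * rise (q * Q ^ suc j) t * (x j * gauss (q * Q) j * (1# - q * Q ^ j) * y)
        ≈⟨ *-congʳ (rise-join q (suc j) t (suc n) eq) ⟩
      rise q (suc n) * (x j * gauss (q * Q) j * (1# - q * Q ^ j) * y) ∎

  -- Here ρ = q³, σ = q, and (-q;q²)_{s+1} = (1 + q) (-q³;q²)_s. Afterwards (1 + q) (-q³;q²)_j =
  -- (-q;q²)_j (1 + q^(2j+1)), whose last factor restores 1 - Q^(2j+1).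
  return-step : ∀ (x : ℕ → Carrier) n →
    anti n (λ s u → I u * (gauss q s * (rise q (suc s) * bailey 1 (λ j → x j * (1# - q * Q ^ j)) s)))
    ≈ rise q n * bailey 1 (λ j → x j * gauss q j * (1# - Q ^ suc (j ℕ.+ j))) n
  return-step x n = begin
    _ ≈⟨ anti-cong n (λ s u _ → trans (*-congˡ (*-congˡ (*-congʳ (rise-suc q s))))
           (solve 5 (λ i g k r b → i :* (g :* ((con (+ 1) :+ k) :* r :* b)) := (con (+ 1) :+ k) :* (i :* (g :* r :* b))) refl _ _ _ _ _)) ⟩
    anti n (λ s u → (1# + q) * (I u * (gauss q s * rise (q * Q) s * bailey 1 (λ j → x j * (1# - q * Q ^ j)) s)))
      ≈⟨ sym (anti-*ˡ n _ _) ⟩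
    (1# + q) * anti n (λ s u → I u * (gauss q s * rise (q * Q) s * bailey 1 (λ j → x j * (1# - q * Q ^ j)) s))
      ≈⟨ *-congˡ (bailey-step 1 (q * Q) q _ n (solve 1 (λ q → q :* (q :* q) :* q := q :* q :* (q :* q :* con (+ 1))) refl q)) ⟩
    (1# + q) * anti n (λ j t → x j * (1# - q * Q ^ j) * gauss q j * (rise (q * Q) j * rise (q * Q ^ j) t) * (I t * I (1 ℕ.+ (j ℕ.+ j) ℕ.+ t)))
      ≈⟨ anti-*ˡ n _ _ ⟩
    anti n (λ j t → (1# + q) * (x j * (1# - q * Q ^ j) * gauss q j * (rise (q * Q) j * rise (q * Q ^ j) t) * (I t * I (1 ℕ.+ (j ℕ.+ j) ℕ.+ t))))
      ≈⟨ anti-cong n (λ j t eq → term j t eq) ⟩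
    anti n (λ j t → rise q n * (x j * gauss q j * (1# - Q ^ suc (j ℕ.+ j)) * (I t * I (1 ℕ.+ (j ℕ.+ j) ℕ.+ t))))
      ≈⟨ sym (anti-*ˡ n _ _) ⟩
    rise q n * bailey 1 (λ j → x j * gauss q j * (1# - Q ^ suc (j ℕ.+ j))) n ∎
    where
    term : ∀ j t {y} → j ℕ.+ t ≡ n →
      (1# + q) * (x j * (1# - q * Q ^ j) * gauss q j * (rise (q * Q) j * rise (q * Q ^ j) t) * y)
      ≈ rise q n * (x j * gauss q j * (1# - Q ^ suc (j ℕ.+ j)) * y)
    term j t {y} eq = begin
      (1# + q) * (x j * (1# - q * Q ^ j) * gauss q j * (rise (q * Q) j * rise (q * Q ^ j) t) * y)
        ≈⟨ solve 7 (λ k x a g r s y → k :* (x :* a :* g :* (r :* s) :* y) := (k :* r) :* s :* (x :* g :* a :* y)) refl _ _ _ _ _ _ _ ⟩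
      (1# + q) * rise (q * Q) j * rise (q * Q ^ j) t * (x j * gauss q j * (1# - q * Q ^ j) * y)
        ≈⟨ *-congʳ (*-congʳ (sym (rise-suc q j))) ⟩
      rise q j * (1# + q * Q ^ j) * rise (q * Q ^ j) t * (x j * gauss q j * (1# - q * Q ^ j) * y)
        ≈⟨ solve 7 (λ r b s x g a y → (r :* b) :* s :* (x :* g :* a :* y) := r :* s :* (x :* g :* (a :* b) :* y)) refl _ _ _ _ _ _ _ ⟩
      rise q j * rise (q * Q ^ j) t * (x j * gauss q j * ((1# - q * Q ^ j) * (1# + q * Q ^ j)) * y)
        ≈⟨ *-cong (rise-join q j t n eq) (*-congʳ (*-congˡ (sym (1-Q^ j)))) ⟩
      rise q n * (x j * gauss q j * (1# - Q ^ suc (j ℕ.+ j)) * y) ∎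

  -- For ρ = σ = q the two products join for an arbitrary sequence `x`, and (-q;q²)_s is handed on
  -- in the same form, so this step can be iterated.
  plain-step : ∀ (x : ℕ → Carrier) n →
    anti n (λ s u → I u * (gauss q s * (rise q s * bailey 0 x s)))
    ≈ rise q n * bailey 0 (λ j → x j * gauss q j) n
  plain-step x n = begin
    _ ≈⟨ anti-cong n (λ s u _ → *-congˡ (sym (*-assoc _ _ _))) ⟩
    anti n (λ s u → I u * (gauss q s * rise q s * bailey 0 x s))
      ≈⟨ bailey-step 0 q q _ n (sym (*-identityʳ Q)) ⟩
    anti n (λ j t → x j * gauss q j * (rise q j * rise (q * Q ^ j) t) * (I t * I (0 ℕ.+ (j ℕ.+ j) ℕ.+ t)))
      ≈⟨ anti-cong n (λ j t eq → trans (*-congʳ (*-congˡ (rise-join q j t n eq)))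
           (solve 4 (λ x g r y → x :* g :* r :* y := r :* (x :* g :* y)) refl _ _ _ _)) ⟩
    anti n (λ j t → rise q n * (x j * gauss q j * (I t * I (0 ℕ.+ (j ℕ.+ j) ℕ.+ t))))
      ≈⟨ sym (anti-*ˡ n _ _) ⟩
    rise q n * bailey 0 (λ j → x j * gauss q j) n ∎

  -- β C N is the sum of all terms with N₁ = N, and γ C n = Σ_N β C N / (Q;Q)_{n-N}.
  β γ : ∀ {K a m} → Chain K a m → ℕ → Carrier
  β base      s = gauss (q * Q) s * (rise q s * J s)
  β (turn C)  s = gauss (q * Q) s * γ C s
  β (plain C) s = gauss q s * γ C s
  γ C n = anti n (λ s u → I u * β C s)

  -- pair j = q^(2j² + 2j) is the weight that α j gains over two consecutive levels, of which exactly
  -- one carries the linear term.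
  pair : ℕ → Carrier
  pair j = gauss (q * Q) j * gauss q j

  -- The innermost α weighted by an odd number 2m + 1, respectively an even number 2m, of levels at
  -- ε = 1.
  odd-seq even-seq : ℕ → ℕ → Carrier
  odd-seq  m j = coeff j * pair j ^ m * gauss (q * Q) j
  even-seq m j = coeff j * pair j ^ m

  -- The kernel has changed to ε = 0 after N_{a-1}; each of the i = a - 2 remaining levels
  -- contributes `gauss q j`, which is q^(j²).
  inner-seq : ℕ → ℕ → ℕ → Carrier
  inner-seq m i j = fold (even-seq (suc m)) (λ j → - (even-seq (suc m) j * Q ^ suc (j ℕ.+ j))) j * gauss q j ^ i

  γ-base : ∀ n → γ base n ≈ rise q (suc n) * bailey 1 (λ j → odd-seq 0 j * (1# - q * Q ^ j)) n
  γ-base n = begin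
    γ base n
      ≈⟨ anti-cong n (λ s u _ → *-congˡ (*-congˡ (*-congˡ (J-bailey s)))) ⟩
    anti n (λ s u → I u * (gauss (q * Q) s * (rise q s * bailey 1 (λ j → coeff j * (1# - Q ^ suc (j ℕ.+ j))) s)))
      ≈⟨ turn-step coeff n ⟩
    rise q (suc n) * bailey 1 (λ j → coeff j * gauss (q * Q) j * (1# - q * Q ^ j)) n
      ≈⟨ *-congˡ (bailey-cong 1 n (λ j → *-congʳ (*-congʳ (sym (*-identityʳ _))))) ⟩
    rise q (suc n) * bailey 1 (λ j → odd-seq 0 j * (1# - q * Q ^ j)) n ∎

  -- The two forms feed each other: `return-step` consumes exactly what `turn-step` leaves, and
  -- conversely.
  γ-odd : ∀ {K m} (C : Chain K 1 m) n → γ C n ≈ rise q (suc n) * bailey 1 (λ j → odd-seq m j * (1# - q * Q ^ j)) n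
  γ-even : ∀ {K m} (C : Chain K 2 m) n → γ C n ≈ rise q n * bailey 1 (λ j → even-seq (suc m) j * (1# - Q ^ suc (j ℕ.+ j))) n
  γ-odd base n = γ-base n
  γ-odd (turn {m = m} C) n = trans (anti-cong n (λ s u _ → *-congˡ (*-congˡ (γ-even C s)))) (turn-step (even-seq (suc m)) n)
  γ-even {m = m} (plain C) n = begin
    γ (plain C) n
      ≈⟨ anti-cong n (λ s u _ → *-congˡ (*-congˡ (γ-odd C s))) ⟩
    _ ≈⟨ return-step (odd-seq m) n ⟩
    rise q n * bailey 1 (λ j → odd-seq m j * gauss q j * (1# - Q ^ suc (j ℕ.+ j))) n
      ≈⟨ *-congˡ (bailey-cong 1 n (λ j → *-congʳ (solve 4 (λ c p g h → c :* p :* g :* h := c :* (g :* h :* p)) refl _ _ _ _))) ⟩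
    rise q n * bailey 1 (λ j → even-seq (suc m) j * (1# - Q ^ suc (j ℕ.+ j))) n ∎

  γ-inner : ∀ {K m} i (C : Chain K (2 ℕ.+ i) m) n → γ C n ≈ rise q n * bailey 0 (inner-seq m i) n
  γ-inner {m = m} zero    C n = begin
    γ C n
      ≈⟨ γ-even C n ⟩
    rise q n * bailey 1 (λ j → even-seq (suc m) j * (1# - Q ^ suc (j ℕ.+ j))) n
      ≈⟨ *-congˡ (bailey₁⇒bailey₀ (even-seq (suc m)) n) ⟩
    rise q n * bailey 0 (fold (even-seq (suc m)) (λ j → - (even-seq (suc m) j * Q ^ suc (j ℕ.+ j)))) n
      ≈⟨ *-congˡ (bailey-cong 0 n (λ j → sym (*-identityʳ _))) ⟩
    rise q n * bailey 0 (inner-seq m 0) n ∎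
  γ-inner {m = m} (suc i) (plain C) n = begin
    γ (plain C) n
      ≈⟨ anti-cong n (λ s u _ → *-congˡ (*-congˡ (γ-inner i C s))) ⟩
    _ ≈⟨ plain-step (inner-seq m i) n ⟩
    rise q n * bailey 0 (λ j → inner-seq m i j * gauss q j) n
      ≈⟨ *-congˡ (bailey-cong 0 n (λ j → solve 3 (λ x g p → x :* p :* g := x :* (g :* p)) refl _ _ _)) ⟩
    rise q n * bailey 0 (inner-seq m (suc i)) n ∎

-- Limits as stationary values

module Stable {c ℓ} (R : CommutativeRing c ℓ) (Q : CommutativeRing.Carrier R)
  (I : ℕ → CommutativeRing.Carrier R) (I-inverse : Rising.Reciprocal R Q I)
  (M : ℕ) (Q^≈0 : Rising.Nilpotent R Q M) where
  open CommutativeRing R renaming (zero to *-zero)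
  open Rising R Q
  open IntegerSolver R
  open Antidiagonal R
  open BaileyStep R Q I I-inverse

  private
    from-M : ∀ (f : ℕ → Carrier) → (∀ {n} → M ≤ n → f (suc n) ≈ f n) → ∀ {n} → M ≤ n → f n ≈ f M
    from-M f step {n} M≤n = ≡.subst (λ i → f i ≈ f M) (ℕₚ.m+[n∸m]≡n M≤n) (go (n ℕ.∸ M))
      where
      go : ∀ d → f (M ℕ.+ d) ≈ f M
      go zero    = reflexive (≡.cong f (ℕₚ.+-identityʳ M))
      go (suc d) = trans (reflexive (≡.cong f (ℕₚ.+-suc M d))) (trans (step (ℕₚ.m≤m+n M d)) (go d))

  rise-stable : ∀ x {n} → M ≤ n → rise x n ≈ rise x M
  rise-stable x = from-M (rise x) (λ {n} M≤n → trans (*-congˡ (+-congˡ (*-congˡ (Q^≈0 M≤n))))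
    (solve 2 (λ r x → r :* (con (+ 1) :+ x :* con (+ 0)) := r) refl (rise x n) x))

  I-stable : ∀ {n} → M ≤ n → I n ≈ I M
  I-stable = from-M I (λ {n} M≤n → sym (trans (sym (I-suc n))
    (trans (*-congʳ (+-congˡ (-‿cong (Q^≈0 (ℕₚ.m≤n⇒m≤1+n M≤n)))))
      (solve 1 (λ i → (con (+ 1) :- con (+ 0)) :* i := i) refl (I (suc n))))))

  -- The full sum of a sequence that vanishes from M on, given the length 2M at which the finite
  -- identities are evaluated.
  total : (ℕ → Carrier) → Carrier
  total α = anti (M ℕ.+ M) (λ j _ → α j)

  total-cong : ∀ {α β} → (∀ j → α j ≈ β j) → total α ≈ total β
  total-cong α≈β = anti-cong (M ℕ.+ M) (λ j _ _ → α≈β j)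

  private
    large : ∀ j t → j ℕ.+ t ≡ M ℕ.+ M → j ≤ M → M ≤ t
    large j t eq j≤M = ℕₚ.+-cancelˡ-≤ M M t (≡.subst (_≤ M ℕ.+ t) eq (ℕₚ.+-monoˡ-≤ t j≤M))

  convolution-limit : ∀ β → (∀ {j} → M ≤ j → β j ≈ 0#) →
    anti (M ℕ.+ M) (λ s u → I u * β s) ≈ I M * total β
  convolution-limit β β≈0 = trans (anti-cong (M ℕ.+ M) term) (sym (anti-*ˡ (M ℕ.+ M) _ _))
    where
    term : ∀ s u → s ℕ.+ u ≡ M ℕ.+ M → I u * β s ≈ I M * β s
    term s u eq with ℕₚ.≤-total M s
    ... | inj₁ M≤s = trans (*-congˡ (β≈0 M≤s)) (trans (solve 2 (λ x y → x :* con (+ 0) := y :* con (+ 0)) refl (I u) (I M)) (*-congˡ (sym (β≈0 M≤s))))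
    ... | inj₂ s≤M = *-congʳ (I-stable (large s u eq s≤M))

  bailey-limit : ∀ ε α → (∀ {j} → M ≤ j → α j ≈ 0#) → bailey ε α (M ℕ.+ M) ≈ I M * I M * total α
  bailey-limit ε α α≈0 = trans (anti-cong (M ℕ.+ M) term) (sym (anti-*ˡ (M ℕ.+ M) _ _))
    where
    term : ∀ j t → j ℕ.+ t ≡ M ℕ.+ M → α j * (I t * I (ε ℕ.+ (j ℕ.+ j) ℕ.+ t)) ≈ I M * I M * α j
    term j t eq with ℕₚ.≤-total M j
    ... | inj₁ M≤j = trans (*-congʳ (α≈0 M≤j)) (trans (solve 2 (λ x y → con (+ 0) :* x := y :* con (+ 0)) refl _ _) (*-congˡ (sym (α≈0 M≤j))))
    ... | inj₂ j≤M = trans (*-comm _ _) (*-congʳ (*-cong (I-stable M≤t) (I-stable (ℕₚ.≤-trans M≤t (ℕₚ.m≤n+m t (ε ℕ.+ (j ℕ.+ j)))))))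
      where M≤t = large j t eq j≤M

module ThetaLimit {c ℓ} (R : CommutativeRing c ℓ) (z w P : CommutativeRing.Carrier R)
  (zw≈P : CommutativeRing._≈_ R (CommutativeRing._*_ R z w) P)
  (h : ℕ → CommutativeRing.Carrier R) (h-inverse : Rising.Reciprocal R P h)
  (M′ : ℕ) (z^≈0 : Rising.Nilpotent R z (suc M′)) (w^≈0 : Rising.Nilpotent R w (suc M′)) where
  open CommutativeRing R renaming (zero to *-zero)
  open Rising R P
  open Relation.Binary.Reasoning.Setoid setoid
  open IntegerSolver R
  open TripleProduct R P h h-inverse
  open Theta z w zw≈P

  private
    M : ℕ
    -- M is positive, so that M ≤ j excludes j = 0, where θ is 1.
    M = suc M′

  P^≈0 : Nilpotent M
  P^≈0 {n} M≤n = begin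
    P ^ n          ≈⟨ ^-congˡ n (sym zw≈P) ⟩
    (z * w) ^ n    ≈⟨ ^-distrib-* z w n ⟩
    z ^ n * w ^ n  ≈⟨ *-congʳ (z^≈0 M≤n) ⟩
    0# * w ^ n     ≈⟨ zeroˡ _ ⟩
    0#             ∎
    where open Algebra.Properties.CommutativeSemiring.Exp commutativeSemiring using (^-distrib-*)

  open Stable R P h h-inverse M P^≈0

  θ≈0 : ∀ {j} → M ≤ j → θ j ≈ 0#
  θ≈0 {suc j} M≤j = trans (-‿cong (*-congˡ (*-congʳ (w^≈0 M≤j))))
    (solve 2 (λ t x → :- (t :* (con (+ 0) :* x)) := con (+ 0)) refl (θ j) _)

  -- The bound is M ≤ j + 1 because `fold` stores θ⁻ j at place j + 1; the exponent 2j + 1 of z is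
  -- large enough for it.
  θ⁻≈0 : ∀ {j} → M ≤ suc j → θ⁻ j ≈ 0#
  θ⁻≈0 {j} M≤j = trans (-‿cong (*-congˡ (z^≈0 (ℕₚ.≤-trans M≤j (s≤s (ℕₚ.m≤m+n j j))))))
    (solve 1 (λ t → :- (t :* con (+ 0)) := con (+ 0)) refl (θ j))

  private
    -- One factor `h M` is cancelled by (P;P)_N = (P;P)_M; removing the other produces the (P;P)_∞
    -- of the triple product.
    extract : ∀ {x y N} → M ≤ N → rise (- P) N * (h M * h M * x) ≈ y → x ≈ rise (- P) M * y
    extract {x} {y} {N} M≤N eq = begin
      x                                                        ≈⟨ solve 1 (λ x → x := con (+ 1) :* con (+ 1) :* x) refl x ⟩
      1# * 1# * x                                              ≈⟨ *-congʳ (sym (*-cong (h-inverse M) (h-inverse M))) ⟩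
      rise (- P) M * h M * (rise (- P) M * h M) * x
        ≈⟨ solve 3 (λ r h x → r :* h :* (r :* h) :* x := r :* (r :* (h :* h :* x))) refl _ _ _ ⟩
      rise (- P) M * (rise (- P) M * (h M * h M * x))          ≈⟨ *-congˡ (*-congʳ (sym (rise-stable (- P) M≤N))) ⟩
      rise (- P) M * (rise (- P) N * (h M * h M * x))          ≈⟨ *-congˡ eq ⟩
      rise (- P) M * y                                         ∎

    M≤2M : M ≤ M ℕ.+ M
    M≤2M = ℕₚ.m≤m+n M M

  fold≈0 : ∀ {j} → M ≤ j → fold θ θ⁻ j ≈ 0#
  fold≈0 {suc j} M≤j = trans (+-cong (θ≈0 M≤j) (θ⁻≈0 M≤j)) (+-identityʳ 0#)

  sum≈0 : ∀ {j} → M ≤ j → θ j + θ⁻ j ≈ 0#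
  sum≈0 M≤j = trans (+-cong (θ≈0 M≤j) (θ⁻≈0 (ℕₚ.m≤n⇒m≤1+n M≤j))) (+-identityʳ 0#)

  -- Jacobi's triple product. `total-fold` and `total-sum` concern the same bilateral series, folded
  -- about 0 and about -1/2 as the kernels ε = 0 and ε = 1 require.
  total-fold : total (fold θ θ⁻) ≈ rise (- P) M * (rise (- z) M * rise (- w) M)
  total-fold = extract (ℕₚ.≤-trans M≤2M (ℕₚ.m≤m+n _ _)) (begin
    rise (- P) (M ℕ.+ M ℕ.+ (M ℕ.+ M)) * (h M * h M * total (fold θ θ⁻))
      ≈⟨ *-congˡ (sym (bailey-limit 0 _ fold≈0)) ⟩
    rise (- P) (M ℕ.+ M ℕ.+ (M ℕ.+ M)) * E (M ℕ.+ M)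
      ≈⟨ E-product (M ℕ.+ M) ⟩
    rise (- z) (M ℕ.+ M) * rise (- w) (M ℕ.+ M)
      ≈⟨ *-cong (rise-stable (- z) M≤2M) (rise-stable (- w) M≤2M) ⟩
    rise (- z) M * rise (- w) M ∎)

  total-sum : total (λ j → θ j + θ⁻ j) ≈ rise (- P) M * (rise (- z) M * rise (- w) M)
  total-sum = extract (ℕₚ.m≤n⇒m≤1+n (ℕₚ.≤-trans M≤2M (ℕₚ.m≤m+n _ _))) (begin
    rise (- P) (suc (M ℕ.+ M ℕ.+ (M ℕ.+ M))) * (h M * h M * total (λ j → θ j + θ⁻ j))
      ≈⟨ *-congˡ (sym (bailey-limit 1 _ sum≈0)) ⟩
    rise (- P) (suc (M ℕ.+ M ℕ.+ (M ℕ.+ M))) * D (M ℕ.+ M)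
      ≈⟨ D-product (M ℕ.+ M) ⟩
    rise (- z) (suc (M ℕ.+ M)) * rise (- w) (M ℕ.+ M)
      ≈⟨ *-cong (rise-stable (- z) (ℕₚ.m≤n⇒m≤1+n M≤2M)) (rise-stable (- w) M≤2M) ⟩
    rise (- z) M * rise (- w) M ∎)

-- The chain evaluated as a theta series

module ChainPowers {c ℓ} (R : CommutativeRing c ℓ) (S : QData R) where
  open CommutativeRing R renaming (zero to *-zero)
  open QData S
  open Rising R Q
  open Relation.Binary.Reasoning.Setoid setoid
  open IntegerSolver R
  open BaileyChain R S
  open Algebra.Properties.CommutativeSemiring.Exp commutativeSemiring using (^-distrib-*)

  Q^j : ∀ j → Q ^ j ≈ q ^ (j ℕ.+ j)
  Q^j j = trans (^-distrib-* q q j) (sym (^-homo-* q j j))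

  q^-+ : ∀ d e {f} → d ℕ.+ e ≡ f → q ^ d * q ^ e ≈ q ^ f
  q^-+ d e ≡.refl = sym (^-homo-* q d e)

  qQ^j : ∀ j → q * Q ^ j ≈ q ^ suc (j ℕ.+ j)
  qQ^j j = *-congˡ (Q^j j)

  -- From j to j + 1, `coeff` gains - q^(4j+2) and each of the m copies of `pair` gains q^(4j+4).
  even-seq-suc : ∀ m j → even-seq m (suc j) ≈ - (even-seq m j * q ^ (4 ℕ.* j ℕ.+ 2 ℕ.+ (4 ℕ.* j ℕ.+ 4) ℕ.* m))
  even-seq-suc m j = begin
    - (coeff j * Q ^ suc (j ℕ.+ j)) * pair (suc j) ^ m
      ≈⟨ *-cong (-‿cong (*-congˡ (trans (Q^j (suc (j ℕ.+ j))) (^-congʳ q e₁)))) (^-congˡ m pair-suc) ⟩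
    - (coeff j * q ^ (4 ℕ.* j ℕ.+ 2)) * (pair j * q ^ (4 ℕ.* j ℕ.+ 4)) ^ m
      ≈⟨ *-congˡ (trans (^-distrib-* _ _ m) (*-congˡ (^-assocʳ q (4 ℕ.* j ℕ.+ 4) m))) ⟩
    - (coeff j * q ^ (4 ℕ.* j ℕ.+ 2)) * (pair j ^ m * q ^ ((4 ℕ.* j ℕ.+ 4) ℕ.* m))
      ≈⟨ solve 4 (λ c x p y → :- (c :* x) :* (p :* y) := :- (c :* p :* (x :* y))) refl _ _ _ _ ⟩
    - (coeff j * pair j ^ m * (q ^ (4 ℕ.* j ℕ.+ 2) * q ^ ((4 ℕ.* j ℕ.+ 4) ℕ.* m)))
      ≈⟨ -‿cong (*-congˡ (q^-+ (4 ℕ.* j ℕ.+ 2) ((4 ℕ.* j ℕ.+ 4) ℕ.* m) ≡.refl)) ⟩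
    - (even-seq m j * q ^ (4 ℕ.* j ℕ.+ 2 ℕ.+ (4 ℕ.* j ℕ.+ 4) ℕ.* m)) ∎
    where
    e₁ : suc (j ℕ.+ j) ℕ.+ suc (j ℕ.+ j) ≡ 4 ℕ.* j ℕ.+ 2
    e₁ = solveℕ 1 (λ j → cst 1 ⊹ (j ⊹ j) ⊹ (cst 1 ⊹ (j ⊹ j)) :≡ cst 4 ⊠ j ⊹ cst 2) ≡.refl j
    e₂ : suc (suc (suc (j ℕ.+ j))) ℕ.+ suc (j ℕ.+ j) ≡ 4 ℕ.* j ℕ.+ 4
    e₂ = solveℕ 1 (λ j → cst 3 ⊹ (j ⊹ j) ⊹ (cst 1 ⊹ (j ⊹ j)) :≡ cst 4 ⊠ j ⊹ cst 4) ≡.refl j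
    pair-suc : pair (suc j) ≈ pair j * q ^ (4 ℕ.* j ℕ.+ 4)
    pair-suc = begin
      gauss (q * Q) j * (q * Q * Q ^ j) * (gauss q j * (q * Q ^ j))
        ≈⟨ solve 4 (λ g h q p → g :* (q :* (q :* q) :* p) :* (h :* (q :* p)) := g :* h :* (q :* (q :* (q :* p)) :* (q :* p))) refl _ _ q (Q ^ j) ⟩
      pair j * (q * (q * (q * Q ^ j)) * (q * Q ^ j))
        ≈⟨ *-congˡ (*-cong (*-congˡ (*-congˡ (qQ^j j))) (qQ^j j)) ⟩
      pair j * (q ^ suc (suc (suc (j ℕ.+ j))) * q ^ suc (j ℕ.+ j))
        ≈⟨ *-congˡ (q^-+ (suc (suc (suc (j ℕ.+ j)))) (suc (j ℕ.+ j)) e₂) ⟩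
      pair j * q ^ (4 ℕ.* j ℕ.+ 4) ∎

  pair^ : ∀ n → pair 0 ^ n ≈ 1#
  pair^ n = trans (^-congˡ n (*-identityˡ 1#)) (1^ n)

  gauss-* : ∀ x y n → gauss (x * y) n ≈ x ^ n * gauss y n
  gauss-* x y zero    = sym (*-identityˡ 1#)
  gauss-* x y (suc n) = trans (*-congʳ (gauss-* x y n))
    (solve 5 (λ x y p g r → p :* g :* (x :* y :* r) := x :* p :* (g :* (y :* r))) refl _ _ _ _ _)

module Vanishing {c ℓ} (R : CommutativeRing c ℓ) (S : QData R)
  (M : ℕ) (q^≈0 : Rising.Nilpotent R (QData.q S) M) where
  open CommutativeRing R renaming (zero to *-zero)
  open QData S
  open Rising R Q
  open BaileyChain R S
  open ChainPowers R S

  [q^e]^≈0 : ∀ e → 1 ≤ e → Rising.Nilpotent R (q ^ e) M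
  [q^e]^≈0 (suc e) _ {n} M≤n = trans (^-assocʳ q (suc e) n) (q^≈0 (ℕₚ.≤-trans M≤n (ℕₚ.m≤m+n n _)))

  Q^≈0 : Nilpotent M
  Q^≈0 {n} M≤n = trans (Q^j n) (q^≈0 (ℕₚ.≤-trans M≤n (ℕₚ.m≤m+n n n)))

  gauss≈0 : ∀ y {n} → M ≤ n → gauss (q * y) n ≈ 0#
  gauss≈0 y {n} M≤n = trans (gauss-* q y n) (trans (*-congʳ (q^≈0 M≤n)) (zeroˡ _))

  gauss-q≈0 : ∀ {n} → M ≤ n → gauss q n ≈ 0#
  gauss-q≈0 {n} M≤n = trans (gauss-cong n (sym (*-identityʳ q))) (gauss≈0 1# M≤n)

  β≈0 : ∀ {K a m} (C : Chain K a m) {s} → M ≤ s → β C s ≈ 0#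
  β≈0 base      M≤s = trans (*-congʳ (gauss≈0 Q M≤s)) (zeroˡ _)
  β≈0 (turn C)  M≤s = trans (*-congʳ (gauss≈0 Q M≤s)) (zeroˡ _)
  β≈0 (plain C) M≤s = trans (*-congʳ (gauss-q≈0 M≤s)) (zeroˡ _)

module ChainLimit {c ℓ} (R : CommutativeRing c ℓ) (S : QData R)
  (M′ : ℕ) (q^≈0 : Rising.Nilpotent R (QData.q S) (suc M′)) where
  open CommutativeRing R renaming (zero to *-zero)
  open QData S
  open Rising R Q
  open Relation.Binary.Reasoning.Setoid setoid
  open IntegerSolver R
  open BaileyStep R Q I I-inverse
  open BaileyChain R S
  open ChainPowers R S
  open Algebra.Properties.CommutativeSemiring.Exp commutativeSemiring using (^-distrib-*)

  private
    M : ℕ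
    M = suc M′

  open Vanishing R S M q^≈0
  open Stable R Q I I-inverse M Q^≈0

  -- At n = 2M the left side of the closed form is `I M` times the full sum and the right side has
  -- `I M` twice; multiplying by (Q;Q)_M removes one from each. The separate index n admits both
  -- (-q;q²)_{2M} and (-q;q²)_{2M+1}.
  assemble : ∀ {K a m} (C : Chain K a m) ε {n} α → M ≤ n → (∀ {j} → M ≤ j → α j ≈ 0#) →
    γ C (M ℕ.+ M) ≈ rise q n * bailey ε α (M ℕ.+ M) →
    total (β C) ≈ rise q M * total α * I M
  assemble C ε {n} α M≤n α≈0 eq = begin
    total (β C)                                    ≈⟨ sym (*-identityˡ _) ⟩
    1# * total (β C)                               ≈⟨ *-congʳ (sym (I-inverse M)) ⟩
    rise (- Q) M * I M * total (β C)               ≈⟨ *-assoc _ _ _ ⟩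
    rise (- Q) M * (I M * total (β C))             ≈⟨ *-congˡ (sym (convolution-limit (β C) (β≈0 C))) ⟩
    rise (- Q) M * γ C (M ℕ.+ M)                   ≈⟨ *-congˡ eq ⟩
    rise (- Q) M * (rise q n * bailey ε α (M ℕ.+ M))
      ≈⟨ *-congˡ (*-cong (rise-stable q M≤n) (bailey-limit ε α α≈0)) ⟩
    rise (- Q) M * (rise q M * (I M * I M * total α))
      ≈⟨ solve 4 (λ r s i t → r :* (s :* (i :* i :* t)) := r :* i :* (s :* t :* i)) refl _ _ _ _ ⟩
    rise (- Q) M * I M * (rise q M * total α * I M) ≈⟨ *-congʳ (I-inverse M) ⟩
    1# * (rise q M * total α * I M)                ≈⟨ *-identityˡ _ ⟩
    rise q M * total α * I M                       ∎

  -- With k = a + 2m + 1 the exponent a + 4(m + 1) is 2k + 2 - a, and P is q^(2k+2).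
  module Target (a m : ℕ) (a≥1 : 1 ≤ a)
    (h : ℕ → Carrier) (h-inverse : Rising.Reciprocal R (q ^ a * q ^ (a ℕ.+ 4 ℕ.* suc m)) h) where
    z w P : Carrier
    z = q ^ a
    w = q ^ (a ℕ.+ 4 ℕ.* suc m)
    P = z * w

    open Rising R P using () renaming (rise to riseP)
    open TripleProduct R P h h-inverse using (fold; module Theta)
    open Theta z w refl using (θ; θ⁻)
    open ThetaLimit R z w P refl h h-inverse M′ ([q^e]^≈0 a a≥1) ([q^e]^≈0 (a ℕ.+ 4 ℕ.* suc m) (ℕₚ.≤-trans a≥1 (ℕₚ.m≤m+n a _)))

    θ-ratio : ∀ j → w ^ suc j * z ^ j ≈ q ^ ((a ℕ.+ 4 ℕ.* suc m) ℕ.* suc j ℕ.+ a ℕ.* j)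
    θ-ratio j = trans (*-cong (^-assocʳ q (a ℕ.+ 4 ℕ.* suc m) (suc j)) (^-assocʳ q a j)) (q^-+ ((a ℕ.+ 4 ℕ.* suc m) ℕ.* suc j) (a ℕ.* j) ≡.refl)

    -- Recognising a theta sequence is reduced to its value at 0 and to an identity between
    -- exponents of q in successive ratios.
    θ-unique : ∀ (x : ℕ → Carrier) → x 0 ≈ 1# →
      (∀ j → x (suc j) ≈ - (x j * q ^ ((a ℕ.+ 4 ℕ.* suc m) ℕ.* suc j ℕ.+ a ℕ.* j))) → ∀ j → x j ≈ θ j
    θ-unique x x₀ x₊ zero    = x₀
    θ-unique x x₀ x₊ (suc j) = trans (x₊ j) (-‿cong (*-cong (θ-unique x x₀ x₊ j) (sym (θ-ratio j))))

    target : Carrier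
    target = rise q M * (riseP (- P) M * (riseP (- z) M * riseP (- w) M)) * I M

    -- For a = 1 one has z = q, and the factor 1 - q^(2j+1) left by the last linear level already is
    -- 1 - z^(2j+1), giving θ j + θ⁻ j with the kernel ε = 1.
    total-odd : ∀ {K} → a ≡ 1 → (C : Chain K 1 m) → total (β C) ≈ target
    total-odd ≡.refl C = begin
      total (β C)
        ≈⟨ assemble C 1 (λ j → odd-seq m j * (1# - q * Q ^ j)) (ℕₚ.m≤n⇒m≤1+n (ℕₚ.m≤m+n M M)) (λ {j} M≤j → trans (α≈ j) (sum≈0 M≤j)) (γ-odd C (M ℕ.+ M)) ⟩
      rise q M * total (λ j → odd-seq m j * (1# - q * Q ^ j)) * I M
        ≈⟨ *-congʳ (*-congˡ (trans (total-cong α≈) total-sum)) ⟩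
      target ∎
      where
      e : ∀ j → 4 ℕ.* j ℕ.+ 2 ℕ.+ (4 ℕ.* j ℕ.+ 4) ℕ.* m ℕ.+ suc (suc (suc (j ℕ.+ j))) ≡ (1 ℕ.+ 4 ℕ.* suc m) ℕ.* suc j ℕ.+ 1 ℕ.* j
      e j = solveℕ 2 (λ j m → cst 4 ⊠ j ⊹ cst 2 ⊹ (cst 4 ⊠ j ⊹ cst 4) ⊠ m ⊹ (cst 3 ⊹ (j ⊹ j))
        :≡ (cst 1 ⊹ cst 4 ⊠ (cst 1 ⊹ m)) ⊠ (cst 1 ⊹ j) ⊹ cst 1 ⊠ j) ≡.refl j m
      odd-suc : ∀ j → odd-seq m (suc j) ≈ - (odd-seq m j * q ^ ((1 ℕ.+ 4 ℕ.* suc m) ℕ.* suc j ℕ.+ 1 ℕ.* j))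
      odd-suc j = begin
        even-seq m (suc j) * (gauss (q * Q) j * (q * Q * Q ^ j))
          ≈⟨ *-cong (even-seq-suc m j) (*-congˡ (trans (solve 2 (λ q p → q :* (q :* q) :* p := q :* (q :* (q :* p))) refl q (Q ^ j))
                                                       (*-congˡ (*-congˡ (qQ^j j))))) ⟩
        - (even-seq m j * q ^ (4 ℕ.* j ℕ.+ 2 ℕ.+ (4 ℕ.* j ℕ.+ 4) ℕ.* m)) * (gauss (q * Q) j * q ^ suc (suc (suc (j ℕ.+ j))))
          ≈⟨ solve 4 (λ e x g y → :- (e :* x) :* (g :* y) := :- (e :* g :* (x :* y))) refl _ _ _ _ ⟩
        - (odd-seq m j * (q ^ (4 ℕ.* j ℕ.+ 2 ℕ.+ (4 ℕ.* j ℕ.+ 4) ℕ.* m) * q ^ suc (suc (suc (j ℕ.+ j)))))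
          ≈⟨ -‿cong (*-congˡ (q^-+ (4 ℕ.* j ℕ.+ 2 ℕ.+ (4 ℕ.* j ℕ.+ 4) ℕ.* m) (suc (suc (suc (j ℕ.+ j)))) (e j))) ⟩
        - (odd-seq m j * q ^ ((1 ℕ.+ 4 ℕ.* suc m) ℕ.* suc j ℕ.+ 1 ℕ.* j)) ∎
      α≈ : ∀ j → odd-seq m j * (1# - q * Q ^ j) ≈ θ j + θ⁻ j
      α≈ j = begin
        odd-seq m j * (1# - q * Q ^ j)
          ≈⟨ *-cong (θ-unique (odd-seq m) (trans (*-identityʳ _) (trans (*-identityˡ _) (pair^ m))) odd-suc j)
                    (+-congˡ (-‿cong (trans (qQ^j j) (sym (^-congˡ (suc (j ℕ.+ j)) (*-identityʳ q)))))) ⟩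
        θ j * (1# - z ^ suc (j ℕ.+ j))
          ≈⟨ solve 2 (λ t p → t :* (con (+ 1) :- p) := t :+ :- (t :* p)) refl _ _ ⟩
        θ j + θ⁻ j ∎

    total-inner : ∀ {K} i → a ≡ 2 ℕ.+ i → (C : Chain K (2 ℕ.+ i) m) → total (β C) ≈ target
    total-inner i ≡.refl C = begin
      total (β C)
        ≈⟨ assemble C 0 (inner-seq m i) (ℕₚ.m≤m+n M M) (λ {j} M≤j → trans (α≈ j) (fold≈0 M≤j)) (γ-inner i C (M ℕ.+ M)) ⟩
      rise q M * total (inner-seq m i) * I M
        ≈⟨ *-congʳ (*-congˡ (trans (total-cong α≈) total-fold)) ⟩
      target ∎
      where
      X : ℕ → Carrier
      X j = even-seq (suc m) j * gauss q j ^ i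
      gauss^ : ∀ j → gauss q (suc j) ^ i ≈ gauss q j ^ i * q ^ (suc (j ℕ.+ j) ℕ.* i)
      gauss^ j = trans (^-distrib-* _ _ i) (*-congˡ (trans (^-congˡ i (qQ^j j)) (^-assocʳ q (suc (j ℕ.+ j)) i)))
      e : ∀ j → 4 ℕ.* j ℕ.+ 2 ℕ.+ (4 ℕ.* j ℕ.+ 4) ℕ.* suc m ℕ.+ suc (j ℕ.+ j) ℕ.* i
        ≡ (2 ℕ.+ i ℕ.+ 4 ℕ.* suc m) ℕ.* suc j ℕ.+ (2 ℕ.+ i) ℕ.* j
      e j = solveℕ 3 (λ j m i → cst 4 ⊠ j ⊹ cst 2 ⊹ (cst 4 ⊠ j ⊹ cst 4) ⊠ (cst 1 ⊹ m) ⊹ (cst 1 ⊹ (j ⊹ j)) ⊠ i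
        :≡ (cst 2 ⊹ i ⊹ cst 4 ⊠ (cst 1 ⊹ m)) ⊠ (cst 1 ⊹ j) ⊹ (cst 2 ⊹ i) ⊠ j) ≡.refl j m i
      X-suc : ∀ j → X (suc j) ≈ - (X j * q ^ ((2 ℕ.+ i ℕ.+ 4 ℕ.* suc m) ℕ.* suc j ℕ.+ (2 ℕ.+ i) ℕ.* j))
      X-suc j = begin
        even-seq (suc m) (suc j) * gauss q (suc j) ^ i
          ≈⟨ *-cong (even-seq-suc (suc m) j) (gauss^ j) ⟩
        - (even-seq (suc m) j * q ^ (4 ℕ.* j ℕ.+ 2 ℕ.+ (4 ℕ.* j ℕ.+ 4) ℕ.* suc m)) * (gauss q j ^ i * q ^ (suc (j ℕ.+ j) ℕ.* i))
          ≈⟨ solve 4 (λ e x g y → :- (e :* x) :* (g :* y) := :- (e :* g :* (x :* y))) refl _ _ _ _ ⟩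
        - (X j * (q ^ (4 ℕ.* j ℕ.+ 2 ℕ.+ (4 ℕ.* j ℕ.+ 4) ℕ.* suc m) * q ^ (suc (j ℕ.+ j) ℕ.* i)))
          ≈⟨ -‿cong (*-congˡ (q^-+ (4 ℕ.* j ℕ.+ 2 ℕ.+ (4 ℕ.* j ℕ.+ 4) ℕ.* suc m) (suc (j ℕ.+ j) ℕ.* i) (e j))) ⟩
        - (X j * q ^ ((2 ℕ.+ i ℕ.+ 4 ℕ.* suc m) ℕ.* suc j ℕ.+ (2 ℕ.+ i) ℕ.* j)) ∎
      X≈θ : ∀ j → X j ≈ θ j
      X≈θ = θ-unique X (trans (*-cong (trans (*-identityˡ _) (pair^ (suc m))) (1^ i)) (*-identityˡ 1#)) X-suc
      e⁻ : ∀ j → suc (j ℕ.+ j) ℕ.+ suc (j ℕ.+ j) ℕ.+ suc (j ℕ.+ j) ℕ.* i ≡ (2 ℕ.+ i) ℕ.* suc (j ℕ.+ j)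
      e⁻ j = solveℕ 2 (λ j i → cst 1 ⊹ (j ⊹ j) ⊹ (cst 1 ⊹ (j ⊹ j)) ⊹ (cst 1 ⊹ (j ⊹ j)) ⊠ i
        :≡ (cst 2 ⊹ i) ⊠ (cst 1 ⊹ (j ⊹ j))) ≡.refl j i
      -- This term sits at place j + 1, so its weight is `gauss q (suc j) ^ i`. The excess
      -- q^((2j+1)i) over place j turns Q^(2j+1) into q^((2j+1)(2+i)) = z^(2j+1).
      Y≈θ⁻ : ∀ j → - (even-seq (suc m) j * Q ^ suc (j ℕ.+ j)) * gauss q (suc j) ^ i ≈ θ⁻ j
      Y≈θ⁻ j = begin
        - (even-seq (suc m) j * Q ^ suc (j ℕ.+ j)) * gauss q (suc j) ^ i
          ≈⟨ *-cong (-‿cong (*-congˡ (Q^j (suc (j ℕ.+ j))))) (gauss^ j) ⟩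
        - (even-seq (suc m) j * q ^ (suc (j ℕ.+ j) ℕ.+ suc (j ℕ.+ j))) * (gauss q j ^ i * q ^ (suc (j ℕ.+ j) ℕ.* i))
          ≈⟨ solve 4 (λ e x g y → :- (e :* x) :* (g :* y) := :- (e :* g :* (x :* y))) refl _ _ _ _ ⟩
        - (X j * (q ^ (suc (j ℕ.+ j) ℕ.+ suc (j ℕ.+ j)) * q ^ (suc (j ℕ.+ j) ℕ.* i)))
          ≈⟨ -‿cong (*-cong (X≈θ j) (trans
               (q^-+ (suc (j ℕ.+ j) ℕ.+ suc (j ℕ.+ j)) (suc (j ℕ.+ j) ℕ.* i) (e⁻ j)) (sym (^-assocʳ q (2 ℕ.+ i) (suc (j ℕ.+ j)))))) ⟩
        θ⁻ j ∎
      α≈ : ∀ j → inner-seq m i j ≈ fold θ θ⁻ j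
      α≈ zero    = X≈θ 0
      α≈ (suc j) = trans (distribʳ _ _ _) (+-cong (X≈θ (suc j)) (Y≈θ⁻ j))

    total-β : ∀ {K} (C : Chain K a m) → total (β C) ≈ target
    total-β base = total-odd ≡.refl base
    total-β C@(turn _)            = total-odd ≡.refl C
    total-β (plain {a = i} C) = total-inner i ≡.refl (plain C)

-- From the variables nᵢ to the partial sums Nᵢ

module MultiSum {c ℓ} (R : CommutativeRing c ℓ) (S : QData R)
  (M : ℕ) (q^≈0 : Rising.Nilpotent R (QData.q S) M) (l : ℕ) (M≤l : M ≤ l) where
  open CommutativeRing R renaming (zero to *-zero)
  open QData S
  open Rising R Q
  open Relation.Binary.Reasoning.Setoid setoid
  open IntegerSolver R
  open Antidiagonal R
  open BaileyChain R S
  open Vanishing R S M q^≈0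

  private
    above : ∀ {n} → l < n → M ≤ n
    above l<n = ℕₚ.≤-trans M≤l (ℕₚ.<⇒≤ l<n)

  box : (K : ℕ) → (Vec ℕ K → Carrier) → Carrier
  box zero    F = F []
  box (suc K) F = anti l (λ x _ → box K (λ v → F (x ∷ v)))

  box-cong : ∀ K {F G} → (∀ v → F v ≈ G v) → box K F ≈ box K G
  box-cong zero    F≈G = F≈G []
  box-cong (suc K) F≈G = anti-cong l (λ x _ _ → box-cong K (λ v → F≈G (x ∷ v)))

  term : ∀ {K a m} → Chain K a m → Vec ℕ (suc K) → Carrier
  term base      (x ∷ [])        = gauss (q * Q) (Nt (x ∷ []) 1) * (rise q x * J x)
  term (turn C)  v₊@(x ∷ v) = gauss (q * Q) (Nt v₊ 1) * (I x * term C v)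
  term (plain C) v₊@(x ∷ v) = gauss q (Nt v₊ 1) * (I x * term C v)

  private
    anti-truncate : ∀ x y (g : ℕ → Carrier) → (∀ {s} → y < s → g s ≈ 0#) → anti (x ℕ.+ y) (λ s _ → g s) ≈ anti y (λ s _ → g s)
    anti-truncate zero    y g g≈0 = refl
    anti-truncate (suc x) y g g≈0 = begin
      anti (suc x ℕ.+ y) (λ s _ → g s)           ≈⟨ anti-last (x ℕ.+ y) (λ s _ → g s) ⟩
      anti (x ℕ.+ y) (λ s _ → g s) + g (suc x ℕ.+ y)
        ≈⟨ +-cong (anti-truncate x y g g≈0) (g≈0 (s≤s (ℕₚ.m≤n+m y x))) ⟩
      anti y (λ s _ → g s) + 0#                  ≈⟨ +-identityʳ _ ⟩
      anti y (λ s _ → g s)                       ∎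

    -- As H vanishes above l, only the part x + s ≤ l of the square contributes; it is regrouped by
    -- n = x + s.
    square-to-triangle : ∀ (H b : ℕ → Carrier) → (∀ {n} → l < n → H n ≈ 0#) →
      anti l (λ x _ → anti l (λ s _ → H (x ℕ.+ s) * (I x * b s)))
      ≈ anti l (λ n _ → H n * anti n (λ s u → I u * b s))
    square-to-triangle H b H≈0 = begin
      anti l (λ x _ → anti l (λ s _ → f x s))
        ≈⟨ anti-cong l (λ x y x+y≡l → trans (reflexive (≡.cong (λ n → anti n (λ s _ → f x s)) (≡.sym x+y≡l)))
             (anti-truncate x y (f x) (λ {s} y<s → trans (*-congʳ (H≈0 (≡.subst (_< x ℕ.+ s) x+y≡l (ℕₚ.+-monoʳ-< x y<s)))) (zeroˡ _)))) ⟩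
      anti l (λ x y → anti y (λ s _ → f x s))
        ≈⟨ sym (anti-assoc l (λ x s _ → f x s)) ⟩
      anti l (λ n _ → anti n (λ x s → f x s))
        ≈⟨ anti-cong l (λ n _ _ → trans (anti-cong n (λ x s x+s≡n → *-congʳ (reflexive (≡.cong H x+s≡n)))) (sym (anti-*ˡ n _ _))) ⟩
      anti l (λ n _ → H n * anti n (λ x s → I x * b s))
        ≈⟨ anti-cong l (λ n _ _ → *-congˡ (anti-comm n (λ x s → I x * b s))) ⟩
      anti l (λ n _ → H n * anti n (λ s u → I u * b s)) ∎
      where
      f : ℕ → ℕ → Carrier
      f x s = H (x ℕ.+ s) * (I x * b s)

  -- The weight G is what makes the induction work: the next level multiplies the sum over v by a
  -- function of x + N₁(v).
  box-weighted : ∀ {K a m} (C : Chain K a m) (G : ℕ → Carrier) →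
    box (suc K) (λ v → G (Nt v 1) * term C v) ≈ anti l (λ s _ → G s * β C s)

  private
    box-level : ∀ {K a m} (C : Chain K a m) (g G : ℕ → Carrier) → (∀ {n} → l < n → g n ≈ 0#) →
      anti l (λ x _ → box (suc K) (λ v → G (x ℕ.+ Nt v 1) * (g (x ℕ.+ Nt v 1) * (I x * term C v))))
      ≈ anti l (λ s _ → G s * (g s * γ C s))
    box-level {K} C g G g≈0 = begin
      _ ≈⟨ anti-cong l (λ x _ _ → box-cong (suc K) (λ v →
             solve 4 (λ a b c d → a :* (b :* (c :* d)) := a :* b :* c :* d) refl (G (x ℕ.+ Nt v 1)) (g (x ℕ.+ Nt v 1)) (I x) (term C v))) ⟩
      anti l (λ x _ → box (suc K) (λ v → G (x ℕ.+ Nt v 1) * g (x ℕ.+ Nt v 1) * I x * term C v))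
        ≈⟨ anti-cong l (λ x _ _ → box-weighted C (λ s → G (x ℕ.+ s) * g (x ℕ.+ s) * I x)) ⟩
      anti l (λ x _ → anti l (λ s _ → G (x ℕ.+ s) * g (x ℕ.+ s) * I x * β C s))
        ≈⟨ anti-cong l (λ x _ _ → anti-cong l (λ s _ _ → *-assoc _ _ _)) ⟩
      anti l (λ x _ → anti l (λ s _ → G (x ℕ.+ s) * g (x ℕ.+ s) * (I x * β C s)))
        ≈⟨ square-to-triangle (λ s → G s * g s) (β C) (λ l<n → trans (*-congˡ (g≈0 l<n)) (zeroʳ _)) ⟩
      anti l (λ s _ → G s * g s * γ C s)
        ≈⟨ anti-cong l (λ s _ _ → *-assoc _ _ _) ⟩
      anti l (λ s _ → G s * (g s * γ C s)) ∎

  box-weighted base      G = anti-cong l (λ x _ _ → reflexive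
    (≡.cong (λ i → G i * (gauss (q * Q) i * (rise q x * J x))) (ℕₚ.+-identityʳ x)))
  box-weighted (turn C)  G = box-level C (gauss (q * Q)) G (λ l<n → gauss≈0 Q (above l<n))
  box-weighted (plain C) G = box-level C (gauss q) G (λ l<n → gauss-q≈0 (above l<n))

  box-term : ∀ {K a m} (C : Chain K a m) → box (suc K) (term C) ≈ anti l (λ s _ → β C s)
  box-term {K} C = begin
    box (suc K) (term C)                  ≈⟨ box-cong (suc K) {F = term C} (λ v → sym (*-identityˡ _)) ⟩
    box (suc K) (λ v → 1# * term C v)          ≈⟨ box-weighted C (λ _ → 1#) ⟩
    anti l (λ s _ → 1# * β C s)           ≈⟨ anti-cong l (λ s _ _ → *-identityˡ _) ⟩
    anti l (λ s _ → β C s)                ∎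

  term≈0 : ∀ {K a m} (C : Chain K a m) v → l < Nt v 1 → term C v ≈ 0#
  term≈0 base      (x ∷ []) l<N = trans (*-congʳ (gauss≈0 Q (above l<N))) (zeroˡ _)
  term≈0 (turn C)  (x ∷ v)  l<N = trans (*-congʳ (gauss≈0 Q (above l<N))) (zeroˡ _)
  term≈0 (plain C) (x ∷ v)  l<N = trans (*-congʳ (gauss-q≈0 (above l<N))) (zeroˡ _)

-- Truncated formal power series

open Antidiagonal ℤₚ.+-*-commutativeRing using () renaming
  (anti to antiℤ; anti-cong to antiℤ-cong; anti-last to antiℤ-last; anti-+ to antiℤ-+; anti-*ˡ to antiℤ-*ˡ;
   anti-comm to antiℤ-comm; anti-assoc to antiℤ-assoc)

Σ<-anti : ∀ n (h : ℕ → ℕ → ℤ) g → (∀ i j → i ℕ.+ j ≡ n → g i ≡ h i j) → Σ< (suc n) g ≡ antiℤ n h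
Σ<-anti zero    h g g≡h = ≡.trans (ℤₚ.+-identityˡ _) (g≡h 0 0 ≡.refl)
Σ<-anti (suc n) h g g≡h = ≡.trans
  (≡.cong₂ ℤ._+_
    (Σ<-anti n (λ i j → h i (suc j)) g (λ i j i+j≡n → g≡h i (suc j) (≡.trans (ℕₚ.+-suc i j) (≡.cong suc i+j≡n))))
    (g≡h (suc n) 0 (ℕₚ.+-identityʳ (suc n))))
  (≡.sym (antiℤ-last n h))

⊛-anti : ∀ f g n → (f ⊛ g) n ≡ antiℤ n (λ i j → f i ℤ.* g j)
⊛-anti f g n = Σ<-anti n _ _ (λ { i j ≡.refl → ≡.cong (λ k → f i ℤ.* g k) (ℕₚ.m+n∸m≡n i j) })

antiℤ-zero : ∀ n → antiℤ n (λ _ _ → + 0) ≡ + 0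
antiℤ-zero zero    = ≡.refl
antiℤ-zero (suc n) = ≡.trans (ℤₚ.+-identityˡ _) (antiℤ-zero n)

one-⊛ : ∀ f n → (one ⊛ f) n ≡ f n
one-⊛ f n = ≡.trans (⊛-anti one f n) (go n)
  where
  go : ∀ n → antiℤ n (λ i j → one i ℤ.* f j) ≡ f n
  go zero    = ℤₚ.*-identityˡ (f 0)
  go (suc n) = ≡.trans (≡.cong₂ ℤ._+_ (ℤₚ.*-identityˡ (f (suc n))) (antiℤ-zero n)) (ℤₚ.+-identityʳ _)

⊛-comm : ∀ f g n → (f ⊛ g) n ≡ (g ⊛ f) n
⊛-comm f g n = begin
  (f ⊛ g) n                        ≡⟨ ⊛-anti f g n ⟩
  antiℤ n (λ i j → f i ℤ.* g j)    ≡⟨ antiℤ-comm n _ ⟩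
  antiℤ n (λ i j → f j ℤ.* g i)    ≡⟨ antiℤ-cong n (λ i j _ → ℤₚ.*-comm (f j) (g i)) ⟩
  antiℤ n (λ i j → g i ℤ.* f j)    ≡⟨ ≡.sym (⊛-anti g f n) ⟩
  (g ⊛ f) n                        ∎
  where open ≡.≡-Reasoning

⊛-assoc : ∀ f g h n → ((f ⊛ g) ⊛ h) n ≡ (f ⊛ (g ⊛ h)) n
⊛-assoc f g h n = begin
  ((f ⊛ g) ⊛ h) n
    ≡⟨ ⊛-anti (f ⊛ g) h n ⟩
  antiℤ n (λ s u → (f ⊛ g) s ℤ.* h u)
    ≡⟨ antiℤ-cong n (λ s u _ → ≡.trans (ℤₚ.*-comm _ (h u)) (≡.trans (≡.cong (h u ℤ.*_) (⊛-anti f g s)) (antiℤ-*ˡ s (h u) _))) ⟩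
  antiℤ n (λ s u → antiℤ s (λ i j → h u ℤ.* (f i ℤ.* g j)))
    ≡⟨ antiℤ-assoc n (λ i j u → h u ℤ.* (f i ℤ.* g j)) ⟩
  antiℤ n (λ i r → antiℤ r (λ j u → h u ℤ.* (f i ℤ.* g j)))
    ≡⟨ antiℤ-cong n (λ i r _ → ≡.trans (antiℤ-cong r (λ j u _ → ≡.trans (ℤₚ.*-comm (h u) _) (ℤₚ.*-assoc (f i) (g j) (h u))))
         (≡.trans (≡.sym (antiℤ-*ˡ r (f i) _)) (≡.cong (f i ℤ.*_) (≡.sym (⊛-anti g h r))))) ⟩
  antiℤ n (λ i r → f i ℤ.* (g ⊛ h) r)
    ≡⟨ ≡.sym (⊛-anti f (g ⊛ h) n) ⟩
  (f ⊛ (g ⊛ h)) n ∎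
  where open ≡.≡-Reasoning

⊛-distribˡ : ∀ f g h n → (f ⊛ (g ⊕ h)) n ≡ ((f ⊛ g) ⊕ (f ⊛ h)) n
⊛-distribˡ f g h n = begin
  (f ⊛ (g ⊕ h)) n
    ≡⟨ ⊛-anti f (g ⊕ h) n ⟩
  antiℤ n (λ i j → f i ℤ.* (g j ℤ.+ h j))
    ≡⟨ antiℤ-cong n (λ i j _ → ℤₚ.*-distribˡ-+ (f i) (g j) (h j)) ⟩
  antiℤ n (λ i j → f i ℤ.* g j ℤ.+ f i ℤ.* h j)
    ≡⟨ antiℤ-+ n _ _ ⟩
  antiℤ n (λ i j → f i ℤ.* g j) ℤ.+ antiℤ n (λ i j → f i ℤ.* h j)
    ≡⟨ ≡.sym (≡.cong₂ ℤ._+_ (⊛-anti f g n) (⊛-anti f h n)) ⟩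
  ((f ⊛ g) ⊕ (f ⊛ h)) n ∎
  where open ≡.≡-Reasoning

-- Power series modulo q^M.  There q is nilpotent, so every limit becomes an exact equality.
psRing : ℕ → CommutativeRing 0ℓ 0ℓ
psRing M = record
  { Carrier = PS
  ; _≈_ = _≋_
  ; _+_ = _⊕_
  ; _*_ = _⊛_
  ; -_  = λ f n → ℤ.- f n
  ; 0#  = λ _ → + 0
  ; 1#  = one
  ; isCommutativeRing = record
    { isRing = record
      { +-isAbelianGroup = record
        { isGroup = record
          { isMonoid = record
            { isSemigroup = record
              { isMagma = record
                { isEquivalence = record
                  { refl  = λ _ _ → ≡.refl
                  ; sym   = λ f≋g n n<M → ≡.sym (f≋g n n<M)
                  ; trans = λ f≋g g≋h n n<M → ≡.trans (f≋g n n<M) (g≋h n n<M) }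
                ; ∙-cong = λ f≋f′ g≋g′ n n<M → ≡.cong₂ ℤ._+_ (f≋f′ n n<M) (g≋g′ n n<M) }
              ; assoc = λ f g h n _ → ℤₚ.+-assoc (f n) (g n) (h n) }
            ; identity = (λ f n _ → ℤₚ.+-identityˡ (f n)) , (λ f n _ → ℤₚ.+-identityʳ (f n)) }
          ; inverse = (λ f n _ → ℤₚ.+-inverseˡ (f n)) , (λ f n _ → ℤₚ.+-inverseʳ (f n))
          ; ⁻¹-cong = λ f≋g n n<M → ≡.cong ℤ.-_ (f≋g n n<M) }
        ; comm = λ f g n _ → ℤₚ.+-comm (f n) (g n) }
      ; *-cong = ⊛-cong
      ; *-assoc = λ f g h n _ → ⊛-assoc f g h n
      ; *-identity = (λ f n _ → one-⊛ f n) , (λ f n _ → ≡.trans (⊛-comm f one n) (one-⊛ f n))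
      ; distrib = (λ f g h n _ → ⊛-distribˡ f g h n)
                , (λ f g h n _ → ≡.trans (⊛-comm (g ⊕ h) f n) (≡.trans (⊛-distribˡ f g h n)
                     (≡.cong₂ ℤ._+_ (⊛-comm f g n) (⊛-comm f h n)))) }
    ; *-comm = λ f g n _ → ⊛-comm f g n } }
  where
  _≋_ : PS → PS → Set
  f ≋ g = ∀ n → n < M → f n ≡ g n
  ⊛-cong : ∀ {f f′ g g′} → f ≋ f′ → g ≋ g′ → (f ⊛ g) ≋ (f′ ⊛ g′)
  ⊛-cong {f} {f′} {g} {g′} f≋f′ g≋g′ n n<M = ≡.trans (⊛-anti f g n) (≡.trans
    (antiℤ-cong n (λ { i j ≡.refl → ≡.cong₂ ℤ._*_ (f≋f′ i (ℕₚ.≤-<-trans (ℕₚ.m≤m+n i j) n<M)) (g≋g′ j (ℕₚ.≤-<-trans (ℕₚ.m≤n+m j i) n<M)) }))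
    (≡.sym (⊛-anti f′ g′ n)))

-- The function dot of Defs is private; unification in inv-suc solves the meta to it.
mutual
  dot : PS → ℕ → List ℤ → ℤ
  dot = _

  inv-suc : ∀ f n → inv f (suc n) ≡ ℤ.- dot f 1 (invList f n)
  inv-suc f n with ℤ.-_ | invList f n | 1
  ... | _ | _ | _ = ≡.refl

-- `invList f n` lists the coefficients of the inverse from n down to 0. The offset i is general
-- because `dot` advances it at each entry.
dot-anti : ∀ f i n → dot f i (invList f n) ≡ antiℤ n (λ j u → f (i ℕ.+ j) ℤ.* inv f u)
dot-anti f i zero    = ≡.trans (ℤₚ.+-identityʳ _) (≡.cong (λ k → f k ℤ.* + 1) (≡.sym (ℕₚ.+-identityʳ i)))
dot-anti f i (suc n) = ≡.cong₂ ℤ._+_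
  (≡.cong (λ k → f k ℤ.* inv f (suc n)) (≡.sym (ℕₚ.+-identityʳ i)))
  (≡.trans (dot-anti f (suc i) n)
    (antiℤ-cong n (λ j u _ → ≡.cong (λ k → f k ℤ.* inv f u) (≡.sym (ℕₚ.+-suc i j)))))

inv-inverse : ∀ f → f 0 ≡ + 1 → ∀ n → (f ⊛ inv f) n ≡ one n
inv-inverse f f₀≡1 zero    = ≡.cong (λ c → + 0 ℤ.+ c ℤ.* + 1) f₀≡1
inv-inverse f f₀≡1 (suc n) = begin
  (f ⊛ inv f) (suc n)
    ≡⟨ ⊛-anti f (inv f) (suc n) ⟩
  f 0 ℤ.* inv f (suc n) ℤ.+ antiℤ n (λ j u → f (suc j) ℤ.* inv f u)
    ≡⟨ ≡.cong₂ ℤ._+_ (≡.cong₂ ℤ._*_ f₀≡1 (inv-suc f n)) (≡.sym (dot-anti f 1 n)) ⟩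
  + 1 ℤ.* (ℤ.- dot f 1 (invList f n)) ℤ.+ dot f 1 (invList f n)
    ≡⟨ ≡.cong (ℤ._+ dot f 1 (invList f n)) (ℤₚ.*-identityˡ (ℤ.- dot f 1 (invList f n))) ⟩
  ℤ.- dot f 1 (invList f n) ℤ.+ dot f 1 (invList f n)
    ≡⟨ ℤₚ.+-inverseˡ (dot f 1 (invList f n)) ⟩
  + 0 ∎
  where open ≡.≡-Reasoning

⊛-constant : ∀ f g → f 0 ≡ + 1 → g 0 ≡ + 1 → (f ⊛ g) 0 ≡ + 1
⊛-constant f g f₀≡1 g₀≡1 = ≡.cong₂ (λ x y → + 0 ℤ.+ x ℤ.* y) f₀≡1 g₀≡1

poch-constant : ∀ ε c d n → poch ε (suc c) d n 0 ≡ + 1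
poch-constant ε c d zero    = ≡.refl
poch-constant ε c d (suc n) = ⊛-constant (poch ε (suc c) d n) (factor ε (suc c ℕ.+ d ℕ.* n)) (poch-constant ε c d n)
  (≡.cong (λ k → + 1 ℤ.+ k) (ℤₚ.*-zeroʳ (ℤ.- ε)))

prodPS-constant : ∀ n F → (∀ j → F j 0 ≡ + 1) → prodPS n F 0 ≡ + 1
prodPS-constant zero    F F₀≡1 = ≡.refl
prodPS-constant (suc n) F F₀≡1 = ⊛-constant (prodPS n F) (F n) (prodPS-constant n F F₀≡1) (F₀≡1 n)

mono-< : ∀ {e n} → n < e → mono e n ≡ + 0
mono-< {suc e} {zero}  n<e       = ≡.refl
mono-< {suc e} {suc n} (s≤s n<e) = mono-< n<e

mono-zero : ∀ n → mono 0 n ≡ one n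
mono-zero zero    = ≡.refl
mono-zero (suc n) = ≡.refl

mono-suc : ∀ e n → mono (suc e) n ≡ (mono 1 ⊛ mono e) n
mono-suc e n = ≡.sym (≡.trans (⊛-anti (mono 1) (mono e) n) (go n))
  where
  go : ∀ n → antiℤ n (λ i j → mono 1 i ℤ.* mono e j) ≡ mono (suc e) n
  go zero    = ≡.refl
  go (suc n) = begin
    + 0 ℤ.+ antiℤ n (λ i j → mono 0 i ℤ.* mono e j)
      ≡⟨ ℤₚ.+-identityˡ _ ⟩
    antiℤ n (λ i j → mono 0 i ℤ.* mono e j)
      ≡⟨ antiℤ-cong n (λ i j _ → ≡.cong (ℤ._* mono e j) (mono-zero i)) ⟩
    antiℤ n (λ i j → one i ℤ.* mono e j)
      ≡⟨ ≡.sym (⊛-anti one (mono e) n) ⟩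
    (one ⊛ mono e) n
      ≡⟨ one-⊛ (mono e) n ⟩
    mono e n ∎
    where open ≡.≡-Reasoning

sumℕ-suc : ∀ n f → sumℕ (suc n) f ≡ f 0 ℕ.+ sumℕ n (λ i → f (suc i))
sumℕ-suc zero    f = ≡.sym (ℕₚ.+-identityʳ (f 0))
sumℕ-suc (suc n) f = ≡.trans (≡.cong (ℕ._+ f (suc n)) (sumℕ-suc n f)) (ℕₚ.+-assoc (f 0) _ _)

sumℕ-cong : ∀ n {f g} → (∀ i → f i ≡ g i) → sumℕ n f ≡ sumℕ n g
sumℕ-cong zero    f≡g = ≡.refl
sumℕ-cong (suc n) f≡g = ≡.cong₂ ℕ._+_ (sumℕ-cong n f≡g) (f≡g n)

-- Dropping n₁ renumbers N_{i+1} as N_i, so only N₁² is lost and a falls by one.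
expo-plain : ∀ K a x (v : Vec ℕ (suc K)) →
  expo (3 ℕ.+ K) (2 ℕ.+ a) (x ∷ v) ≡ Nt (x ∷ v) 1 ℕ.* Nt (x ∷ v) 1 ℕ.+ expo (2 ℕ.+ K) (1 ℕ.+ a) v
expo-plain K a x v = ≡.trans
  (≡.cong (ℕ._+ 2 ℕ.* sumℕ ⌊ (2 ℕ.+ K ℕ.+ 1 ∸ (1 ℕ.+ a)) /2⌋ (λ t → Nt v (1 ℕ.+ a ℕ.+ 2 ℕ.* t)))
    (sumℕ-suc (suc K) (λ j → Nt (x ∷ v) (suc j) ℕ.* Nt (x ∷ v) (suc j))))
  (ℕₚ.+-assoc (Nt (x ∷ v) 1 ℕ.* Nt (x ∷ v) 1) _ _)

-- Besides N₁² the linear term 2N₁ is lost; the next one, at N₃, becomes N₂ of the tail, whence a =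
-- 2 there.
expo-turn : ∀ K x (v : Vec ℕ (suc K)) →
  expo (3 ℕ.+ K) 1 (x ∷ v) ≡ (Nt (x ∷ v) 1 ℕ.* Nt (x ∷ v) 1 ℕ.+ 2 ℕ.* Nt (x ∷ v) 1) ℕ.+ expo (2 ℕ.+ K) 2 v
expo-turn K x v = ≡.trans
  (≡.cong₂ (λ s t → s ℕ.+ 2 ℕ.* t)
    (sumℕ-suc (suc K) (λ j → Nt (x ∷ v) (suc j) ℕ.* Nt (x ∷ v) (suc j)))
    (≡.trans (sumℕ-suc c (λ t → Nt (x ∷ v) (1 ℕ.+ 2 ℕ.* t)))
      (≡.cong (Nt (x ∷ v) 1 ℕ.+_) (sumℕ-cong c (λ t → ≡.cong (λ i → Nt v (suc i)) (ℕₚ.+-suc t (t ℕ.+ 0)))))))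
  (solveℕ 4 (λ N s n l → (N ⊹ s) ⊹ cst 2 ⊠ (n ⊹ l) :≡ (N ⊹ cst 2 ⊠ n) ⊹ (s ⊹ cst 2 ⊠ l)) ≡.refl
    (Nt (x ∷ v) 1 ℕ.* Nt (x ∷ v) 1) (sumℕ (suc K) (λ j → Nt v (suc j) ℕ.* Nt v (suc j))) (Nt (x ∷ v) 1) (sumℕ c (λ t → Nt v (2 ℕ.+ 2 ℕ.* t))))
  where c = ⌊ (K ℕ.+ 1) /2⌋

denom-constant : ∀ K (v : Vec ℕ (suc K)) → denom (2 ℕ.+ K) v 0 ≡ + 1
denom-constant K v = ⊛-constant (prodPS K (λ j → poch (+ 1) 2 2 (nAt v (suc j)))) (poch (+ 1) 4 4 (nAt v (suc K)))
  (prodPS-constant K _ (λ j → poch-constant (+ 1) 1 2 (nAt v (suc j))))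
  (poch-constant (+ 1) 3 4 (nAt v (suc K)))

-- The new factor has exponent c + (d + 1) n ≥ n, so it is 1 modulo q^n.
poch-stable : ∀ ε c d n {i} → i < n → poch ε c (suc d) (suc n) i ≡ poch ε c (suc d) n i
poch-stable ε c d n i<n = ≡.trans
  (*-cong {poch ε c (suc d) n} {poch ε c (suc d) n} {factor ε (c ℕ.+ suc d ℕ.* n)} {one} (λ _ _ → ≡.refl)
    (λ j j<n → ≡.trans (≡.cong (λ x → one j ℤ.+ x) (late j j<n)) (ℤₚ.+-identityʳ (one j))) _ i<n)
  (*-identityʳ (poch ε c (suc d) n) _ i<n)
  where
  open CommutativeRing (psRing n) using (*-cong; *-identityʳ)
  late : ∀ i → i < n → ((ℤ.- ε) · mono (c ℕ.+ suc d ℕ.* n)) i ≡ + 0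
  late i i<n = ≡.trans (≡.cong (ℤ.- ε ℤ.*_) (mono-< (ℕₚ.<-≤-trans i<n (ℕₚ.≤-trans (ℕₚ.m≤m+n n (d ℕ.* n)) (ℕₚ.m≤n+m _ c))))) (ℤₚ.*-zeroʳ (ℤ.- ε))

pochInf-poch : ∀ ε c d M i → i < M → pochInf ε c (suc d) i ≡ poch ε c (suc d) M i
pochInf-poch ε c d M i i<M = ≡.sym (≡.subst (λ n → poch ε c (suc d) n i ≡ pochInf ε c (suc d) i) (ℕₚ.m+[n∸m]≡n i<M) (go (M ∸ suc i)))
  where
  go : ∀ e → poch ε c (suc d) (suc i ℕ.+ e) i ≡ poch ε c (suc d) (suc i) i
  go zero    = ≡.cong (λ n → poch ε c (suc d) n i) (ℕₚ.+-identityʳ (suc i))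
  go (suc e) = ≡.trans (≡.cong (λ n → poch ε c (suc d) n i) (ℕₚ.+-suc (suc i) e))
    (≡.trans (poch-stable ε c d (suc i ℕ.+ e) (s≤s (ℕₚ.m≤m+n i e))) (go e))

-- Both sides of the identity in the abstract ring

-- A commutative ring R with a ring homomorphism from PS that only sees coefficients below M.
record Realisation {c ℓ} (R : CommutativeRing c ℓ) (M : ℕ) : Set (c ⊔ ℓ) where
  open CommutativeRing R
  field
    ⟦_⟧    : PS → Carrier
    ⟦⟧-cong : ∀ {f g} → (∀ n → n < M → f n ≡ g n) → ⟦ f ⟧ ≈ ⟦ g ⟧
    ⟦⟧-⊕   : ∀ f g → ⟦ f ⊕ g ⟧ ≈ ⟦ f ⟧ + ⟦ g ⟧
    ⟦⟧-⊛   : ∀ f g → ⟦ f ⊛ g ⟧ ≈ ⟦ f ⟧ * ⟦ g ⟧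
    ⟦⟧-neg : ∀ f → ⟦ (λ n → ℤ.- f n) ⟧ ≈ - ⟦ f ⟧
    ⟦⟧-zero : ⟦ (λ _ → + 0) ⟧ ≈ 0#
    ⟦⟧-one : ⟦ one ⟧ ≈ 1#

module Modulo {c ℓ} (R : CommutativeRing c ℓ) (M : ℕ) (real : Realisation R M) where
  open CommutativeRing R renaming (zero to *-zero)
  open Realisation real
  open Relation.Binary.Reasoning.Setoid setoid
  open IntegerSolver R
  open Algebra.Properties.Ring ring using (-‿distribˡ-*)
  open Rising R using (rise)
  open Rising R 1# using (_^_; ^-homo-*; ^-assocʳ; ^-congˡ)

  q : Carrier
  q = ⟦ mono 1 ⟧

  ⟦⟧-≗ : ∀ {f g} → (∀ n → f n ≡ g n) → ⟦ f ⟧ ≈ ⟦ g ⟧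
  ⟦⟧-≗ f≗g = ⟦⟧-cong (λ n _ → f≗g n)

  mono≈q^ : ∀ e → ⟦ mono e ⟧ ≈ q ^ e
  mono≈q^ zero    = trans (⟦⟧-≗ mono-zero) ⟦⟧-one
  mono≈q^ (suc e) = trans (⟦⟧-≗ (mono-suc e)) (trans (⟦⟧-⊛ (mono 1) (mono e)) (*-congˡ (mono≈q^ e)))

  q^≈0 : Rising.Nilpotent R q M
  q^≈0 {e} M≤e = trans (sym (mono≈q^ e)) (trans (⟦⟧-cong (λ n n<M → mono-< (ℕₚ.<-≤-trans n<M M≤e))) ⟦⟧-zero)

  inverseʳ : ∀ f → f 0 ≡ + 1 → ⟦ f ⟧ * ⟦ inv f ⟧ ≈ 1#
  inverseʳ f f₀≡1 = trans (sym (⟦⟧-⊛ f (inv f))) (trans (⟦⟧-≗ (inv-inverse f f₀≡1)) ⟦⟧-one)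

  inverse-unique : ∀ {f g x y} → f * x ≈ 1# → g * y ≈ 1# → f ≈ g → x ≈ y
  inverse-unique {f} {g} {x} {y} fx gy f≈g = begin
    x             ≈⟨ sym (*-identityʳ x) ⟩
    x * 1#        ≈⟨ *-congˡ (sym gy) ⟩
    x * (g * y)   ≈⟨ *-congˡ (*-congʳ (sym f≈g)) ⟩
    x * (f * y)   ≈⟨ solve 3 (λ x f y → x :* (f :* y) := f :* x :* y) refl x f y ⟩
    f * x * y     ≈⟨ *-congʳ fx ⟩
    1# * y        ≈⟨ *-identityˡ y ⟩
    y             ∎

  private
    q^[c+dn] : ∀ c d {y Q} → q ^ c ≈ y → q ^ d ≈ Q → ∀ n → ⟦ mono (c ℕ.+ d ℕ.* n) ⟧ ≈ y * Q ^ n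
    q^[c+dn] c d {y} {Q} q^c q^d n = begin
      ⟦ mono (c ℕ.+ d ℕ.* n) ⟧    ≈⟨ mono≈q^ (c ℕ.+ d ℕ.* n) ⟩
      q ^ (c ℕ.+ d ℕ.* n)         ≈⟨ ^-homo-* q c (d ℕ.* n) ⟩
      q ^ c * q ^ (d ℕ.* n)       ≈⟨ *-cong q^c (trans (sym (^-assocʳ q d n)) (^-congˡ n q^d)) ⟩
      y * Q ^ n                   ∎

    poch-factor : ∀ ε c d n {x} → ⟦ (ℤ.- ε) · mono (c ℕ.+ d ℕ.* n) ⟧ ≈ x →
      ⟦ poch ε c d (suc n) ⟧ ≈ ⟦ poch ε c d n ⟧ * (1# + x)
    poch-factor ε c d n eq = trans (⟦⟧-⊛ (poch ε c d n) (factor ε (c ℕ.+ d ℕ.* n)))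
      (*-congˡ (trans (⟦⟧-⊕ one _) (+-cong ⟦⟧-one eq)))

  poch⁺≈rise : ∀ c d {y Q} → q ^ c ≈ y → q ^ d ≈ Q → ∀ n → ⟦ poch (+ 1) c d n ⟧ ≈ rise Q (- y) n
  poch⁺≈rise c d q^c q^d zero    = ⟦⟧-one
  poch⁺≈rise c d {y} {Q} q^c q^d (suc n) = trans (poch-factor (+ 1) c d n (begin
    ⟦ -[1+ 0 ] · mono e ⟧        ≈⟨ ⟦⟧-≗ (λ i → ℤₚ.-1*i≡-i (mono e i)) ⟩
    ⟦ (λ i → ℤ.- mono e i) ⟧     ≈⟨ ⟦⟧-neg (mono e) ⟩
    - ⟦ mono e ⟧                 ≈⟨ -‿cong (q^[c+dn] c d q^c q^d n) ⟩
    - (y * Q ^ n)                ≈⟨ -‿distribˡ-* y (Q ^ n) ⟩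
    - y * Q ^ n                  ∎)) (*-congʳ (poch⁺≈rise c d q^c q^d n))
    where e = c ℕ.+ d ℕ.* n

  poch⁻≈rise : ∀ c d {y Q} → q ^ c ≈ y → q ^ d ≈ Q → ∀ n → ⟦ poch -[1+ 0 ] c d n ⟧ ≈ rise Q y n
  poch⁻≈rise c d q^c q^d zero    = ⟦⟧-one
  poch⁻≈rise c d q^c q^d (suc n) = trans (poch-factor -[1+ 0 ] c d n (trans
    (⟦⟧-≗ (λ i → ℤₚ.*-identityˡ (mono (c ℕ.+ d ℕ.* n) i))) (q^[c+dn] c d q^c q^d n)))
    (*-congʳ (poch⁻≈rise c d q^c q^d n))

-- The parity condition takes the form k = a + 2m + 1. The box bound l = 2M is the point at which
-- the finite identities are evaluated.
module Identity {c ℓ} (R : CommutativeRing c ℓ) (M′ a′ m : ℕ) (real : Realisation R (suc M′)) where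
  M = suc M′
  K = a′ ℕ.+ m ℕ.* 2
  k = suc (suc K)
  a = suc a′
  l = M ℕ.+ M

  open CommutativeRing R renaming (zero to *-zero)
  open Realisation real
  open Modulo R M real
  open Relation.Binary.Reasoning.Setoid setoid
  open IntegerSolver R

  Q : Carrier
  Q = q * q
  open Rising R Q
  open Rising R using () renaming (rise to riseAt)

  I J : ℕ → Carrier
  I n = ⟦ inv (poch (+ 1) 2 2 n) ⟧
  J n = ⟦ inv (poch (+ 1) 4 4 n) ⟧

  q^2≈Q : q ^ 2 ≈ Q
  q^2≈Q = *-congˡ (*-identityʳ q)

  I-inverse : ∀ n → rise (- Q) n * I n ≈ 1#
  I-inverse n = trans (*-congʳ (sym (poch⁺≈rise 2 2 q^2≈Q q^2≈Q n))) (inverseʳ (poch (+ 1) 2 2 n) (poch-constant (+ 1) 1 2 n))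

  q^4≈Q*Q : q ^ 4 ≈ Q * Q
  q^4≈Q*Q = solve 1 (λ q → q :* (q :* (q :* (q :* con (+ 1)))) := q :* q :* (q :* q)) refl q

  -- (Q²;Q²)ₙ = (Q;Q)ₙ (-Q;Q)ₙ, factor by factor from 1 - x² = (1 - x) (1 + x).
  J-inverse : ∀ n → rise (- Q) n * rise Q n * J n ≈ 1#
  J-inverse n = trans (*-congʳ (trans (conjugate n) (sym (poch⁺≈rise 4 4 q^4≈Q*Q q^4≈Q*Q n)))) (inverseʳ (poch (+ 1) 4 4 n) (poch-constant (+ 1) 3 4 n))
    where
    open import Algebra.Properties.CommutativeSemiring.Exp commutativeSemiring using (^-distrib-*)
    conjugate : ∀ n → rise (- Q) n * rise Q n ≈ riseAt (Q * Q) (- (Q * Q)) n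
    conjugate zero    = *-identityˡ 1#
    conjugate (suc n) = begin
      rise (- Q) n * (1# + - Q * Q ^ n) * (rise Q n * (1# + Q * Q ^ n))
        ≈⟨ solve 4 (λ r s x p → r :* (con (+ 1) :+ :- x :* p) :* (s :* (con (+ 1) :+ x :* p))
              := r :* s :* (con (+ 1) :+ :- (x :* x) :* (p :* p))) refl (rise (- Q) n) (rise Q n) Q (Q ^ n) ⟩
      rise (- Q) n * rise Q n * (1# + - (Q * Q) * (Q ^ n * Q ^ n))
        ≈⟨ *-cong (conjugate n) (+-congˡ (*-congˡ (sym (^-distrib-* Q Q n)))) ⟩
      riseAt (Q * Q) (- (Q * Q)) (suc n) ∎

  z w P : Carrier
  z = q ^ a
  w = q ^ (a ℕ.+ 4 ℕ.* suc m)
  P = z * w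

  other : 2 ℕ.* k ℕ.+ 2 ≡ a ℕ.+ (a ℕ.+ 4 ℕ.* suc m)
  other = solveℕ 2 (λ a m → cst 2 ⊠ (cst 2 ⊹ (a ⊹ m ⊠ cst 2)) ⊹ cst 2
    :≡ (cst 1 ⊹ a) ⊹ ((cst 1 ⊹ a) ⊹ cst 4 ⊠ (cst 1 ⊹ m))) ≡.refl a′ m

  other-∸ : 2 ℕ.* k ℕ.+ 2 ∸ a ≡ a ℕ.+ 4 ℕ.* suc m
  other-∸ = ≡.trans (≡.cong (_∸ a) other) (ℕₚ.m+n∸m≡n a _)

  q^≈P : q ^ (2 ℕ.* k ℕ.+ 2) ≈ P
  q^≈P = trans (^-congʳ q other) (^-homo-* q a (a ℕ.+ 4 ℕ.* suc m))

  h : ℕ → Carrier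
  h n = ⟦ inv (poch (+ 1) (2 ℕ.* k ℕ.+ 2) (2 ℕ.* k ℕ.+ 2) n) ⟧

  h-inverse : ∀ n → riseAt P (- P) n * h n ≈ 1#
  h-inverse n = trans (*-congʳ (sym (poch⁺≈rise (2 ℕ.* k ℕ.+ 2) (2 ℕ.* k ℕ.+ 2) q^≈P q^≈P n)))
    (inverseʳ (poch (+ 1) (2 ℕ.* k ℕ.+ 2) (2 ℕ.* k ℕ.+ 2) n) (poch-constant (+ 1) _ (2 ℕ.* k ℕ.+ 2) n))

  S : QData R
  S = record { q = q ; I = I ; I-inverse = I-inverse ; J = J ; J-inverse = J-inverse }

  open ChainPowers R S using (q^-+; qQ^j)
  open ChainLimit R S M′ q^≈0 using (module Target)
  open Target a m (s≤s z≤n) h h-inverse using (target; total-β)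
  open MultiSum R S M q^≈0 l (ℕₚ.m≤m+n M M) public using (box)
  open MultiSum R S M q^≈0 l (ℕₚ.m≤m+n M M) using (box-cong; term; box-term; term≈0)

  gauss-square : ∀ n → gauss q n ≈ ⟦ mono (n ℕ.* n) ⟧
  gauss-square n = trans (go n) (sym (mono≈q^ (n ℕ.* n)))
    where
    go : ∀ n → gauss q n ≈ q ^ (n ℕ.* n)
    go zero    = refl
    go (suc n) = trans (*-cong (go n) (qQ^j n)) (q^-+ (n ℕ.* n) (suc (n ℕ.+ n))
      (solveℕ 1 (λ n → n ⊠ n ⊹ (cst 1 ⊹ (n ⊹ n)) :≡ (cst 1 ⊹ n) ⊠ (cst 1 ⊹ n)) ≡.refl n))

  gauss-shifted-square : ∀ n → gauss (q * Q) n ≈ ⟦ mono (n ℕ.* n ℕ.+ 2 ℕ.* n) ⟧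
  gauss-shifted-square n = trans (go n) (sym (mono≈q^ (n ℕ.* n ℕ.+ 2 ℕ.* n)))
    where
    go : ∀ n → gauss (q * Q) n ≈ q ^ (n ℕ.* n ℕ.+ 2 ℕ.* n)
    go zero    = refl
    go (suc n) = trans (*-cong (go n) (trans (*-assoc q Q (Q ^ n)) (qQ^j (suc n)))) (q^-+ (n ℕ.* n ℕ.+ 2 ℕ.* n) (suc (suc n ℕ.+ suc n))
      (solveℕ 1 (λ n → n ⊠ n ⊹ cst 2 ⊠ n ⊹ (cst 1 ⊹ ((cst 1 ⊹ n) ⊹ (cst 1 ⊹ n)))
        :≡ (cst 1 ⊹ n) ⊠ (cst 1 ⊹ n) ⊹ cst 2 ⊠ (cst 1 ⊹ n)) ≡.refl n))

  mono-+ : ∀ d e → ⟦ mono (d ℕ.+ e) ⟧ ≈ ⟦ mono d ⟧ * ⟦ mono e ⟧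
  mono-+ d e = trans (mono≈q^ (d ℕ.+ e)) (trans (^-homo-* q d e) (sym (*-cong (mono≈q^ d) (mono≈q^ e))))

  private
    ⟦⟧-⊛³ : ∀ f g h → ⟦ f ⊛ g ⊛ h ⟧ ≈ ⟦ f ⟧ * ⟦ g ⟧ * ⟦ h ⟧
    ⟦⟧-⊛³ f g h = trans (⟦⟧-⊛ (f ⊛ g) h) (*-congʳ (⟦⟧-⊛ f g))

  prodPS-suc : ∀ n F → ⟦ prodPS (suc n) F ⟧ ≈ ⟦ F 0 ⟧ * ⟦ prodPS n (λ j → F (suc j)) ⟧
  prodPS-suc zero    F = trans (⟦⟧-⊛ one (F 0)) (*-comm _ _)
  prodPS-suc (suc n) F = begin
    ⟦ prodPS (suc n) F ⊛ F (suc n) ⟧                               ≈⟨ ⟦⟧-⊛ (prodPS (suc n) F) (F (suc n)) ⟩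
    ⟦ prodPS (suc n) F ⟧ * ⟦ F (suc n) ⟧                           ≈⟨ *-congʳ (prodPS-suc n F) ⟩
    ⟦ F 0 ⟧ * ⟦ prodPS n (λ j → F (suc j)) ⟧ * ⟦ F (suc n) ⟧       ≈⟨ *-assoc _ _ _ ⟩
    ⟦ F 0 ⟧ * (⟦ prodPS n (λ j → F (suc j)) ⟧ * ⟦ F (suc n) ⟧)     ≈⟨ *-congˡ (sym (⟦⟧-⊛ (prodPS n (λ j → F (suc j))) (F (suc n)))) ⟩
    ⟦ F 0 ⟧ * ⟦ prodPS (suc n) (λ j → F (suc j)) ⟧                 ∎

  -- `inv` is computed by a recurrence, so its multiplicativity is obtained from the uniqueness of
  -- inverses.
  inv-denom : ∀ {K} x (v : Vec ℕ (suc K)) → ⟦ inv (denom (3 ℕ.+ K) (x ∷ v)) ⟧ ≈ I x * ⟦ inv (denom (2 ℕ.+ K) v) ⟧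
  inv-denom {K} x v = inverse-unique
    (inverseʳ (denom (3 ℕ.+ K) (x ∷ v)) (denom-constant (suc K) (x ∷ v)))
    (begin
      ⟦ poch (+ 1) 2 2 x ⟧ * ⟦ denom (2 ℕ.+ K) v ⟧ * (I x * ⟦ inv (denom (2 ℕ.+ K) v) ⟧)
        ≈⟨ solve 4 (λ a b c d → a :* b :* (c :* d) := a :* c :* (b :* d)) refl _ _ _ _ ⟩
      ⟦ poch (+ 1) 2 2 x ⟧ * I x * (⟦ denom (2 ℕ.+ K) v ⟧ * ⟦ inv (denom (2 ℕ.+ K) v) ⟧)
        ≈⟨ *-cong (inverseʳ (poch (+ 1) 2 2 x) (poch-constant (+ 1) 1 2 x)) (inverseʳ (denom (2 ℕ.+ K) v) (denom-constant K v)) ⟩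
      1# * 1#
        ≈⟨ *-identityˡ 1# ⟩
      1# ∎)
    (begin
      ⟦ prodPS (suc K) F ⊛ last ⟧
        ≈⟨ ⟦⟧-⊛ (prodPS (suc K) F) last ⟩
      ⟦ prodPS (suc K) F ⟧ * ⟦ last ⟧
        ≈⟨ *-congʳ (prodPS-suc K F) ⟩
      ⟦ F 0 ⟧ * ⟦ prodPS K (λ j → F (suc j)) ⟧ * ⟦ last ⟧
        ≈⟨ *-assoc _ _ _ ⟩
      ⟦ F 0 ⟧ * (⟦ prodPS K (λ j → F (suc j)) ⟧ * ⟦ last ⟧)
        ≈⟨ *-congˡ (sym (⟦⟧-⊛ (prodPS K (λ j → F (suc j))) last)) ⟩
      ⟦ poch (+ 1) 2 2 x ⟧ * ⟦ denom (2 ℕ.+ K) v ⟧ ∎)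
    where
    F : ℕ → PS
    F j = poch (+ 1) 2 2 (nAt (x ∷ v) (suc j))
    last : PS
    last = poch (+ 1) 4 4 (nAt v (suc K))

  lhsTerm≈term : ∀ {K a m} (C : Chain K a m) v → ⟦ lhsTerm (2 ℕ.+ K) a v ⟧ ≈ term C v

  private
    level : ∀ {K a m} (C : Chain K a m) a₊ x (v : Vec ℕ (suc K)) e {g} → ⟦ mono e ⟧ ≈ g →
      expo (3 ℕ.+ K) a₊ (x ∷ v) ≡ e ℕ.+ expo (2 ℕ.+ K) a v →
      ⟦ lhsTerm (3 ℕ.+ K) a₊ (x ∷ v) ⟧ ≈ g * (I x * term C v)
    level {K} {a} C a₊ x v e {g} e≈g expo≡ = begin
      ⟦ mono (expo (3 ℕ.+ K) a₊ (x ∷ v)) ⊛ p ⊛ inv (denom (3 ℕ.+ K) (x ∷ v)) ⟧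
        ≈⟨ ⟦⟧-⊛³ (mono (expo (3 ℕ.+ K) a₊ (x ∷ v))) p (inv (denom (3 ℕ.+ K) (x ∷ v))) ⟩
      ⟦ mono (expo (3 ℕ.+ K) a₊ (x ∷ v)) ⟧ * ⟦ p ⟧ * ⟦ inv (denom (3 ℕ.+ K) (x ∷ v)) ⟧
        ≈⟨ *-cong (*-congʳ (trans (reflexive (≡.cong (λ i → ⟦ mono i ⟧) expo≡)) (trans (mono-+ e e′) (*-congʳ e≈g)))) (inv-denom x v) ⟩
      g * ⟦ mono e′ ⟧ * ⟦ p ⟧ * (I x * ⟦ inv (denom (2 ℕ.+ K) v) ⟧)
        ≈⟨ solve 5 (λ g e p i d → g :* e :* p :* (i :* d) := g :* (i :* (e :* p :* d))) refl _ _ _ _ _ ⟩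
      g * (I x * (⟦ mono e′ ⟧ * ⟦ p ⟧ * ⟦ inv (denom (2 ℕ.+ K) v) ⟧))
        ≈⟨ *-congˡ (*-congˡ (sym (⟦⟧-⊛³ (mono e′) p (inv (denom (2 ℕ.+ K) v))))) ⟩
      g * (I x * ⟦ lhsTerm (2 ℕ.+ K) a v ⟧)
        ≈⟨ *-congˡ (*-congˡ (lhsTerm≈term C v)) ⟩
      g * (I x * term C v) ∎
      where
      e′ = expo (2 ℕ.+ K) a v
      p = poch -[1+ 0 ] 1 2 (nAt v (suc K))

  lhsTerm≈term base (x ∷ []) = begin
    ⟦ lhsTerm 2 1 (x ∷ []) ⟧
      ≈⟨ ⟦⟧-⊛³ (mono (N ℕ.* N ℕ.+ 2 ℕ.* N)) (poch -[1+ 0 ] 1 2 x) (inv (denom 2 (x ∷ []))) ⟩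
    ⟦ mono (N ℕ.* N ℕ.+ 2 ℕ.* N) ⟧ * ⟦ poch -[1+ 0 ] 1 2 x ⟧ * ⟦ inv (denom 2 (x ∷ [])) ⟧
      ≈⟨ *-cong (*-cong (sym (gauss-shifted-square N)) (poch⁻≈rise 1 2 (*-identityʳ q) q^2≈Q x))
           (inverse-unique (inverseʳ (denom 2 (x ∷ [])) (denom-constant 0 (x ∷ []))) (inverseʳ (poch (+ 1) 4 4 x) (poch-constant (+ 1) 3 4 x))
             (⟦⟧-≗ (one-⊛ (poch (+ 1) 4 4 x)))) ⟩
    gauss (q * Q) N * rise q x * J x
      ≈⟨ *-assoc _ _ _ ⟩
    term base (x ∷ []) ∎
    where N = Nt (x ∷ []) 1
  lhsTerm≈term {suc K} (turn C)  (x ∷ v) = level C 1 x v (N ℕ.* N ℕ.+ 2 ℕ.* N) (sym (gauss-shifted-square N)) (expo-turn K x v)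
    where N = Nt (x ∷ v) 1
  lhsTerm≈term {suc K} {suc (suc a)} (plain C) (x ∷ v) = level C (suc (suc a)) x v (N ℕ.* N) (sym (gauss-square N)) (expo-plain K a x v)
    where N = Nt (x ∷ v) 1

  rhs≈target : ⟦ rhs k a ⟧ ≈ target
  rhs≈target = begin
    ⟦ f₁ ⊛ f₂ ⊛ f₃ ⊛ f₄ ⊛ f₅ ⟧
      ≈⟨ trans (⟦⟧-⊛³ (f₁ ⊛ f₂ ⊛ f₃) f₄ f₅) (*-congʳ (*-congʳ (⟦⟧-⊛³ f₁ f₂ f₃))) ⟩
    ⟦ f₁ ⟧ * ⟦ f₂ ⟧ * ⟦ f₃ ⟧ * ⟦ f₄ ⟧ * ⟦ f₅ ⟧
      ≈⟨ *-cong (*-cong (*-cong (*-cong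
           (trans (⟦⟧-cong (pochInf-poch -[1+ 0 ] 1 1 M)) (poch⁻≈rise 1 2 (*-identityʳ q) q^2≈Q M))
           (trans (⟦⟧-cong (pochInf-poch (+ 1) a _ M)) (poch⁺≈rise a b refl q^≈P M)))
           (trans (⟦⟧-cong (pochInf-poch (+ 1) (b ∸ a) _ M)) (poch⁺≈rise (b ∸ a) b (^-congʳ q other-∸) q^≈P M)))
           (trans (⟦⟧-cong (pochInf-poch (+ 1) b _ M)) (poch⁺≈rise b b q^≈P q^≈P M)))
           (inverse-unique (inverseʳ (pochInf (+ 1) 2 2) (poch-constant (+ 1) 1 2 1))
             (inverseʳ (poch (+ 1) 2 2 M) (poch-constant (+ 1) 1 2 M)) (⟦⟧-cong (pochInf-poch (+ 1) 2 1 M))) ⟩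
    rise q M * riseAt P (- z) M * riseAt P (- w) M * riseAt P (- P) M * I M
      ≈⟨ solve 5 (λ r x y s i → r :* x :* y :* s :* i := r :* (s :* (x :* y)) :* i) refl _ _ _ _ _ ⟩
    target ∎
    where
    b = 2 ℕ.* k ℕ.+ 2
    f₁ f₂ f₃ f₄ f₅ : PS
    f₁ = pochInf -[1+ 0 ] 1 2
    f₂ = pochInf (+ 1) a b
    f₃ = pochInf (+ 1) (b ∸ a) b
    f₄ = pochInf (+ 1) b b
    f₅ = inv (pochInf (+ 1) 2 2)

  lhsTerm≈0 : Chain K a m → ∀ v → l < Nt v 1 → ⟦ lhsTerm k a v ⟧ ≈ 0#
  lhsTerm≈0 C v l<N = trans (lhsTerm≈term C v) (term≈0 C v l<N)

  box-lhsTerm : Chain K a m → box (suc K) (λ v → ⟦ lhsTerm k a v ⟧) ≈ ⟦ rhs k a ⟧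
  box-lhsTerm C = trans (box-cong (suc K) (lhsTerm≈term C)) (trans (box-term C) (trans (total-β C) (sym rhs≈target)))

-- Coefficients and summability

psRealisation : ∀ M → Realisation (psRing M) M
psRealisation M = record
  { ⟦_⟧     = λ f → f
  ; ⟦⟧-cong = λ f≋g → f≋g
  ; ⟦⟧-⊕    = λ _ _ _ _ → ≡.refl
  ; ⟦⟧-⊛    = λ _ _ _ _ → ≡.refl
  ; ⟦⟧-neg  = λ _ _ _ → ≡.refl
  ; ⟦⟧-zero = λ _ _ → ≡.refl
  ; ⟦⟧-one  = λ _ _ → ≡.refl }

anti-coefficient : ∀ M n f i → Antidiagonal.anti (psRing M) n f i ≡ antiℤ n (λ x y → f x y i)
anti-coefficient M zero    f i = ≡.refl
anti-coefficient M (suc n) f i = ≡.cong (λ c → f 0 (suc n) i ℤ.+ c) (anti-coefficient M n (λ x y → f (suc x) y) i)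

All-< : ∀ {n B} (v : Vec ℕ n) → Nt v 1 < B → All (_< B) v
All-< []      _   = []
All-< (x ∷ v) N<B = ℕₚ.≤-<-trans (ℕₚ.m≤m+n x _) N<B ∷ All-< v (ℕₚ.≤-<-trans (ℕₚ.m≤n+m _ x) N<B)

-- The coefficient of q^n is read off modulo q^(n+1). A vector outside the box of side l + 1 has N₁
-- > l, where the summand vanishes modulo q^(n+1).
hasSum : ∀ a′ m → Chain (a′ ℕ.+ m ℕ.* 2) (suc a′) m →
  HasSum (suc (a′ ℕ.+ m ℕ.* 2)) (lhsTerm (2 ℕ.+ (a′ ℕ.+ m ℕ.* 2)) (suc a′)) (rhs (2 ℕ.+ (a′ ℕ.+ m ℕ.* 2)) (suc a′))
hasSum a′ m C n = suc l , outside , inside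
  where
  open Identity (psRing (suc n)) n a′ m (psRealisation (suc n)) using (l; k; a; K; box; lhsTerm≈0; box-lhsTerm)
  boxSum≡box : ∀ K F → boxSum K (suc l) (λ v → F v n) ≡ box K F n
  boxSum≡box zero    F = ≡.refl
  boxSum≡box (suc K) F = ≡.trans
    (Σ<-anti l _ _ (λ x y _ → boxSum≡box K (λ v → F (x ∷ v))))
    (≡.sym (anti-coefficient (suc n) l (λ x _ → box K (λ v → F (x ∷ v))) n))
  outside : ∀ v → ¬ All (_< suc l) v → lhsTerm k a v n ≡ + 0
  outside v ¬all with Nt v 1 ℕₚ.<? suc l
  ... | yes N<B = ⊥-elim (¬all (All-< v N<B))
  ... | no  N≮B = lhsTerm≈0 C v (ℕₚ.≮⇒≥ N≮B) n ℕₚ.≤-refl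
  inside : boxSum (suc K) (suc l) (λ v → lhsTerm k a v n) ≡ rhs k a n
  inside = ≡.trans (boxSum≡box (suc K) (lhsTerm k a)) (box-lhsTerm C n ℕₚ.≤-refl)

-- The a - 1 levels without linear term are peeled off first; at a = 1 a linear level leads back to
-- a = 2 with one linear term fewer.
chain : ∀ m a′ → Chain (a′ ℕ.+ m ℕ.* 2) (suc a′) m
chain zero    zero     = base
chain (suc m) zero     = turn (chain m 1)
chain m       (suc a′) = plain (chain m a′)

odd-difference : ∀ {k a} → a ≤ k → ¬ (k % 2 ≡ a % 2) → ∃[ m ] k ≡ a ℕ.+ suc (m ℕ.* 2)
odd-difference {k} {a} a≤k k≢a = go ((k ∸ a) % 2) ((k ∸ a) / 2) (m%n<n (k ∸ a) 2)
  (≡.trans (≡.sym (ℕₚ.m+[n∸m]≡n a≤k)) (≡.cong (a ℕ.+_) (m≡m%n+[m/n]*n (k ∸ a) 2)))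
  where
  go : ∀ r m → r < 2 → k ≡ a ℕ.+ (r ℕ.+ m ℕ.* 2) → ∃[ m ] k ≡ a ℕ.+ suc (m ℕ.* 2)
  go zero          m _ k≡ = ⊥-elim (k≢a (≡.trans (≡.cong (_% 2) k≡) ([m+kn]%n≡m%n a m 2)))
  go (suc zero)    m _ k≡ = m , k≡
  go (suc (suc r)) m (s≤s (s≤s ())) _

theorem1p5 : (k a : ℕ) → 1 ≤ a → a ≤ k → ¬ (k % 2 ≡ a % 2)
    → HasSum (k ∸ 1) (lhsTerm k a) (rhs k a)
theorem1p5 k (suc a′) _ a≤k k≢a with odd-difference a≤k k≢a
-- k is brought to the form 2 + (a′ + 2m), in which `hasSum` is stated.
... | m , k≡ with ≡.trans k≡ (≡.cong suc (ℕₚ.+-suc a′ (m ℕ.* 2)))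
... | ≡.refl = hasSum a′ m (chain m a′)
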